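{- For every sufficiently small constant $\varepsilon>0$ there exist a constant $\delta=\delta(\varepsilon)>0$, depending only on $\varepsilon$, and a constant $C>0$ such that the following holds: for every sufficiently large prime $p$ and every positive odd integer $n$ with $n \mid p-1$ and $n>p^{\varepsilon}$, one has $k(p,n)\le C\,p^{1-\delta}$.
   Context: Let $p$ be a prime and $n$ a positive odd integer with $n\mid p-1$. Define $k(p,n)$ to be the least positive integer $k$ such that, as $x$ ranges over $\{ -k,\dots,-1,1,2,\dots,k\}$, the residues $x^n \bmod p$ include every non-zero $n$-th power residue modulo $p$, i.e. every $m\not\equiv 0 \pmod p$ for which $x^n\equiv m\pmod p$ is solvable. -}

module Defs where

open import Data.Nat as ℕ using (ℕ; _<_; _≤_; _∸_)
open import Data.Integer as ℤ using (ℤ; +_; ∣_∣)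
open import Data.Integer.Divisibility as ℤD using ()
open import Data.Product using (∃-syntax; _×_)
open import Relation.Nullary using (¬_)

NthPowerResidue : ℕ → ℕ → ℕ → Set
NthPowerResidue p n m = 0 < m × m < p × ∃[ y ] (+ p) ℤD.∣ (y ℤ.^ n ℤ.- + m)

Covers : ℕ → ℕ → ℕ → Set
Covers p n k = ∀ m → NthPowerResidue p n m →
  ∃[ x ] (1 ≤ ∣ x ∣ × ∣ x ∣ ≤ k × (+ p) ℤD.∣ (x ℤ.^ n ℤ.- + m))

IsKpn : ℕ → ℕ → ℕ → Set
IsKpn p n k = 0 < k × Covers p n k × (∀ j → 0 < j → j < k → ¬ Covers p n j)

{-# OPTIONS --safe #-}
module Submission where

-- Let H be the group of n-th roots of unity mod p, |H| ≥ n. The solutions of xⁿ ≡ m form a coset of H, so it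
-- suffices that every coset xH meets [-L, L] for some L ≪ p^(1-δ). If xH avoids this interval, let f be the
-- balanced indicator of [0, L), ψ(y) = Σ f(t) f(t + y) and S(y) = Σ_{h ∈ H} ψ(yh). Then |S(x)| is large, and by
-- positive definiteness of ψ the level sets of |S| (which are H-invariant, and of size ≪ p^(1+o(1)) / |H| by a
-- second moment bound playing the role of Parseval) satisfy: for many pairs y, y′ in one level set, y - y′ lies
-- in the next one. By pigeonhole two consecutive level sets have comparable sizes, so Balog–Szemerédi–Gowers
-- gives A′ inside a level set with |A′ - A′| ≪ |A′|. The ξ for which ξB is covered by few translates of B, for B
-- a set of sums of popular differences of A′, are closed under ring operations with controlled losses and, by
-- H-invariance, contain a large part of H. Starting from that part X, either (X - X)/(X - X) is the whole field,
-- or some ξ in it has ξ + 1 outside, and then (c - d)X + (a - b + c - d)X with ξ = (a - b)/(c - d) has |X|²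
-- elements. After boundedly many steps all ξ in the field satisfy |B + ξB| ≪ |B|, and averaging the additive
-- energy of B and ξB over ξ shows that B has about 1 or about p elements, which is impossible.

open import Defs
open import Algebra.Bundles using (CommutativeRing)
import Algebra.Properties.CommutativeMonoid.Sum as MonoidSum
import Algebra.Properties.Semiring.Sum as SemiringSum
import Algebra.Solver.Ring as RingSolver
open import Algebra.Solver.Ring.AlmostCommutativeRing using (AlmostCommutativeRing; fromCommutativeRing; _-Raw-AlmostCommutative⟶_)
open import Algebra.Structures using (IsCommutativeRing)
open import Data.Bool as Bool using (Bool; true; false; _∧_; not; if_then_else_)
open import Data.Empty using (⊥; ⊥-elim)
open import Data.Fin as Fin using (Fin; zero; suc; toℕ; fromℕ<)
open import Data.Fin.Permutation using (permutation)
import Data.Fin.Properties as Fin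
open import Data.Integer as ℤ using (ℤ; +_; -[1+_]; ∣_∣)
import Data.Integer.DivMod as ℤ
open import Data.Integer.Divisibility.Signed as ℤ∣ using () renaming (_∣_ to _∣ᶻ_)
import Data.Integer.Properties as ℤₚ
open import Data.Integer.Tactic.RingSolver using () renaming (solve-∀ to solveᶻ-∀)
open import Data.List using (List; []; _∷_; length; map; allFin; cartesianProductWith)
open import Data.List.Membership.Propositional using (_∈_)
open import Data.List.Membership.Propositional.Properties using (∈-allFin; ∈-cartesianProductWith⁺)
open import Data.List.Properties using (length-map; length-++)
open import Data.List.Relation.Unary.Any using (here; there)
open import Data.Maybe using (Maybe; just; nothing)
open import Data.Nat
open import Data.Nat.Coprimality using (prime⇒coprime; coprime-Bézout)
open import Data.Nat.DivMod using (m%n<n; m≡m%n+[m/n]*n; m/n*n≤m)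
open import Data.Nat.Divisibility using (_∣_; ∣⇒≤; divides)
open import Data.Nat.GCD using (module Bézout)
open import Data.Nat.Primality using (Prime; prime⇒nonZero; prime⇒nonTrivial; euclidsLemma)
open import Data.Nat.Properties
open import Data.Nat.Solver using (module +-*-Solver)
open import Data.Nat.Tactic.RingSolver using (solve-∀)
open import Data.Product using (∃-syntax; _×_; _,_; proj₁; proj₂)
open import Data.Sum using (_⊎_; inj₁; inj₂)
open import Data.Unit using (tt)
open import Data.Vec using (Vec; []; _∷_; replicate)
open import Function using (_∘_)
open import Level using (0ℓ)
open import Relation.Binary.PropositionalEquality hiding (J)
open import Relation.Nullary using (Dec; yes; no; does; ¬_; ¬?; _×-dec_; _⊎-dec_)
open import Relation.Nullary.Decidable using (decidable-stable; toWitness)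

-- Finite sums and cardinalities

-- The usual tool would be exponential sums over H; here everything is an integer count. `ψ` plays
-- the part of a function with nonnegative Fourier transform, and that positivity enters only
-- through Cauchy-Schwarz and sums of squares. Passing to differences weakens the threshold defining
-- a level set, so no level set need be closed under subtraction. The chain can only be slow to
-- grow, since each of its members has between |H| and p elements; this yields many pairs with
-- difference in a comparable set, not small doubling itself. A level set close to the whole field
-- would be compatible with additive structure; it is ruled out because |A| |H| ≤ p K while |H|
-- exceeds the powers of K that occur. All losses are powers of one number K = R^(3^I), where R is
-- about p^δ and the exponents depend on b only. In the end the contradiction asks for K^W < n with
-- a fixed W, and this inequality determines δ.

module FiniteSums where

  module ℕΣ = SemiringSum +-*-semiring
  module ℤΣ = SemiringSum ℤₚ.+-*-semiring

  private
    variable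
      m n : ℕ

  opaque
    ∑ : (Fin n → ℕ) → ℕ
    ∑ = ℕΣ.sum

    ∑ᶻ : (Fin n → ℤ) → ℤ
    ∑ᶻ = ℤΣ.sum

    ∑-cong : {f g : Fin n → ℕ} → (∀ i → f i ≡ g i) → ∑ f ≡ ∑ g
    ∑-cong = ℕΣ.sum-cong-≗

    ∑ᶻ-cong : {f g : Fin n → ℤ} → (∀ i → f i ≡ g i) → ∑ᶻ f ≡ ∑ᶻ g
    ∑ᶻ-cong = ℤΣ.sum-cong-≗

    ∑-+ : (f g : Fin n → ℕ) → ∑ (λ i → f i + g i) ≡ ∑ f + ∑ g
    ∑-+ = ℕΣ.∑-distrib-+

    ∑ᶻ-+ : (f g : Fin n → ℤ) → ∑ᶻ (λ i → f i ℤ.+ g i) ≡ ∑ᶻ f ℤ.+ ∑ᶻ g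
    ∑ᶻ-+ = ℤΣ.∑-distrib-+

    *-∑ : ∀ c (f : Fin n → ℕ) → c * ∑ f ≡ ∑ (λ i → c * f i)
    *-∑ = ℕΣ.*-distribˡ-sum

    ∑-*ʳ : ∀ c (f : Fin n → ℕ) → ∑ f * c ≡ ∑ (λ i → f i * c)
    ∑-*ʳ = ℕΣ.*-distribʳ-sum

    *-∑ᶻ : ∀ c (f : Fin n → ℤ) → c ℤ.* ∑ᶻ f ≡ ∑ᶻ (λ i → c ℤ.* f i)
    *-∑ᶻ = ℤΣ.*-distribˡ-sum

    ∑ᶻ-*ʳ : ∀ c (f : Fin n → ℤ) → ∑ᶻ f ℤ.* c ≡ ∑ᶻ (λ i → f i ℤ.* c)
    ∑ᶻ-*ʳ = ℤΣ.*-distribʳ-sum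

    ∑-comm : (f : Fin m → Fin n → ℕ) → ∑ (λ i → ∑ (f i)) ≡ ∑ (λ j → ∑ λ i → f i j)
    ∑-comm = ℕΣ.∑-comm

    ∑ᶻ-comm : (f : Fin m → Fin n → ℤ) → ∑ᶻ (λ i → ∑ᶻ (f i)) ≡ ∑ᶻ (λ j → ∑ᶻ λ i → f i j)
    ∑ᶻ-comm = ℤΣ.∑-comm

    ∑-reindex : (f : Fin n → ℕ) (σ τ : Fin n → Fin n) → (∀ x → σ (τ x) ≡ x) → (∀ x → τ (σ x) ≡ x) → ∑ (λ x → f (σ x)) ≡ ∑ f
    ∑-reindex f σ τ στ τσ = sym (ℕΣ.sum-permute f (permutation σ τ στ τσ))

    ∑ᶻ-reindex : (f : Fin n → ℤ) (σ τ : Fin n → Fin n) → (∀ x → σ (τ x) ≡ x) → (∀ x → τ (σ x) ≡ x) → ∑ᶻ (λ x → f (σ x)) ≡ ∑ᶻ f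
    ∑ᶻ-reindex f σ τ στ τσ = sym (ℤΣ.sum-permute f (permutation σ τ στ τσ))

    ∑-mono : {f g : Fin n → ℕ} → (∀ i → f i ≤ g i) → ∑ f ≤ ∑ g
    ∑-mono {zero}  h = z≤n
    ∑-mono {suc n} h = +-mono-≤ (h zero) (∑-mono (h ∘ suc))

    ∑-const : ∀ n c → ∑ {n} (λ _ → c) ≡ n * c
    ∑-const zero    c = refl
    ∑-const (suc n) c = cong (_+_ c) (∑-const n c)

    ∑ᶻ-0 : ∀ n → ∑ᶻ {n} (λ _ → + 0) ≡ + 0
    ∑ᶻ-0 = ℤΣ.sum-replicate-zero

    ≤-∑ : (f : Fin n → ℕ) (i : Fin n) → f i ≤ ∑ f
    ≤-∑ f zero    = m≤m+n _ _
    ≤-∑ f (suc i) = ≤-trans (≤-∑ (f ∘ suc) i) (m≤n+m _ (f zero))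

    ∑-<⇒∃ : {f g : Fin n → ℕ} → ∑ f < ∑ g → ∃[ i ] f i < g i
    ∑-<⇒∃ {suc n} {f} {g} ∑f<∑g with f zero <? g zero
    ... | yes f<g = zero , f<g
    ... | no  f≮g = let i , h = ∑-<⇒∃ (+-cancelˡ-< (f zero) _ _ (<-≤-trans ∑f<∑g (+-monoˡ-≤ _ (≮⇒≥ f≮g)))) in suc i , h

    ∑ᶻ-pos : (f : Fin n → ℕ) → ∑ᶻ (λ i → + f i) ≡ + ∑ f
    ∑ᶻ-pos {zero}  f = refl
    ∑ᶻ-pos {suc n} f = cong (ℤ._+_ (+ f zero)) (∑ᶻ-pos (f ∘ suc))

    ∑ᶻ-single : (f : Fin n → ℤ) (a : Fin n) → (∀ i → i ≢ a → f i ≡ + 0) → ∑ᶻ f ≡ f a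
    ∑ᶻ-single {suc n} f zero h = trans (cong (ℤ._+_ (f zero)) (trans (∑ᶻ-cong λ i → h (suc i) λ ()) (∑ᶻ-0 n))) (ℤₚ.+-identityʳ _)
    ∑ᶻ-single {suc n} f (suc a) h = trans (cong₂ ℤ._+_ (h zero λ ()) (∑ᶻ-single (f ∘ suc) a λ i i≢a → h (suc i) λ { refl → i≢a refl })) (ℤₚ.+-identityˡ _)

    ∣∑ᶻ∣≤∑∣∣ : (f : Fin n → ℤ) → ∣ ∑ᶻ f ∣ ≤ ∑ (λ i → ∣ f i ∣)
    ∣∑ᶻ∣≤∑∣∣ {zero}  f = z≤n
    ∣∑ᶻ∣≤∑∣∣ {suc n} f = ≤-trans (ℤₚ.∣i+j∣≤∣i∣+∣j∣ (f zero) _) (+-monoʳ-≤ ∣ f zero ∣ (∣∑ᶻ∣≤∑∣∣ (f ∘ suc)))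

  ∑>0⇒∃ : (f : Fin n → ℕ) → 0 < ∑ f → ∃[ i ] 0 < f i
  ∑>0⇒∃ {n} f 0<∑ = ∑-<⇒∃ (subst (_< ∑ f) (sym (trans (∑-const n 0) (*-zeroʳ n))) 0<∑)

  ∑-* : (f : Fin m → ℕ) (g : Fin n → ℕ) → ∑ f * ∑ g ≡ ∑ (λ i → ∑ λ j → f i * g j)
  ∑-* f g = trans (∑-*ʳ (∑ g) f) (∑-cong λ i → *-∑ (f i) g)

  2ab≤a²+b² : ∀ a b → 2 * (a * b) ≤ a * a + b * b
  2ab≤a²+b² a b with ≤-total a b
  ... | inj₁ a≤b = subst (λ b → 2 * (a * b) ≤ a * a + b * b) (m+[n∸m]≡n a≤b) (lemma a (b ∸ a))
    where
    identity : ∀ a c → a * a + (a + c) * (a + c) ≡ 2 * (a * (a + c)) + c * c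
    identity = solve-∀
    lemma : ∀ a c → 2 * (a * (a + c)) ≤ a * a + (a + c) * (a + c)
    lemma a c = ≤-trans (m≤m+n _ (c * c)) (≤-reflexive (sym (identity a c)))
  ... | inj₂ b≤a = subst (λ a → 2 * (a * b) ≤ a * a + b * b) (m+[n∸m]≡n b≤a) (lemma b (a ∸ b))
    where
    identity : ∀ a c → (a + c) * (a + c) + a * a ≡ 2 * ((a + c) * a) + c * c
    identity = solve-∀
    lemma : ∀ a c → 2 * ((a + c) * a) ≤ (a + c) * (a + c) + a * a
    lemma a c = ≤-trans (m≤m+n _ (c * c)) (≤-reflexive (sym (identity a c)))

  -- After doubling, the pair (i, j) contributes 2 (u i v j)(u j v i) on the left, which is at most
  -- the sum of the squares of the two factors.
  cauchy-schwarz : (u v : Fin n → ℕ) → ∑ (λ i → u i * v i) * ∑ (λ i → u i * v i) ≤ ∑ (λ i → u i * u i) * ∑ (λ i → v i * v i)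
  cauchy-schwarz {n} u v = *-cancelˡ-≤ 2 (begin
    2 * (∑ uv * ∑ uv)  ≡⟨ cong (2 *_) (∑-* uv uv) ⟩
    2 * ∑ (λ i → ∑ λ j → uv i * uv j)  ≡⟨ *-∑ 2 (λ i → ∑ λ j → uv i * uv j) ⟩
    ∑ (λ i → 2 * ∑ λ j → uv i * uv j)  ≡⟨ ∑-cong (λ i → *-∑ 2 (λ j → uv i * uv j)) ⟩
    ∑ (λ i → ∑ λ j → 2 * (uv i * uv j))  ≤⟨ ∑-mono (λ i → ∑-mono λ j → pointwise (u i) (v i) (u j) (v j)) ⟩
    ∑ (λ i → ∑ λ j → uu i * vv j + uu j * vv i)  ≡⟨ ∑-cong (λ i → ∑-+ (λ j → uu i * vv j) (λ j → uu j * vv i)) ⟩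
    ∑ (λ i → ∑ (λ j → uu i * vv j) + ∑ (λ j → uu j * vv i))  ≡⟨ ∑-+ (λ i → ∑ (λ j → uu i * vv j)) (λ i → ∑ (λ j → uu j * vv i)) ⟩
    ∑ (λ i → ∑ (λ j → uu i * vv j)) + ∑ (λ i → ∑ (λ j → uu j * vv i))  ≡⟨ cong₂ _+_ (sym (∑-* uu vv)) (trans (∑-comm (λ i j → uu j * vv i)) (sym (∑-* uu vv))) ⟩
    ∑ uu * ∑ vv + ∑ uu * ∑ vv  ≡⟨ cong (_+_ (∑ uu * ∑ vv)) (sym (+-identityʳ _)) ⟩
    2 * (∑ uu * ∑ vv)  ∎)
    where
    open ≤-Reasoning
    uv uu vv : Fin n → ℕ
    uv i = u i * v i
    uu i = u i * u i
    vv i = v i * v i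
    lhs : ∀ a b c d → 2 * ((a * b) * (c * d)) ≡ 2 * ((a * d) * (c * b))
    lhs = solve-∀
    rhs : ∀ a b c d → (a * d) * (a * d) + (c * b) * (c * b) ≡ (a * a) * (d * d) + (c * c) * (b * b)
    rhs = solve-∀
    pointwise : ∀ a b c d → 2 * ((a * b) * (c * d)) ≤ (a * a) * (d * d) + (c * c) * (b * b)
    pointwise a b c d = ≤-trans (≤-reflexive (lhs a b c d)) (≤-trans (2ab≤a²+b² (a * d) (c * b)) (≤-reflexive (rhs a b c d)))

  -- Cauchy-Schwarz against the indicator of the support of `r`, which `w` only has to dominate. It
  -- serves to bound a sum of squares from below when the support is small.
  cauchy-schwarz-support : (r w : Fin n → ℕ) → (∀ i → r i ≡ 0 ⊎ 1 ≤ w i) → ∑ r * ∑ r ≤ ∑ w * ∑ (λ i → r i * r i)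
  cauchy-schwarz-support {n} r w supp = begin
    ∑ r * ∑ r  ≡⟨ cong₂ _*_ (∑-cong r≡ur) (∑-cong r≡ur) ⟩
    ∑ (λ i → u (r i) * r i) * ∑ (λ i → u (r i) * r i)  ≤⟨ cauchy-schwarz (u ∘ r) r ⟩
    ∑ (λ i → u (r i) * u (r i)) * ∑ (λ i → r i * r i)  ≤⟨ *-monoˡ-≤ _ (∑-mono u≤w) ⟩
    ∑ w * ∑ (λ i → r i * r i)  ∎
    where
    open ≤-Reasoning
    u : ℕ → ℕ
    u zero    = 0
    u (suc _) = 1
    r≡ur : ∀ i → r i ≡ u (r i) * r i
    r≡ur i with r i
    ... | zero  = refl
    ... | suc k = sym (*-identityˡ (suc k))
    u≤w : ∀ i → u (r i) * u (r i) ≤ w i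
    u≤w i with r i | supp i
    ... | zero  | _ = z≤n
    ... | suc _ | inj₂ h = h

  cauchy-schwarzᶻ : (u v : Fin n → ℤ) →
    ∣ ∑ᶻ (λ i → u i ℤ.* v i) ∣ * ∣ ∑ᶻ (λ i → u i ℤ.* v i) ∣ ≤ ∑ (λ i → ∣ u i ∣ * ∣ u i ∣) * ∑ (λ i → ∣ v i ∣ * ∣ v i ∣)
  cauchy-schwarzᶻ u v = ≤-trans (*-mono-≤ bound bound) (cauchy-schwarz (∣_∣ ∘ u) (∣_∣ ∘ v))
    where
    bound : ∣ ∑ᶻ (λ i → u i ℤ.* v i) ∣ ≤ ∑ (λ i → ∣ u i ∣ * ∣ v i ∣)
    bound = ≤-trans (∣∑ᶻ∣≤∑∣∣ _) (≤-reflexive (∑-cong λ i → ℤₚ.abs-* (u i) (v i)))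

  ∣i∣²≡i² : ∀ i → + (∣ i ∣ * ∣ i ∣) ≡ i ℤ.* i
  ∣i∣²≡i² (+ n)    = ℤₚ.pos-* n n
  ∣i∣²≡i² -[1+ n ] = refl

  square-cancel-≤ : ∀ {a b} → a * a ≤ b * b → a ≤ b
  square-cancel-≤ {a} {b} h with a ≤? b
  ... | yes a≤b = a≤b
  ... | no  a≰b = ⊥-elim (<⇒≱ (*-mono-< (≰⇒> a≰b) (≰⇒> a≰b)) h)

  ⟦_⟧ : Bool → ℕ
  ⟦ false ⟧ = 0
  ⟦ true  ⟧ = 1

  ⟦⟧≤1 : ∀ b → ⟦ b ⟧ ≤ 1
  ⟦⟧≤1 false = z≤n
  ⟦⟧≤1 true  = ≤-refl

  ⟦⟧-idem : ∀ b → ⟦ b ⟧ * ⟦ b ⟧ ≡ ⟦ b ⟧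
  ⟦⟧-idem false = refl
  ⟦⟧-idem true  = refl

  ⟦⟧*-mono : ∀ b {x y} → (b ≡ true → x ≤ y) → ⟦ b ⟧ * x ≤ ⟦ b ⟧ * y
  ⟦⟧*-mono false h = z≤n
  ⟦⟧*-mono true  h = +-monoˡ-≤ 0 (h refl)

  ⟦⟧*≤ : ∀ b {x y} → (b ≡ true → x ≤ y) → ⟦ b ⟧ * x ≤ y
  ⟦⟧*≤ false h = z≤n
  ⟦⟧*≤ true  h = ≤-trans (≤-reflexive (+-identityʳ _)) (h refl)

  ⟦⟧≤ : ∀ b {y} → (b ≡ true → 1 ≤ y) → ⟦ b ⟧ ≤ y
  ⟦⟧≤ false h = z≤n
  ⟦⟧≤ true  h = h refl

  ⟦⟧>0 : ∀ b → 0 < ⟦ b ⟧ → b ≡ true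
  ⟦⟧>0 true _ = refl

  opaque
    ⌊_⌋ : ∀ {ℓ} {P : Set ℓ} → Dec P → Bool
    ⌊ P? ⌋ = does P?

    ⌊⌋-true : ∀ {ℓ} {P : Set ℓ} (P? : Dec P) → ⌊ P? ⌋ ≡ true → P
    ⌊⌋-true (yes p) _ = p

    ⌊⌋-false : ∀ {ℓ} {P : Set ℓ} (P? : Dec P) → ⌊ P? ⌋ ≡ false → ¬ P
    ⌊⌋-false (no ¬p) _ = ¬p

    true-⌊⌋ : ∀ {ℓ} {P : Set ℓ} (P? : Dec P) → P → ⌊ P? ⌋ ≡ true
    true-⌊⌋ (yes _) _ = refl
    true-⌊⌋ (no ¬p) p = ⊥-elim (¬p p)

  card : (Fin n → Bool) → ℕ
  card A = ∑ λ x → ⟦ A x ⟧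

  card≤n : (A : Fin n → Bool) → card A ≤ n
  card≤n {n} A = ≤-trans (∑-mono λ x → ⟦⟧≤1 (A x)) (≤-reflexive (trans (∑-const n 1) (*-identityʳ n)))

  ⟦∧⟧ : ∀ a b → ⟦ a ∧ b ⟧ ≡ ⟦ a ⟧ * ⟦ b ⟧
  ⟦∧⟧ false b = refl
  ⟦∧⟧ true  b = sym (+-identityʳ _)

  ∧-true : ∀ a b → a ∧ b ≡ true → a ≡ true × b ≡ true
  ∧-true true true _ = refl , refl

  ∑-swap : (c : Fin m → ℕ) (u : Fin n → ℕ) (v : Fin m → Fin n → ℕ) →
    ∑ (λ i → c i * ∑ λ j → u j * v i j) ≡ ∑ (λ j → u j * ∑ λ i → c i * v i j)
  ∑-swap c u v = begin
    ∑ (λ i → c i * ∑ λ j → u j * v i j)  ≡⟨ ∑-cong (λ i → *-∑ (c i) (λ j → u j * v i j)) ⟩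
    ∑ (λ i → ∑ λ j → c i * (u j * v i j))  ≡⟨ ∑-comm (λ i j → c i * (u j * v i j)) ⟩
    ∑ (λ j → ∑ λ i → c i * (u j * v i j))  ≡⟨ ∑-cong (λ j → ∑-cong λ i → exchange (c i) (u j) (v i j)) ⟩
    ∑ (λ j → ∑ λ i → u j * (c i * v i j))  ≡⟨ ∑-cong (λ j → *-∑ (u j) (λ i → c i * v i j)) ⟨
    ∑ (λ j → u j * ∑ λ i → c i * v i j)  ∎
    where
    open ≡-Reasoning
    exchange : ∀ a b c → a * (b * c) ≡ b * (a * c)
    exchange = solve-∀

  ∑-*-pull : ∀ c (a v : Fin n → ℕ) → c * ∑ (λ i → a i * v i) ≡ ∑ (λ i → a i * (c * v i))
  ∑-*-pull c a v = trans (*-∑ c (λ i → a i * v i)) (∑-cong λ i → exchange c (a i) (v i))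
    where
    exchange : ∀ c a x → c * (a * x) ≡ a * (c * x)
    exchange = solve-∀

  ∑-⟦⟧-<⇒∃ : (A : Fin n → Bool) (f g : Fin n → ℕ) → ∑ (λ v → ⟦ A v ⟧ * f v) < ∑ (λ v → ⟦ A v ⟧ * g v) → ∃[ v ] (A v ≡ true × f v < g v)
  ∑-⟦⟧-<⇒∃ A f g h = let v , fv<gv = ∑-<⇒∃ h in v , weighted (A v) fv<gv
    where
    weighted : ∀ b {x y} → ⟦ b ⟧ * x < ⟦ b ⟧ * y → b ≡ true × x < y
    weighted true x<y = refl , subst₂ _<_ (*-identityˡ _) (*-identityˡ _) x<y

  false≢true : false ≢ true
  false≢true ()

  opaque
    unfolding ∑
    card-unique : (P : Fin n → Bool) → (∀ i j → P i ≡ true → P j ≡ true → i ≡ j) → card P ≤ 1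
    card-unique {zero}  P unique = z≤n
    card-unique {suc n} P unique with P zero in eq
    ... | false = card-unique (P ∘ suc) λ i j Pi Pj → Fin.suc-injective (unique (suc i) (suc j) Pi Pj)
    ... | true  = ≤-reflexive (cong suc (trans (∑-cong rest) (trans (∑-const n 0) (*-zeroʳ n))))
      where
      rest : ∀ i → ⟦ P (suc i) ⟧ ≡ 0
      rest i with P (suc i) in eqᵢ
      ... | false = refl
      ... | true  with () ← unique zero (suc i) eq eqᵢ

  ^-distribʳ-* : ∀ e x y → (x * y) ^ e ≡ x ^ e * y ^ e
  ^-distribʳ-* zero    x y = refl
  ^-distribʳ-* (suc e) x y = trans (cong (x * y *_) (^-distribʳ-* e x y)) (exchange x y (x ^ e) (y ^ e))
    where
    exchange : ∀ a b c d → a * b * (c * d) ≡ a * c * (b * d)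
    exchange = solve-∀

open FiniteSums

-- Prime fields

record PrimeField (p : ℕ) : Set₁ where
  infixl 6 _⊕_ _⊝_
  infixl 7 _⊗_
  infix 8 ⊖_
  field
    _⊕_ _⊗_ : Fin p → Fin p → Fin p
    ⊖_ : Fin p → Fin p
    0̂ 1̂ : Fin p
    isCommutativeRing : IsCommutativeRing _≡_ _⊕_ _⊗_ ⊖_ 0̂ 1̂
    -- The canonical map lets the ring solver below work with integer coefficients.
    ⟨_⟩ : ℤ → Fin p
    ⟨⟩-+ : ∀ i j → ⟨ i ℤ.+ j ⟩ ≡ ⟨ i ⟩ ⊕ ⟨ j ⟩
    ⟨⟩-* : ∀ i j → ⟨ i ℤ.* j ⟩ ≡ ⟨ i ⟩ ⊗ ⟨ j ⟩
    ⟨⟩-neg : ∀ i → ⟨ ℤ.- i ⟩ ≡ ⊖ ⟨ i ⟩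
    ⟨⟩-0 : ⟨ + 0 ⟩ ≡ 0̂
    ⟨⟩-1 : ⟨ + 1 ⟩ ≡ 1̂
    integral : ∀ x y → x ⊗ y ≡ 0̂ → x ≡ 0̂ ⊎ y ≡ 0̂
    inverse : ∀ x → x ≢ 0̂ → Fin p
    inverseʳ : ∀ x (x≢0 : x ≢ 0̂) → x ⊗ inverse x x≢0 ≡ 1̂
    -- Excludes proper subfields, in which sums and products would stop growing; `full-or-gap`
    -- depends on it.
    1̂-generates : (P : Fin p → Set) → P 0̂ → (∀ x → P x → P (x ⊕ 1̂)) → ∀ x → P x

  _⊝_ : Fin p → Fin p → Fin p
  x ⊝ y = x ⊕ ⊖ y

  commutativeRing : CommutativeRing 0ℓ 0ℓ
  commutativeRing = record { isCommutativeRing = isCommutativeRing }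

  private
    acr : AlmostCommutativeRing 0ℓ 0ℓ
    acr = fromCommutativeRing commutativeRing

    morphism : ℤ.+-*-rawRing -Raw-AlmostCommutative⟶ acr
    morphism = record
      { ⟦_⟧ = ⟨_⟩ ; +-homo = ⟨⟩-+ ; *-homo = ⟨⟩-* ; -‿homo = ⟨⟩-neg
      ; 0-homo = ⟨⟩-0 ; 1-homo = ⟨⟩-1 }

    coeff≟ : (i j : ℤ) → Maybe (⟨ i ⟩ ≡ ⟨ j ⟩)
    coeff≟ i j with i ℤₚ.≟ j
    ... | yes i≡j = just (cong ⟨_⟩ i≡j)
    ... | no  _   = nothing

  open CommutativeRing commutativeRing public
    using () renaming (+-identityˡ to ⊕-identityˡ; +-identityʳ to ⊕-identityʳ; *-identityˡ to ⊗-identityˡ; *-identityʳ to ⊗-identityʳ; zeroˡ to ⊗-zeroˡ; zeroʳ to ⊗-zeroʳ; +-comm to ⊕-comm; *-comm to ⊗-comm; *-assoc to ⊗-assoc)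
  module Solver = RingSolver ℤ.+-*-rawRing acr morphism coeff≟

module FieldSums {p} (𝔽 : PrimeField p) where
  open PrimeField 𝔽
  open Solver using (solve; _:=_; _:+_; _:*_; _:-_)

  ⊕-⊝-cancel : ∀ c x → x ⊝ c ⊕ c ≡ x
  ⊕-⊝-cancel = solve 2 (λ c x → x :- c :+ c := x) refl

  ⊝-⊕-cancel : ∀ c x → x ⊕ c ⊝ c ≡ x
  ⊝-⊕-cancel = solve 2 (λ c x → x :+ c :- c := x) refl

  ⊝-self : ∀ x → x ⊝ x ≡ 0̂
  ⊝-self x = trans (cong (_⊝ x) (sym (⊕-identityˡ x))) (⊝-⊕-cancel x 0̂)

  ⊝≡0⇒≡ : ∀ {x y} → x ⊝ y ≡ 0̂ → x ≡ y
  ⊝≡0⇒≡ {x} {y} eq = trans (sym (⊕-⊝-cancel y x)) (trans (cong (_⊕ y) eq) (⊕-identityˡ y))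

  ⊝≢0 : ∀ {x y} → x ≢ y → x ⊝ y ≢ 0̂
  ⊝≢0 x≢y eq = x≢y (⊝≡0⇒≡ eq)

  ⊝-involutive : ∀ c x → c ⊝ (c ⊝ x) ≡ x
  ⊝-involutive = solve 2 (λ c x → c :- (c :- x) := x) refl

  module _ (c : Fin p) (c≢0 : c ≢ 0̂) where
    c⁻¹ : Fin p
    c⁻¹ = inverse c c≢0

    c⊗c⁻¹⊗ : ∀ x → c ⊗ (c⁻¹ ⊗ x) ≡ x
    c⊗c⁻¹⊗ x = trans (solve 3 (λ a b x → a :* (b :* x) := a :* b :* x) refl c c⁻¹ x) (trans (cong (_⊗ x) (inverseʳ c c≢0)) (⊗-identityˡ x))

    c⁻¹⊗c⊗ : ∀ x → c⁻¹ ⊗ (c ⊗ x) ≡ x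
    c⁻¹⊗c⊗ x = trans (solve 3 (λ a b x → a :* (b :* x) := b :* a :* x) refl c⁻¹ c x) (trans (cong (_⊗ x) (inverseʳ c c≢0)) (⊗-identityˡ x))

    ∑-dilate : (f : Fin p → ℕ) → ∑ (λ x → f (c ⊗ x)) ≡ ∑ f
    ∑-dilate f = ∑-reindex f (c ⊗_) (c⁻¹ ⊗_) c⊗c⁻¹⊗ c⁻¹⊗c⊗

    ∑ᶻ-dilate : (f : Fin p → ℤ) → ∑ᶻ (λ x → f (c ⊗ x)) ≡ ∑ᶻ f
    ∑ᶻ-dilate f = ∑ᶻ-reindex f (c ⊗_) (c⁻¹ ⊗_) c⊗c⁻¹⊗ c⁻¹⊗c⊗

  ∑-shift : ∀ c (f : Fin p → ℕ) → ∑ (λ x → f (x ⊕ c)) ≡ ∑ f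
  ∑-shift c f = ∑-reindex f (_⊕ c) (_⊝ c) (⊕-⊝-cancel c) (⊝-⊕-cancel c)

  ∑-unshift : ∀ c (f : Fin p → ℕ) → ∑ (λ x → f (x ⊝ c)) ≡ ∑ f
  ∑-unshift c f = ∑-reindex f (_⊝ c) (_⊕ c) (⊝-⊕-cancel c) (⊕-⊝-cancel c)

  ∑-reflect : ∀ c (f : Fin p → ℕ) → ∑ (λ x → f (c ⊝ x)) ≡ ∑ f
  ∑-reflect c f = ∑-reindex f (c ⊝_) (c ⊝_) (⊝-involutive c) (⊝-involutive c)

  ∑ᶻ-shift : ∀ c (f : Fin p → ℤ) → ∑ᶻ (λ x → f (x ⊕ c)) ≡ ∑ᶻ f
  ∑ᶻ-shift c f = ∑ᶻ-reindex f (_⊕ c) (_⊝ c) (⊕-⊝-cancel c) (⊝-⊕-cancel c)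

  ⊗-cancelˡ : ∀ c {x y} → c ≢ 0̂ → c ⊗ x ≡ c ⊗ y → x ≡ y
  ⊗-cancelˡ c {x} {y} c≢0 eq = trans (sym (c⁻¹⊗c⊗ c c≢0 x)) (trans (cong (c⁻¹ c c≢0 ⊗_) eq) (c⁻¹⊗c⊗ c c≢0 y))

  ∑-convolution : (f g : Fin p → ℕ) → ∑ (λ z → ∑ λ v → f v * g (z ⊝ v)) ≡ ∑ f * ∑ g
  ∑-convolution f g = begin
    ∑ (λ z → ∑ λ v → f v * g (z ⊝ v))  ≡⟨ ∑-comm (λ z v → f v * g (z ⊝ v)) ⟩
    ∑ (λ v → ∑ λ z → f v * g (z ⊝ v))  ≡⟨ ∑-cong (λ v → *-∑ (f v) (λ z → g (z ⊝ v))) ⟨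
    ∑ (λ v → f v * ∑ λ z → g (z ⊝ v))  ≡⟨ ∑-cong (λ v → cong (f v *_) (∑-unshift v g)) ⟩
    ∑ (λ v → f v * ∑ g)  ≡⟨ ∑-*ʳ (∑ g) f ⟨
    ∑ f * ∑ g  ∎
    where open ≡-Reasoning

  correlation : (Fin p → Bool) → Fin p → ℕ
  correlation A z = ∑ λ t → ⟦ A t ⟧ * ⟦ A (t ⊕ z) ⟧

  ∑-correlation : ∀ A → ∑ (correlation A) ≡ card A * card A
  ∑-correlation A = begin
    ∑ (λ z → ∑ λ t → ⟦ A t ⟧ * ⟦ A (t ⊕ z) ⟧)  ≡⟨ ∑-comm (λ z t → ⟦ A t ⟧ * ⟦ A (t ⊕ z) ⟧) ⟩
    ∑ (λ t → ∑ λ z → ⟦ A t ⟧ * ⟦ A (t ⊕ z) ⟧)  ≡⟨ ∑-cong (λ t → *-∑ ⟦ A t ⟧ (λ z → ⟦ A (t ⊕ z) ⟧)) ⟨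
    ∑ (λ t → ⟦ A t ⟧ * ∑ λ z → ⟦ A (t ⊕ z) ⟧)  ≡⟨ ∑-cong (λ t → cong (⟦ A t ⟧ *_) (trans (∑-cong λ z → cong (λ x → ⟦ A x ⟧) (⊕-comm t z)) (∑-shift t λ x → ⟦ A x ⟧))) ⟩
    ∑ (λ t → ⟦ A t ⟧ * card A)  ≡⟨ ∑-*ʳ (card A) (λ t → ⟦ A t ⟧) ⟨
    card A * card A  ∎
    where open ≡-Reasoning

  correlation≤card : ∀ A z → correlation A z ≤ card A
  correlation≤card A z = ∑-mono λ t → ≤-trans (*-monoʳ-≤ ⟦ A t ⟧ (⟦⟧≤1 (A (t ⊕ z)))) (≤-reflexive (*-identityʳ _))

  differenceSet : (Fin p → Bool) → Fin p → Bool
  differenceSet A z = ⌊ 0 <? correlation A z ⌋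

  ∈-differenceSet : ∀ A {a b} → A a ≡ true → A b ≡ true → differenceSet A (a ⊝ b) ≡ true
  ∈-differenceSet A {a} {b} a∈A b∈A = true-⌊⌋ (0 <? correlation A (a ⊝ b)) (<-≤-trans z<s (≤-trans (≤-reflexive term)
    (≤-∑ (λ t → ⟦ A t ⟧ * ⟦ A (t ⊕ (a ⊝ b)) ⟧) b)))
    where
    b⊕a⊝b : ∀ a b → b ⊕ (a ⊝ b) ≡ a
    b⊕a⊝b = solve 2 (λ a b → b :+ (a :- b) := a) refl
    term : 1 ≡ ⟦ A b ⟧ * ⟦ A (b ⊕ (a ⊝ b)) ⟧
    term rewrite b∈A | b⊕a⊝b a b | a∈A = refl

  differenceSet-∈ : ∀ A z → differenceSet A z ≡ true → ∃[ a ] ∃[ b ] (A a ≡ true × A b ≡ true × z ≡ a ⊝ b)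
  differenceSet-∈ A z z∈ with ∑>0⇒∃ (λ t → ⟦ A t ⟧ * ⟦ A (t ⊕ z) ⟧) (⌊⌋-true (0 <? correlation A z) z∈)
  ... | t , 0<term = t ⊕ z , t , proj₂ both , proj₁ both , solve 2 (λ t z → z := t :+ z :- t) refl t z
    where
    both : A t ≡ true × A (t ⊕ z) ≡ true
    both = ∧-true (A t) (A (t ⊕ z)) (⟦⟧>0 _ (subst (0 <_) (sym (⟦∧⟧ (A t) (A (t ⊕ z)))) 0<term))

-- In `mul-invariant`, multiplication by g preserves both G and its complement: closure under
-- products and under quotients in one equation.
record IsSubgroup {p} (𝔽 : PrimeField p) (G : Fin p → Bool) : Set where
  open PrimeField 𝔽
  field
    nonzero : ∀ {g} → G g ≡ true → g ≢ 0̂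
    mul-invariant : ∀ {g} h → G g ≡ true → G (g ⊗ h) ≡ G h

-- Correlation sums over a subgroup

∑ᶻ-swap : ∀ {m n} (c : Fin m → ℤ) (u : Fin n → ℤ) (v : Fin m → Fin n → ℤ) →
  ∑ᶻ (λ i → c i ℤ.* ∑ᶻ λ j → u j ℤ.* v i j) ≡ ∑ᶻ (λ j → u j ℤ.* ∑ᶻ λ i → c i ℤ.* v i j)
∑ᶻ-swap c u v = begin
  ∑ᶻ (λ i → c i ℤ.* ∑ᶻ λ j → u j ℤ.* v i j)  ≡⟨ ∑ᶻ-cong (λ i → *-∑ᶻ (c i) (λ j → u j ℤ.* v i j)) ⟩
  ∑ᶻ (λ i → ∑ᶻ λ j → c i ℤ.* (u j ℤ.* v i j))  ≡⟨ ∑ᶻ-comm (λ i j → c i ℤ.* (u j ℤ.* v i j)) ⟩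
  ∑ᶻ (λ j → ∑ᶻ λ i → c i ℤ.* (u j ℤ.* v i j))  ≡⟨ ∑ᶻ-cong (λ j → ∑ᶻ-cong λ i → exchange (c i) (u j) (v i j)) ⟩
  ∑ᶻ (λ j → ∑ᶻ λ i → u j ℤ.* (c i ℤ.* v i j))  ≡⟨ ∑ᶻ-cong (λ j → *-∑ᶻ (u j) (λ i → c i ℤ.* v i j)) ⟨
  ∑ᶻ (λ j → u j ℤ.* ∑ᶻ λ i → c i ℤ.* v i j)  ∎
  where
  open ≡-Reasoning
  exchange : ∀ a b c → a ℤ.* (b ℤ.* c) ≡ b ℤ.* (a ℤ.* c)
  exchange = solveᶻ-∀

signum : ℤ → ℤ
signum (+ _)    = + 1
signum -[1+ _ ] = -[1+ 0 ]

signum-* : ∀ i → signum i ℤ.* i ≡ + ∣ i ∣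
signum-* (+ n)    = ℤₚ.*-identityˡ (+ n)
signum-* -[1+ n ] = cong +_ (+-identityʳ (suc n))

∣signum∣ : ∀ i → ∣ signum i ∣ ≡ 1
∣signum∣ (+ _)    = refl
∣signum∣ -[1+ _ ] = refl

module Correlation {p} (𝔽 : PrimeField p) {G : Fin p → Bool} (isSubgroup : IsSubgroup 𝔽 G)
  (f : Fin p → ℤ) (∑f≡0 : ∑ᶻ f ≡ + 0) where

  open PrimeField 𝔽
  open FieldSums 𝔽
  open IsSubgroup isSubgroup
  open Solver using (solve; _:=_; _:+_; _:*_; _:-_)

  γ : Fin p → ℤ
  γ g = + ⟦ G g ⟧

  ψ S : Fin p → ℤ
  ψ y = ∑ᶻ λ t → f t ℤ.* f (t ⊕ y)
  S y = ∑ᶻ λ g → γ g ℤ.* ψ (y ⊗ g)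

  w n : ℕ
  w = ∑ λ t → ∣ f t ∣ * ∣ f t ∣
  n = card G

  s : Fin p → ℕ
  s y = ∣ S y ∣

  ∣ψ∣≤w : ∀ y → ∣ ψ y ∣ ≤ w
  ∣ψ∣≤w y = square-cancel-≤ (≤-trans (cauchy-schwarzᶻ f (λ t → f (t ⊕ y)))
    (≤-reflexive (cong (w *_) (∑-shift y λ t → ∣ f t ∣ * ∣ f t ∣))))

  s≤nw : ∀ y → s y ≤ n * w
  s≤nw y = begin
    ∣ S y ∣  ≤⟨ ∣∑ᶻ∣≤∑∣∣ _ ⟩
    ∑ (λ g → ∣ γ g ℤ.* ψ (y ⊗ g) ∣)  ≡⟨ ∑-cong (λ g → ℤₚ.abs-* (γ g) (ψ (y ⊗ g))) ⟩
    ∑ (λ g → ⟦ G g ⟧ * ∣ ψ (y ⊗ g) ∣)  ≤⟨ ∑-mono (λ g → *-monoʳ-≤ ⟦ G g ⟧ (∣ψ∣≤w (y ⊗ g))) ⟩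
    ∑ (λ g → ⟦ G g ⟧ * w)  ≡⟨ ∑-*ʳ w (λ g → ⟦ G g ⟧) ⟨
    n * w  ∎
    where open ≤-Reasoning

  S-invariant : ∀ {g} → G g ≡ true → ∀ y → S (g ⊗ y) ≡ S y
  S-invariant {g} g∈G y = begin
    ∑ᶻ (λ h → γ h ℤ.* ψ (g ⊗ y ⊗ h))  ≡⟨ ∑ᶻ-cong (λ h → cong₂ ℤ._*_ (cong (λ b → + ⟦ b ⟧) (sym (mul-invariant h g∈G))) (cong ψ (rearrange g y h))) ⟩
    ∑ᶻ (λ h → γ (g ⊗ h) ℤ.* ψ (y ⊗ (g ⊗ h)))  ≡⟨ ∑ᶻ-dilate g (nonzero g∈G) (λ h → γ h ℤ.* ψ (y ⊗ h)) ⟩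
    S y  ∎
    where
    open ≡-Reasoning
    rearrange : ∀ g y h → g ⊗ y ⊗ h ≡ y ⊗ (g ⊗ h)
    rearrange = solve 3 (λ g y h → g :* y :* h := y :* (g :* h)) refl

  s-invariant : ∀ {g} → G g ≡ true → ∀ y → s (g ⊗ y) ≡ s y
  s-invariant g∈G y = cong ∣_∣ (S-invariant g∈G y)

  ∑-shifted-product : ∀ a b → ∑ᶻ (λ t → f (t ⊕ a) ℤ.* f (t ⊕ b)) ≡ ψ (b ⊝ a)
  ∑-shifted-product a b = trans (∑ᶻ-cong λ t → cong (λ z → f (t ⊕ a) ℤ.* f z) (rearrange t a b))
    (∑ᶻ-shift a λ t → f t ℤ.* f (t ⊕ (b ⊝ a)))
    where
    rearrange : ∀ t a b → t ⊕ b ≡ t ⊕ a ⊕ (b ⊝ a)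
    rearrange = solve 3 (λ t a b → t :+ b := t :+ a :+ (b :- a)) refl

  module _ (A : Fin p → Bool) where
    private
      c : Fin p → ℤ
      c y = + ⟦ A y ⟧ ℤ.* signum (S y)

      H : Fin p → Fin p → ℤ
      H g t = ∑ᶻ λ y → c y ℤ.* f (t ⊕ y ⊗ g)

      P : Fin p → ℤ
      P g = ∑ᶻ λ t → f t ℤ.* H g t

      V : Fin p → ℕ
      V g = ∑ λ t → ∣ H g t ∣ * ∣ H g t ∣

      ∣c∣ : ∀ y → ∣ c y ∣ ≡ ⟦ A y ⟧
      ∣c∣ y = trans (ℤₚ.abs-* (+ ⟦ A y ⟧) (signum (S y))) (trans (cong (⟦ A y ⟧ *_) (∣signum∣ (S y))) (*-identityʳ _))

      total : ℕ
      total = ∑ λ y → ⟦ A y ⟧ * s y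

      total≡ : + total ≡ ∑ᶻ λ g → γ g ℤ.* P g
      total≡ = begin
        + total  ≡⟨ ∑ᶻ-pos (λ y → ⟦ A y ⟧ * s y) ⟨
        ∑ᶻ (λ y → + (⟦ A y ⟧ * s y))  ≡⟨ ∑ᶻ-cong (λ y → trans (ℤₚ.pos-* ⟦ A y ⟧ (s y)) (trans (cong (ℤ._*_ (+ ⟦ A y ⟧)) (sym (signum-* (S y)))) (sym (ℤₚ.*-assoc (+ ⟦ A y ⟧) (signum (S y)) (S y))))) ⟩
        ∑ᶻ (λ y → c y ℤ.* S y)  ≡⟨ ∑ᶻ-swap c γ (λ y g → ψ (y ⊗ g)) ⟩
        ∑ᶻ (λ g → γ g ℤ.* ∑ᶻ λ y → c y ℤ.* ψ (y ⊗ g))  ≡⟨ ∑ᶻ-cong (λ g → cong (ℤ._*_ (γ g)) (∑ᶻ-swap c f (λ y t → f (t ⊕ y ⊗ g)))) ⟩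
        ∑ᶻ (λ g → γ g ℤ.* P g)  ∎
        where open ≡-Reasoning

      total² : total * total ≤ n * w * ∑ (λ g → ⟦ G g ⟧ * V g)
      total² = begin
        total * total  ≤⟨ *-mono-≤ total≤ total≤ ⟩
        ∑ (λ g → ⟦ G g ⟧ * ∣ P g ∣) * ∑ (λ g → ⟦ G g ⟧ * ∣ P g ∣)  ≤⟨ cauchy-schwarz-support (λ g → ⟦ G g ⟧ * ∣ P g ∣) (λ g → ⟦ G g ⟧) supported ⟩
        n * ∑ (λ g → ⟦ G g ⟧ * ∣ P g ∣ * (⟦ G g ⟧ * ∣ P g ∣))  ≤⟨ *-monoʳ-≤ n (∑-mono pointwise) ⟩
        n * ∑ (λ g → w * (⟦ G g ⟧ * V g))  ≡⟨ cong (n *_) (*-∑ w (λ g → ⟦ G g ⟧ * V g)) ⟨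
        n * (w * ∑ (λ g → ⟦ G g ⟧ * V g))  ≡⟨ *-assoc n w _ ⟨
        n * w * ∑ (λ g → ⟦ G g ⟧ * V g)  ∎
        where
        open ≤-Reasoning
        open import Data.Sum using (_⊎_; inj₁; inj₂)
        total≤ : total ≤ ∑ (λ g → ⟦ G g ⟧ * ∣ P g ∣)
        total≤ = ≤-trans (≤-reflexive (cong ∣_∣ total≡)) (≤-trans (∣∑ᶻ∣≤∑∣∣ _) (≤-reflexive (∑-cong λ g → ℤₚ.abs-* (γ g) (P g))))
        supported : ∀ g → ⟦ G g ⟧ * ∣ P g ∣ ≡ 0 ⊎ 1 ≤ ⟦ G g ⟧
        supported g with G g
        ... | true  = inj₂ ≤-refl
        ... | false = inj₁ refl
        pointwise : ∀ g → ⟦ G g ⟧ * ∣ P g ∣ * (⟦ G g ⟧ * ∣ P g ∣) ≤ w * (⟦ G g ⟧ * V g)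
        pointwise g with G g
        ... | false = z≤n
        ... | true rewrite *-identityˡ ∣ P g ∣ | *-identityˡ (V g) = cauchy-schwarzᶻ f (H g)

      ∑V≡ : + ∑ (λ g → ⟦ G g ⟧ * V g) ≡ ∑ᶻ λ y → c y ℤ.* ∑ᶻ λ y′ → c y′ ℤ.* S (y′ ⊝ y)
      ∑V≡ = begin
        + ∑ (λ g → ⟦ G g ⟧ * V g)  ≡⟨ ∑ᶻ-pos (λ g → ⟦ G g ⟧ * V g) ⟨
        ∑ᶻ (λ g → + (⟦ G g ⟧ * V g))  ≡⟨ ∑ᶻ-cong (λ g → trans (ℤₚ.pos-* ⟦ G g ⟧ (V g)) (cong (ℤ._*_ (γ g)) (V≡ g))) ⟩
        ∑ᶻ (λ g → γ g ℤ.* ∑ᶻ λ y → c y ℤ.* ∑ᶻ λ y′ → c y′ ℤ.* ψ ((y′ ⊝ y) ⊗ g))  ≡⟨ ∑ᶻ-swap γ c (λ g y → ∑ᶻ λ y′ → c y′ ℤ.* ψ ((y′ ⊝ y) ⊗ g)) ⟩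
        ∑ᶻ (λ y → c y ℤ.* ∑ᶻ λ g → γ g ℤ.* ∑ᶻ λ y′ → c y′ ℤ.* ψ ((y′ ⊝ y) ⊗ g))  ≡⟨ ∑ᶻ-cong (λ y → cong (ℤ._*_ (c y)) (∑ᶻ-swap γ c (λ g y′ → ψ ((y′ ⊝ y) ⊗ g)))) ⟩
        ∑ᶻ (λ y → c y ℤ.* ∑ᶻ λ y′ → c y′ ℤ.* S (y′ ⊝ y))  ∎
        where
        open ≡-Reasoning
        distrib : ∀ y y′ g → y′ ⊗ g ⊝ y ⊗ g ≡ (y′ ⊝ y) ⊗ g
        distrib = solve 3 (λ y y′ g → y′ :* g :- y :* g := (y′ :- y) :* g) refl
        V≡ : ∀ g → + V g ≡ ∑ᶻ λ y → c y ℤ.* ∑ᶻ λ y′ → c y′ ℤ.* ψ ((y′ ⊝ y) ⊗ g)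
        V≡ g = begin
          + V g  ≡⟨ ∑ᶻ-pos (λ t → ∣ H g t ∣ * ∣ H g t ∣) ⟨
          ∑ᶻ (λ t → + (∣ H g t ∣ * ∣ H g t ∣))  ≡⟨ ∑ᶻ-cong (λ t → ∣i∣²≡i² (H g t)) ⟩
          ∑ᶻ (λ t → H g t ℤ.* H g t)  ≡⟨ ∑ᶻ-swap (H g) c (λ t y → f (t ⊕ y ⊗ g)) ⟩
          ∑ᶻ (λ y → c y ℤ.* ∑ᶻ λ t → H g t ℤ.* f (t ⊕ y ⊗ g))  ≡⟨ ∑ᶻ-cong (λ y → cong (ℤ._*_ (c y)) (∑ᶻ-cong λ t → ℤₚ.*-comm (H g t) _)) ⟩
          ∑ᶻ (λ y → c y ℤ.* ∑ᶻ λ t → f (t ⊕ y ⊗ g) ℤ.* H g t)  ≡⟨ ∑ᶻ-cong (λ y → cong (ℤ._*_ (c y)) (∑ᶻ-swap (λ t → f (t ⊕ y ⊗ g)) c (λ t y′ → f (t ⊕ y′ ⊗ g)))) ⟩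
          ∑ᶻ (λ y → c y ℤ.* ∑ᶻ λ y′ → c y′ ℤ.* ∑ᶻ λ t → f (t ⊕ y ⊗ g) ℤ.* f (t ⊕ y′ ⊗ g))  ≡⟨ ∑ᶻ-cong (λ y → cong (ℤ._*_ (c y)) (∑ᶻ-cong λ y′ → cong (ℤ._*_ (c y′)) (trans (∑-shifted-product (y ⊗ g) (y′ ⊗ g)) (cong ψ (distrib y y′ g))))) ⟩
          ∑ᶻ (λ y → c y ℤ.* ∑ᶻ λ y′ → c y′ ℤ.* ψ ((y′ ⊝ y) ⊗ g))  ∎

    -- Large values of |S| on A force large values on A - A. With the signs `c`, the sum of |S| over
    -- A becomes the sum of f t * H g t over t and over g in G. Cauchy-Schwarz in g and in t splits
    -- off the factor n w, and expanding the square of H leaves only the differences y′ ⊝ y.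
    differences-correlate : ∑ (λ y → ⟦ A y ⟧ * s y) * ∑ (λ y → ⟦ A y ⟧ * s y) ≤
      n * w * ∑ λ y → ⟦ A y ⟧ * ∑ λ y′ → ⟦ A y′ ⟧ * s (y′ ⊝ y)
    differences-correlate = ≤-trans total² (*-monoʳ-≤ (n * w) (begin
      ∑ (λ g → ⟦ G g ⟧ * V g)  ≡⟨ cong ∣_∣ ∑V≡ ⟩
      ∣ ∑ᶻ (λ y → c y ℤ.* ∑ᶻ λ y′ → c y′ ℤ.* S (y′ ⊝ y)) ∣  ≤⟨ weighted c (λ y → ∑ᶻ λ y′ → c y′ ℤ.* S (y′ ⊝ y)) ∣c∣ ⟩
      ∑ (λ y → ⟦ A y ⟧ * ∣ ∑ᶻ (λ y′ → c y′ ℤ.* S (y′ ⊝ y)) ∣)  ≤⟨ ∑-mono (λ y → *-monoʳ-≤ ⟦ A y ⟧ (weighted c (λ y′ → S (y′ ⊝ y)) ∣c∣)) ⟩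
      ∑ (λ y → ⟦ A y ⟧ * ∑ λ y′ → ⟦ A y′ ⟧ * s (y′ ⊝ y))  ∎))
      where
      open ≤-Reasoning
      weighted : ∀ (c v : Fin p → ℤ) → (∀ y → ∣ c y ∣ ≡ ⟦ A y ⟧) → ∣ ∑ᶻ (λ y → c y ℤ.* v y) ∣ ≤ ∑ (λ y → ⟦ A y ⟧ * ∣ v y ∣)
      weighted c v h = ≤-trans (∣∑ᶻ∣≤∑∣∣ _) (≤-reflexive (∑-cong λ y → trans (ℤₚ.abs-* (c y) (v y)) (cong (_* ∣ v y ∣) (h y))))

  ψ0≡w : ψ 0̂ ≡ + w
  ψ0≡w = trans (∑ᶻ-cong λ t → trans (cong (λ z → f t ℤ.* f z) (⊕-identityʳ t)) (sym (∣i∣²≡i² (f t)))) (∑ᶻ-pos λ t → ∣ f t ∣ * ∣ f t ∣)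

  private
    Φ : Fin p → Fin p → ℤ
    Φ h z = ∑ᶻ λ t → f t ℤ.* f (z ⊕ t ⊗ h)

    -- The weighted additive energy of f and its dilate by h: the sum of f t f u f v f v′ over all v
    -- - v′ = (t - u) ⊗ h.
    X : Fin p → ℕ
    X h = ∑ λ z → ∣ Φ h z ∣ * ∣ Φ h z ∣

    X≡ : ∀ h → + X h ≡ ∑ᶻ λ y → ψ y ℤ.* ψ (y ⊗ h)
    X≡ h = begin
      + X h  ≡⟨ ∑ᶻ-pos (λ z → ∣ Φ h z ∣ * ∣ Φ h z ∣) ⟨
      ∑ᶻ (λ z → + (∣ Φ h z ∣ * ∣ Φ h z ∣))  ≡⟨ ∑ᶻ-cong (λ z → ∣i∣²≡i² (Φ h z)) ⟩
      ∑ᶻ (λ z → Φ h z ℤ.* Φ h z)  ≡⟨ ∑ᶻ-swap (Φ h) f (λ z t → f (z ⊕ t ⊗ h)) ⟩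
      ∑ᶻ (λ t → f t ℤ.* ∑ᶻ λ z → Φ h z ℤ.* f (z ⊕ t ⊗ h))  ≡⟨ ∑ᶻ-cong (λ t → cong (ℤ._*_ (f t)) (∑ᶻ-cong λ z → ℤₚ.*-comm (Φ h z) _)) ⟩
      ∑ᶻ (λ t → f t ℤ.* ∑ᶻ λ z → f (z ⊕ t ⊗ h) ℤ.* Φ h z)  ≡⟨ ∑ᶻ-cong (λ t → cong (ℤ._*_ (f t)) (∑ᶻ-swap (λ z → f (z ⊕ t ⊗ h)) f (λ z u → f (z ⊕ u ⊗ h)))) ⟩
      ∑ᶻ (λ t → f t ℤ.* ∑ᶻ λ u → f u ℤ.* ∑ᶻ λ z → f (z ⊕ t ⊗ h) ℤ.* f (z ⊕ u ⊗ h))  ≡⟨ ∑ᶻ-cong (λ t → cong (ℤ._*_ (f t)) (inner t)) ⟩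
      ∑ᶻ (λ t → f t ℤ.* ∑ᶻ λ y → ψ (y ⊗ h) ℤ.* f (t ⊕ y))  ≡⟨ ∑ᶻ-swap f (λ y → ψ (y ⊗ h)) (λ t y → f (t ⊕ y)) ⟩
      ∑ᶻ (λ y → ψ (y ⊗ h) ℤ.* ψ y)  ≡⟨ ∑ᶻ-cong (λ y → ℤₚ.*-comm (ψ (y ⊗ h)) (ψ y)) ⟩
      ∑ᶻ (λ y → ψ y ℤ.* ψ (y ⊗ h))  ∎
      where
      open ≡-Reasoning
      to-difference : ∀ t y h → (y ⊕ t) ⊗ h ⊝ t ⊗ h ≡ y ⊗ h
      to-difference = solve 3 (λ t y h → (y :+ t) :* h :- t :* h := y :* h) refl
      inner : ∀ t → ∑ᶻ (λ u → f u ℤ.* ∑ᶻ λ z → f (z ⊕ t ⊗ h) ℤ.* f (z ⊕ u ⊗ h)) ≡ ∑ᶻ λ y → ψ (y ⊗ h) ℤ.* f (t ⊕ y)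
      inner t = begin
        ∑ᶻ (λ u → f u ℤ.* ∑ᶻ λ z → f (z ⊕ t ⊗ h) ℤ.* f (z ⊕ u ⊗ h))  ≡⟨ ∑ᶻ-cong (λ u → cong (ℤ._*_ (f u)) (∑-shifted-product (t ⊗ h) (u ⊗ h))) ⟩
        ∑ᶻ (λ u → f u ℤ.* ψ (u ⊗ h ⊝ t ⊗ h))  ≡⟨ ∑ᶻ-shift t (λ u → f u ℤ.* ψ (u ⊗ h ⊝ t ⊗ h)) ⟨
        ∑ᶻ (λ y → f (y ⊕ t) ℤ.* ψ ((y ⊕ t) ⊗ h ⊝ t ⊗ h))  ≡⟨ ∑ᶻ-cong (λ y → trans (cong₂ ℤ._*_ (cong f (⊕-comm y t)) (cong ψ (to-difference t y h))) (ℤₚ.*-comm (f (t ⊕ y)) _)) ⟩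
        ∑ᶻ (λ y → ψ (y ⊗ h) ℤ.* f (t ⊕ y))  ∎

    ∑ψ≡0 : ∑ᶻ ψ ≡ + 0
    ∑ψ≡0 = begin
      ∑ᶻ (λ y → ∑ᶻ λ t → f t ℤ.* f (t ⊕ y))  ≡⟨ ∑ᶻ-comm (λ y t → f t ℤ.* f (t ⊕ y)) ⟩
      ∑ᶻ (λ t → ∑ᶻ λ y → f t ℤ.* f (t ⊕ y))  ≡⟨ ∑ᶻ-cong (λ t → *-∑ᶻ (f t) (λ y → f (t ⊕ y))) ⟨
      ∑ᶻ (λ t → f t ℤ.* ∑ᶻ λ y → f (t ⊕ y))  ≡⟨ ∑ᶻ-cong (λ t → trans (cong (ℤ._*_ (f t)) (trans (∑ᶻ-cong λ y → cong f (⊕-comm t y)) (trans (∑ᶻ-shift t f) ∑f≡0))) (ℤₚ.*-zeroʳ (f t))) ⟩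
      ∑ᶻ (λ t → + 0)  ≡⟨ ∑ᶻ-0 p ⟩
      + 0  ∎
      where
      open ≡-Reasoning

    -- For y ≠ 0 the products y ⊗ h run through the field, on which ψ has sum zero, so only y = 0
    -- contributes.
    ∑X≡ : ∑ X ≡ w * (p * w)
    ∑X≡ = ℤₚ.+-injective (begin
      + ∑ X  ≡⟨ ∑ᶻ-pos X ⟨
      ∑ᶻ (λ h → + X h)  ≡⟨ ∑ᶻ-cong X≡ ⟩
      ∑ᶻ (λ h → ∑ᶻ λ y → ψ y ℤ.* ψ (y ⊗ h))  ≡⟨ ∑ᶻ-comm (λ h y → ψ y ℤ.* ψ (y ⊗ h)) ⟩
      ∑ᶻ (λ y → ∑ᶻ λ h → ψ y ℤ.* ψ (y ⊗ h))  ≡⟨ ∑ᶻ-cong (λ y → *-∑ᶻ (ψ y) (λ h → ψ (y ⊗ h))) ⟨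
      ∑ᶻ (λ y → ψ y ℤ.* ∑ᶻ λ h → ψ (y ⊗ h))  ≡⟨ ∑ᶻ-single (λ y → ψ y ℤ.* ∑ᶻ λ h → ψ (y ⊗ h)) 0̂ off-zero ⟩
      ψ 0̂ ℤ.* ∑ᶻ (λ h → ψ (0̂ ⊗ h))  ≡⟨ cong₂ ℤ._*_ ψ0≡w (trans (∑ᶻ-cong λ h → trans (cong ψ (⊗-zeroˡ h)) ψ0≡w) (trans (∑ᶻ-pos {p} λ _ → w) (cong +_ (∑-const p w)))) ⟩
      + w ℤ.* + (p * w)  ≡⟨ ℤₚ.pos-* w (p * w) ⟨
      + (w * (p * w))  ∎)
      where
      open ≡-Reasoning
      off-zero : ∀ y → y ≢ 0̂ → ψ y ℤ.* ∑ᶻ (λ h → ψ (y ⊗ h)) ≡ + 0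
      off-zero y y≢0 = trans (cong (ℤ._*_ (ψ y)) (trans (∑ᶻ-dilate y y≢0 ψ) ∑ψ≡0)) (ℤₚ.*-zeroʳ (ψ y))

    ∑s²≡ : ∑ (λ y → s y * s y) ≡ n * ∑ (λ h → ⟦ G h ⟧ * X h)
    ∑s²≡ = ℤₚ.+-injective (begin
      + ∑ (λ y → s y * s y)  ≡⟨ ∑ᶻ-pos (λ y → s y * s y) ⟨
      ∑ᶻ (λ y → + (s y * s y))  ≡⟨ ∑ᶻ-cong (λ y → ∣i∣²≡i² (S y)) ⟩
      ∑ᶻ (λ y → S y ℤ.* S y)  ≡⟨ ∑ᶻ-swap S γ (λ y g → ψ (y ⊗ g)) ⟩
      ∑ᶻ (λ g → γ g ℤ.* ∑ᶻ λ y → S y ℤ.* ψ (y ⊗ g))  ≡⟨ ∑ᶻ-cong dilated ⟩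
      ∑ᶻ (λ g → γ g ℤ.* ∑ᶻ λ y → S y ℤ.* ψ y)  ≡⟨ ∑ᶻ-*ʳ (∑ᶻ λ y → S y ℤ.* ψ y) γ ⟨
      ∑ᶻ γ ℤ.* ∑ᶻ (λ y → S y ℤ.* ψ y)  ≡⟨ cong₂ ℤ._*_ (∑ᶻ-pos (λ g → ⟦ G g ⟧)) ∑Sψ≡ ⟩
      + n ℤ.* + ∑ (λ h → ⟦ G h ⟧ * X h)  ≡⟨ ℤₚ.pos-* n _ ⟨
      + (n * ∑ (λ h → ⟦ G h ⟧ * X h))  ∎)
      where
      open ≡-Reasoning
      dilated : ∀ g → γ g ℤ.* ∑ᶻ (λ y → S y ℤ.* ψ (y ⊗ g)) ≡ γ g ℤ.* ∑ᶻ (λ y → S y ℤ.* ψ y)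
      dilated g with G g in eq
      ... | false = refl
      ... | true  = cong (ℤ._*_ (+ 1)) (trans
        (∑ᶻ-cong λ y → cong₂ ℤ._*_ (sym (S-invariant eq y)) (cong ψ (⊗-comm y g)))
        (∑ᶻ-dilate g (nonzero eq) λ y → S y ℤ.* ψ y))
      ∑Sψ≡ : ∑ᶻ (λ y → S y ℤ.* ψ y) ≡ + ∑ (λ h → ⟦ G h ⟧ * X h)
      ∑Sψ≡ = begin
        ∑ᶻ (λ y → S y ℤ.* ψ y)  ≡⟨ ∑ᶻ-cong (λ y → ℤₚ.*-comm (S y) (ψ y)) ⟩
        ∑ᶻ (λ y → ψ y ℤ.* S y)  ≡⟨ ∑ᶻ-swap ψ γ (λ y h → ψ (y ⊗ h)) ⟩
        ∑ᶻ (λ h → γ h ℤ.* ∑ᶻ λ y → ψ y ℤ.* ψ (y ⊗ h))  ≡⟨ ∑ᶻ-cong (λ h → trans (ℤₚ.pos-* ⟦ G h ⟧ (X h)) (cong (ℤ._*_ (γ h)) (X≡ h))) ⟨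
        ∑ᶻ (λ h → + (⟦ G h ⟧ * X h))  ≡⟨ ∑ᶻ-pos (λ h → ⟦ G h ⟧ * X h) ⟩
        + ∑ (λ h → ⟦ G h ⟧ * X h)  ∎

  -- Invariance of S turns the sum of s² into n times the sum of X over G. Each X h is a sum of
  -- squares, so extending that sum to the whole field can only increase it.
  second-moment : ∑ (λ y → s y * s y) ≤ n * (w * (p * w))
  second-moment = ≤-trans (≤-reflexive ∑s²≡) (*-monoʳ-≤ n (≤-trans (∑-mono λ h → ⟦⟧*≤ (G h) λ _ → ≤-refl) (≤-reflexive ∑X≡)))

-- Level sets of the correlation sum

pairs : ∀ {p} → PrimeField p → (A D : Fin p → Bool) → ℕ
pairs 𝔽 A D = ∑ λ y → ⟦ A y ⟧ * ∑ λ y′ → ⟦ A y′ ⟧ * ⟦ D (y′ ⊝ y) ⟧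
  where open PrimeField 𝔽

-- Pigeonhole over scales: if each of the I steps multiplies by more than K, the factors accumulate
-- to K ^ I.
slow-growth : ∀ K (c : ℕ → ℕ) → 1 ≤ c 0 → ∀ I → (∃[ i ] (i < I × c (suc i) ≤ K * c i)) ⊎ K ^ I ≤ c I
slow-growth K c 1≤c zero = inj₂ 1≤c
slow-growth K c 1≤c (suc I) with slow-growth K c 1≤c I
... | inj₁ (i , i<I , h) = inj₁ (i , m<n⇒m<1+n i<I , h)
... | inj₂ K^I≤c with c (suc I) ≤? K * c I
...   | yes h = inj₁ (I , ≤-refl , h)
...   | no ¬h = inj₂ (≤-trans (*-monoʳ-≤ K K^I≤c) (<⇒≤ (≰⇒> ¬h)))

module LevelSets {p} (𝔽 : PrimeField p) {G : Fin p → Bool} (isSubgroup : IsSubgroup 𝔽 G)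
  (f : Fin p → ℤ) (∑f≡0 : ∑ᶻ f ≡ + 0) where

  open PrimeField 𝔽
  open FieldSums 𝔽
  open IsSubgroup isSubgroup
  open Correlation 𝔽 isSubgroup f ∑f≡0

  -- The product n * w is the trivial bound for s, so q is the factor by which s may fall short of
  -- it.
  level : ℕ → Fin p → Bool
  level q y = ⌊ n * w ≤? q * s y ⌋

  level-invariant : ∀ q {g} → G g ≡ true → ∀ y → level q (g ⊗ y) ≡ level q y
  level-invariant q g∈G y = cong (λ z → ⌊ n * w ≤? q * z ⌋) (s-invariant g∈G y)

  module _ (0<n : 0 < n) (0<w : 0 < w) where

    private
      instance
        n≢0 : NonZero n
        n≢0 = >-nonZero 0<n
        w≢0 : NonZero w
        w≢0 = >-nonZero 0<w
        nw≢0 : NonZero (n * w)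
        nw≢0 = m*n≢0 n w

    -- Chebyshev's inequality for `second-moment`.
    level-card : ∀ q → card (level q) * n ≤ p * (q * q)
    level-card q = *-cancelʳ-≤ _ _ (n * w * w) {{m*n≢0 (n * w) w}} (begin
      card (level q) * n * (n * w * w)  ≡⟨ eq₁ (card (level q)) n w ⟩
      card (level q) * (n * w * (n * w))  ≡⟨ ∑-*ʳ (n * w * (n * w)) (λ y → ⟦ level q y ⟧) ⟩
      ∑ (λ y → ⟦ level q y ⟧ * (n * w * (n * w)))  ≤⟨ ∑-mono pointwise ⟩
      ∑ (λ y → q * q * (s y * s y))  ≡⟨ *-∑ (q * q) (λ y → s y * s y) ⟨
      q * q * ∑ (λ y → s y * s y)  ≤⟨ *-monoʳ-≤ (q * q) second-moment ⟩
      q * q * (n * (w * (p * w)))  ≡⟨ eq₂ q n w p ⟩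
      p * (q * q) * (n * w * w)  ∎)
      where
      open ≤-Reasoning
      eq₁ : ∀ c n w → c * n * (n * w * w) ≡ c * (n * w * (n * w))
      eq₁ = solve-∀
      eq₂ : ∀ q n w p → q * q * (n * (w * (p * w))) ≡ p * (q * q) * (n * w * w)
      eq₂ = solve-∀
      eq₃ : ∀ q s → q * s * (q * s) ≡ q * q * (s * s)
      eq₃ = solve-∀
      pointwise : ∀ y → ⟦ level q y ⟧ * (n * w * (n * w)) ≤ q * q * (s y * s y)
      pointwise y = ⟦⟧*≤ (level q y) λ eq → let h = ⌊⌋-true (n * w ≤? q * s y) eq in
        ≤-trans (*-mono-≤ h h) (≤-reflexive (eq₃ q (s y)))

    -- By `differences-correlate` the mean of s (y′ ⊝ y) over pairs in the level set is at least n w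
    -- / q². Differences outside the level q′ contribute at most n w / q′ each, so at most half of
    -- this mean. The other half comes from pairs counted by `pairs`, each worth at most n w.
    level-pairs : ∀ q q′ → 2 * (q * q) ≤ q′ → card (level q) * card (level q) ≤ 2 * (q * q) * pairs 𝔽 (level q) (level q′)
    level-pairs q q′ 2q²≤q′ = *-cancelʳ-≤ _ _ (n * w) (+-cancelˡ-≤ (N * N * (n * w)) _ _ (begin
      N * N * (n * w) + N * N * (n * w)  ≡⟨ eq₁ (N * N * (n * w)) ⟩
      2 * (N * N * (n * w))  ≤⟨ *-monoʳ-≤ 2 N²nw≤q²Z ⟩
      2 * (q * q * Z)  ≡⟨ *-assoc 2 (q * q) Z ⟨
      2 * (q * q) * Z  ≤⟨ 2q²Z≤ ⟩
      N * N * (n * w) + 2 * (q * q) * P * (n * w)  ∎))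
      where
      open ≤-Reasoning
      A D : Fin p → Bool
      A = level q
      D = level q′
      N T Z P r : ℕ
      N = card A
      T = ∑ λ y → ⟦ A y ⟧ * s y
      Z = ∑ λ y → ⟦ A y ⟧ * ∑ λ y′ → ⟦ A y′ ⟧ * s (y′ ⊝ y)
      P = pairs 𝔽 A D
      r = 2 * (q * q)
      eq₁ : ∀ a → a + a ≡ 2 * a
      eq₁ = solve-∀
      Nnw≤qT : N * (n * w) ≤ q * T
      Nnw≤qT = begin
        N * (n * w)  ≡⟨ ∑-*ʳ (n * w) (λ y → ⟦ A y ⟧) ⟩
        ∑ (λ y → ⟦ A y ⟧ * (n * w))  ≤⟨ ∑-mono (λ y → ⟦⟧*-mono (A y) (⌊⌋-true (n * w ≤? q * s y))) ⟩
        ∑ (λ y → ⟦ A y ⟧ * (q * s y))  ≡⟨ ∑-cong (λ y → eq₂ ⟦ A y ⟧ q (s y)) ⟩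
        ∑ (λ y → q * (⟦ A y ⟧ * s y))  ≡⟨ *-∑ q (λ y → ⟦ A y ⟧ * s y) ⟨
        q * T  ∎
        where
        eq₂ : ∀ a q s → a * (q * s) ≡ q * (a * s)
        eq₂ = solve-∀
      N²nw≤q²Z : N * N * (n * w) ≤ q * q * Z
      N²nw≤q²Z = *-cancelʳ-≤ _ _ (n * w) (begin
        N * N * (n * w) * (n * w)  ≡⟨ eq₃ N (n * w) ⟩
        N * (n * w) * (N * (n * w))  ≤⟨ *-mono-≤ Nnw≤qT Nnw≤qT ⟩
        q * T * (q * T)  ≡⟨ eq₄ q T ⟩
        q * q * (T * T)  ≤⟨ *-monoʳ-≤ (q * q) (differences-correlate A) ⟩
        q * q * (n * w * Z)  ≡⟨ eq₅ (q * q) (n * w) Z ⟩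
        q * q * Z * (n * w)  ∎)
        where
        eq₃ : ∀ N m → N * N * m * m ≡ N * m * (N * m)
        eq₃ = solve-∀
        eq₄ : ∀ q T → q * T * (q * T) ≡ q * q * (T * T)
        eq₄ = solve-∀
        eq₅ : ∀ q m Z → q * (m * Z) ≡ q * Z * m
        eq₅ = solve-∀
      pointwise : ∀ z → r * s z ≤ n * w + r * (n * w) * ⟦ D z ⟧
      pointwise z with D z in eq
      ... | true  = ≤-trans (*-monoʳ-≤ r (s≤nw z)) (≤-trans (≤-reflexive (sym (*-identityʳ _))) (m≤n+m _ (n * w)))
      ... | false = ≤-trans (*-monoˡ-≤ (s z) 2q²≤q′) (≤-trans (<⇒≤ (≰⇒> (⌊⌋-false (n * w ≤? q′ * s z) eq))) (m≤m+n _ _))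
      2q²Z≤ : r * Z ≤ N * N * (n * w) + r * P * (n * w)
      2q²Z≤ = begin
        r * Z
          ≡⟨ push r (λ y y′ → s (y′ ⊝ y)) ⟩
        ∑ (λ y → ⟦ A y ⟧ * ∑ λ y′ → ⟦ A y′ ⟧ * (r * s (y′ ⊝ y)))
          ≤⟨ ∑-mono (λ y → *-monoʳ-≤ ⟦ A y ⟧ (∑-mono λ y′ → *-monoʳ-≤ ⟦ A y′ ⟧ (pointwise (y′ ⊝ y)))) ⟩
        ∑ (λ y → ⟦ A y ⟧ * ∑ λ y′ → ⟦ A y′ ⟧ * (n * w + r * (n * w) * ⟦ D (y′ ⊝ y) ⟧))
          ≡⟨ ∑-cong (λ y → cong (⟦ A y ⟧ *_) (split (λ y′ → ⟦ A y′ ⟧) (n * w) (λ y′ → r * (n * w) * ⟦ D (y′ ⊝ y) ⟧))) ⟩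
        ∑ (λ y → ⟦ A y ⟧ * (N * (n * w) + ∑ λ y′ → ⟦ A y′ ⟧ * (r * (n * w) * ⟦ D (y′ ⊝ y) ⟧)))
          ≡⟨ split (λ y → ⟦ A y ⟧) (N * (n * w)) (λ y → ∑ λ y′ → ⟦ A y′ ⟧ * (r * (n * w) * ⟦ D (y′ ⊝ y) ⟧)) ⟩
        N * (N * (n * w)) + ∑ (λ y → ⟦ A y ⟧ * ∑ λ y′ → ⟦ A y′ ⟧ * (r * (n * w) * ⟦ D (y′ ⊝ y) ⟧))
          ≡⟨ cong₂ _+_ (sym (*-assoc N N (n * w))) (sym (push (r * (n * w)) (λ y y′ → ⟦ D (y′ ⊝ y) ⟧))) ⟩
        N * N * (n * w) + r * (n * w) * P
          ≡⟨ cong (_+_ (N * N * (n * w))) (eq₆ r (n * w) P) ⟩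
        N * N * (n * w) + r * P * (n * w)
          ∎
        where
        eq₆ : ∀ q m Z → q * m * Z ≡ q * Z * m
        eq₆ = solve-∀
        eq₇ : ∀ c a x → c * (a * x) ≡ a * (c * x)
        eq₇ = solve-∀
        push : ∀ c (v : Fin p → Fin p → ℕ) → c * ∑ (λ y → ⟦ A y ⟧ * ∑ λ y′ → ⟦ A y′ ⟧ * v y y′) ≡ ∑ (λ y → ⟦ A y ⟧ * ∑ λ y′ → ⟦ A y′ ⟧ * (c * v y y′))
        push c v = trans (*-∑ c _) (∑-cong λ y → trans (eq₇ c ⟦ A y ⟧ _) (cong (⟦ A y ⟧ *_) (trans (*-∑ c _) (∑-cong λ y′ → eq₇ c ⟦ A y′ ⟧ _))))
        split : (a : Fin p → ℕ) (c : ℕ) (v : Fin p → ℕ) → ∑ (λ y → a y * (c + v y)) ≡ ∑ a * c + ∑ (λ y → a y * v y)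
        split a c v = trans (∑-cong λ y → *-distribˡ-+ (a y) c (v y)) (trans (∑-+ (λ y → a y * c) (λ y → a y * v y)) (cong (_+ _) (sym (∑-*ʳ c a))))

-- Balog–Szemerédi–Gowers

module BalogSzemerédiGowers {p} (𝔽 : PrimeField p) (A D : Fin p → Bool) (K : ℕ)
  (16≤K : 16 ≤ K) (0<N : 0 < card A) (card-D : card D ≤ K * card A)
  (many-pairs : card A * card A ≤ K * pairs 𝔽 A D) where

  open PrimeField 𝔽
  open FieldSums 𝔽
  open Solver using (solve; _:=_; _:+_; _:-_)
  open ≤-Reasoning
  open +-*-Solver using (_:^_; _:*_) renaming (_:=_ to _:≡_)

  private
    N : ℕ
    N = card A

    instance
      N≢0 : NonZero N
      N≢0 = >-nonZero 0<N
      K≢0 : NonZero K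
      K≢0 = >-nonZero (≤-trans (s≤s z≤n) 16≤K)

    α : Fin p → ℕ
    α a = ⟦ A a ⟧

    -- Adjacency in a graph on A: v and a are joined when a - v lies in D.
    e : Fin p → Fin p → ℕ
    e v a = ⟦ D (a ⊝ v) ⟧

    degree : Fin p → ℕ
    degree v = ∑ λ a → α a * e v a

    codegree : Fin p → Fin p → ℕ
    codegree a b = ∑ λ v → α v * (e v a * e v b)

    -- The factor 16 K² is 8 times the 2 K² in `chosen`; cancelling 2 K² there leaves at most one
    -- eighth of the pairs in the chosen neighbourhood bad.
    θ : ℕ
    θ = 16 * (K * K)

    bad : Fin p → Fin p → Bool
    bad a b = ⌊ θ * codegree a b <? N ⌋

    badness : Fin p → Fin p → ℕ
    badness v a = ∑ λ b → (α b * e v b) * ⟦ bad a b ⟧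

    β : Fin p → ℕ
    β v = ∑ λ a → (α a * e v a) * badness v a

    Q : ℕ
    Q = ∑ λ v → α v * (degree v * degree v)

    N³≤K²Q : N * N * N ≤ K * K * Q
    N³≤K²Q = *-cancelʳ-≤ _ _ N (begin
      N * N * N * N  ≡⟨ eq₁ N ⟩
      N * N * (N * N)  ≤⟨ *-mono-≤ many-pairs many-pairs ⟩
      K * P * (K * P)  ≡⟨ eq₂ K P ⟩
      K * K * (P * P)  ≤⟨ *-monoʳ-≤ (K * K) P²≤NQ ⟩
      K * K * (N * Q)  ≡⟨ eq₃ (K * K) N Q ⟩
      K * K * Q * N  ∎)
      where
      P : ℕ
      P = pairs 𝔽 A D
      eq₁ : ∀ N → N * N * N * N ≡ N * N * (N * N)
      eq₁ = solve-∀
      eq₂ : ∀ K P → K * P * (K * P) ≡ K * K * (P * P)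
      eq₂ = solve-∀
      eq₃ : ∀ K N Q → K * (N * Q) ≡ K * Q * N
      eq₃ = solve-∀
      supported : ∀ v → α v * degree v ≡ 0 ⊎ 1 ≤ α v
      supported v with A v
      ... | true  = inj₂ ≤-refl
      ... | false = inj₁ refl
      squared : ∀ v → α v * degree v * (α v * degree v) ≡ α v * (degree v * degree v)
      squared v = trans (rearrange (α v) (degree v)) (cong (_* (degree v * degree v)) (⟦⟧-idem (A v)))
        where
        rearrange : ∀ a d → a * d * (a * d) ≡ a * a * (d * d)
        rearrange = solve-∀
      P²≤NQ : P * P ≤ N * Q
      P²≤NQ = ≤-trans (cauchy-schwarz-support (λ v → α v * degree v) α supported) (≤-reflexive (cong (N *_) (∑-cong squared)))

    ∑β≡ : ∑ (λ v → α v * β v) ≡ ∑ λ a → α a * ∑ λ b → α b * (codegree a b * ⟦ bad a b ⟧)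
    ∑β≡ = begin-equality
      ∑ (λ v → α v * ∑ λ a → (α a * e v a) * badness v a)  ≡⟨ ∑-cong (λ v → cong (α v *_) (∑-cong λ a → *-assoc (α a) (e v a) _)) ⟩
      ∑ (λ v → α v * ∑ λ a → α a * (e v a * badness v a))  ≡⟨ ∑-swap α α (λ v a → e v a * badness v a) ⟩
      ∑ (λ a → α a * ∑ λ v → α v * (e v a * badness v a))  ≡⟨ ∑-cong (λ a → cong (α a *_) (inner a)) ⟩
      ∑ (λ a → α a * ∑ λ b → α b * (codegree a b * ⟦ bad a b ⟧)) ∎
      where
      regroup : ∀ x y z w → x * (y * z * w) ≡ y * (x * z * w)
      regroup = solve-∀
      regroup′ : ∀ x y w → x * (y * w) ≡ (x * y) * w
      regroup′ = solve-∀
      inner : ∀ a → ∑ (λ v → α v * (e v a * badness v a)) ≡ ∑ λ b → α b * (codegree a b * ⟦ bad a b ⟧)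
      inner a = begin-equality
        ∑ (λ v → α v * (e v a * badness v a))  ≡⟨ ∑-cong (λ v → cong (α v *_) (trans (*-∑ (e v a) _) (∑-cong λ b → regroup (e v a) (α b) (e v b) ⟦ bad a b ⟧))) ⟩
        ∑ (λ v → α v * ∑ λ b → α b * (e v a * e v b * ⟦ bad a b ⟧))  ≡⟨ ∑-swap α α (λ v b → e v a * e v b * ⟦ bad a b ⟧) ⟩
        ∑ (λ b → α b * ∑ λ v → α v * (e v a * e v b * ⟦ bad a b ⟧))  ≡⟨ ∑-cong (λ b → cong (α b *_) (trans (∑-cong λ v → regroup′ (α v) (e v a * e v b) ⟦ bad a b ⟧) (sym (∑-*ʳ ⟦ bad a b ⟧ (λ v → α v * (e v a * e v b)))))) ⟩
        ∑ (λ b → α b * (codegree a b * ⟦ bad a b ⟧))  ∎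

    -- A bad pair has fewer than N / θ common neighbours, so it lies in fewer than N / θ of the
    -- neighbourhoods, and there are at most N² pairs.
    θ∑β≤N³ : θ * ∑ (λ v → α v * β v) ≤ N * N * N
    θ∑β≤N³ = begin
      θ * ∑ (λ v → α v * β v)  ≡⟨ cong (θ *_) ∑β≡ ⟩
      θ * ∑ (λ a → α a * ∑ λ b → α b * (codegree a b * ⟦ bad a b ⟧))  ≡⟨ ∑-*-pull θ α _ ⟩
      ∑ (λ a → α a * (θ * ∑ λ b → α b * (codegree a b * ⟦ bad a b ⟧)))  ≡⟨ ∑-cong (λ a → cong (α a *_) (∑-*-pull θ α _)) ⟩
      ∑ (λ a → α a * ∑ λ b → α b * (θ * (codegree a b * ⟦ bad a b ⟧)))  ≤⟨ ∑-mono (λ a → *-monoʳ-≤ (α a) (∑-mono λ b → *-monoʳ-≤ (α b) (pointwise a b))) ⟩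
      ∑ (λ a → α a * ∑ λ b → α b * N)  ≡⟨ ∑-cong (λ a → cong (α a *_) (∑-*ʳ N α)) ⟨
      ∑ (λ a → α a * (N * N))  ≡⟨ ∑-*ʳ (N * N) α ⟨
      N * (N * N)  ≡⟨ *-assoc N N N ⟨
      N * N * N  ∎
      where
      pointwise : ∀ a b → θ * (codegree a b * ⟦ bad a b ⟧) ≤ N
      pointwise a b with bad a b in eq
      ... | false rewrite *-zeroʳ (codegree a b) | *-zeroʳ θ = z≤n
      ... | true  rewrite *-identityʳ (codegree a b) = <⇒≤ (⌊⌋-true (θ * codegree a b <? N) eq)

    -- An average over v that asks for a large degree and few bad pairs at once. The successor on
    -- the right makes the comparison strict, as the existence lemma requires; for a single v it is
    -- undone by passing from < to ≤.
    ∑-compare : ∑ (λ v → α v * (θ * β v + N * N)) < ∑ (λ v → α v * suc (2 * (K * K) * (degree v * degree v)))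
    ∑-compare = begin-strict
      ∑ (λ v → α v * (θ * β v + N * N))  ≡⟨ ∑-cong (λ v → *-distribˡ-+ (α v) (θ * β v) (N * N)) ⟩
      ∑ (λ v → α v * (θ * β v) + α v * (N * N))  ≡⟨ ∑-+ (λ v → α v * (θ * β v)) (λ v → α v * (N * N)) ⟩
      ∑ (λ v → α v * (θ * β v)) + ∑ (λ v → α v * (N * N))  ≡⟨ cong₂ _+_ (∑-*-pull θ α β) (∑-*ʳ (N * N) α) ⟨
      θ * ∑ (λ v → α v * β v) + N * (N * N)  ≤⟨ +-mono-≤ θ∑β≤N³ (≤-reflexive (sym (*-assoc N N N))) ⟩
      N * N * N + N * N * N  ≤⟨ +-mono-≤ N³≤K²Q N³≤K²Q ⟩
      K * K * Q + K * K * Q  ≡⟨ eq₁ (K * K) Q ⟩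
      2 * (K * K) * Q  <⟨ m<n+m (2 * (K * K) * Q) 0<N ⟩
      N + 2 * (K * K) * Q  ≡⟨ cong (_+_ N) (∑-*-pull (2 * (K * K)) α (λ v → degree v * degree v)) ⟩
      N + ∑ (λ v → α v * (2 * (K * K) * (degree v * degree v)))  ≡⟨ ∑-+ α (λ v → α v * (2 * (K * K) * (degree v * degree v))) ⟨
      ∑ (λ v → α v + α v * (2 * (K * K) * (degree v * degree v)))  ≡⟨ ∑-cong (λ v → *-suc (α v) (2 * (K * K) * (degree v * degree v))) ⟨
      ∑ (λ v → α v * suc (2 * (K * K) * (degree v * degree v)))  ∎
      where
      eq₁ : ∀ k q → k * q + k * q ≡ 2 * k * q
      eq₁ = solve-∀

    opaque
      good-vertex : ∃[ v ] (A v ≡ true × θ * β v + N * N < suc (2 * (K * K) * (degree v * degree v)))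
      good-vertex = ∑-⟦⟧-<⇒∃ A (λ v → θ * β v + N * N) (λ v → suc (2 * (K * K) * (degree v * degree v))) ∑-compare

    v₀ : Fin p
    v₀ = proj₁ good-vertex

    V : Fin p → Bool
    V a = A a ∧ D (a ⊝ v₀)

    ⟦V⟧ : ∀ a → ⟦ V a ⟧ ≡ α a * e v₀ a
    ⟦V⟧ a = ⟦∧⟧ (A a) (D (a ⊝ v₀))

    δ : ℕ
    δ = card V

    bd : Fin p → ℕ
    bd a = ∑ λ b → ⟦ V b ⟧ * ⟦ bad a b ⟧

    chosen : θ * ∑ (λ a → ⟦ V a ⟧ * bd a) + N * N ≤ 2 * (K * K) * (δ * δ)
    chosen = subst₂ (λ x d → θ * x + N * N ≤ 2 * (K * K) * (d * d))
      (sym (∑-cong λ a → cong₂ _*_ (⟦V⟧ a) (∑-cong λ b → cong (_* ⟦ bad a b ⟧) (⟦V⟧ b))))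
      (sym (∑-cong ⟦V⟧)) (s≤s⁻¹ (proj₂ (proj₂ good-vertex)))

    N²≤2K²δ² : N * N ≤ 2 * (K * K) * (δ * δ)
    N²≤2K²δ² = ≤-trans (m≤n+m _ _) chosen

    N≤2Kδ : N ≤ 2 * K * δ
    N≤2Kδ = square-cancel-≤ (≤-trans N²≤2K²δ² (≤-trans (m≤m+n _ _) (≤-reflexive (eq K δ))))
      where
      eq : ∀ K d → 2 * (K * K) * (d * d) + 2 * (K * K) * (d * d) ≡ 2 * K * d * (2 * K * d)
      eq = solve-∀

    instance
      δ≢0 : NonZero δ
      δ≢0 = ≢-nonZero λ δ≡0 → <⇒≱ 0<N (≤-trans N≤2Kδ (≤-reflexive (trans (cong (2 * K *_) δ≡0) (*-zeroʳ (2 * K)))))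

    8∑bd≤δ² : 8 * ∑ (λ a → ⟦ V a ⟧ * bd a) ≤ δ * δ
    8∑bd≤δ² = *-cancelˡ-≤ (2 * (K * K)) {{m*n≢0 2 (K * K) {{_}} {{m*n≢0 K K}}}}
      (≤-trans (≤-reflexive (eq K (∑ λ a → ⟦ V a ⟧ * bd a))) (≤-trans (m≤m+n _ _) chosen))
      where
      eq : ∀ K x → 2 * (K * K) * (8 * x) ≡ 16 * (K * K) * x
      eq = solve-∀

  -- Keeps the vertices of V that are bad with at most a quarter of V, so that any two of them share
  -- at least half of V as good partners.
  A′ : Fin p → Bool
  A′ a = V a ∧ ⌊ 4 * bd a ≤? δ ⌋

  private
    δ≤2∣A′∣ : δ ≤ 2 * card A′
    δ≤2∣A′∣ = *-cancelʳ-≤ _ _ δ (+-cancelˡ-≤ (δ * δ) _ _ (begin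
      δ * δ + δ * δ  ≡⟨ eq₁ (δ * δ) ⟩
      2 * (δ * δ)  ≡⟨ cong (2 *_) (∑-*ʳ δ (λ a → ⟦ V a ⟧)) ⟩
      2 * ∑ (λ a → ⟦ V a ⟧ * δ)  ≤⟨ *-monoʳ-≤ 2 (∑-mono pointwise) ⟩
      2 * ∑ (λ a → ⟦ A′ a ⟧ * δ + 4 * (⟦ V a ⟧ * bd a))  ≡⟨ cong (2 *_) (∑-+ (λ a → ⟦ A′ a ⟧ * δ) (λ a → 4 * (⟦ V a ⟧ * bd a))) ⟩
      2 * (∑ (λ a → ⟦ A′ a ⟧ * δ) + ∑ (λ a → 4 * (⟦ V a ⟧ * bd a)))  ≡⟨ cong (2 *_) (cong₂ _+_ (∑-*ʳ δ (λ a → ⟦ A′ a ⟧)) (*-∑ 4 (λ a → ⟦ V a ⟧ * bd a))) ⟨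
      2 * (card A′ * δ + 4 * ∑ (λ a → ⟦ V a ⟧ * bd a))  ≡⟨ eq₂ (card A′) δ (∑ λ a → ⟦ V a ⟧ * bd a) ⟩
      8 * ∑ (λ a → ⟦ V a ⟧ * bd a) + 2 * card A′ * δ  ≤⟨ +-monoˡ-≤ _ 8∑bd≤δ² ⟩
      δ * δ + 2 * card A′ * δ  ∎))
      where
      eq₁ : ∀ x → x + x ≡ 2 * x
      eq₁ = solve-∀
      eq₂ : ∀ a d x → 2 * (a * d + 4 * x) ≡ 8 * x + 2 * a * d
      eq₂ = solve-∀
      pointwise : ∀ a → ⟦ V a ⟧ * δ ≤ ⟦ A′ a ⟧ * δ + 4 * (⟦ V a ⟧ * bd a)
      pointwise a = split (V a) ⌊ 4 * bd a ≤? δ ⌋ λ eq → <⇒≤ (≰⇒> (⌊⌋-false (4 * bd a ≤? δ) eq))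
        where
        split : ∀ v c {x d} → (c ≡ false → d ≤ 4 * x) → ⟦ v ⟧ * d ≤ ⟦ v ∧ c ⟧ * d + 4 * (⟦ v ⟧ * x)
        split false _     h = z≤n
        split true  true  h = m≤m+n _ _
        split true  false {x} {d} h = subst₂ (λ d x → d ≤ 4 * x) (sym (*-identityˡ d)) (sym (*-identityˡ x)) (h refl)

    -- Counts the representations of z as a sum of two differences of elements of D.
    r₄ : Fin p → ℕ
    r₄ z = ∑ λ v → correlation D v * correlation D (z ⊝ v)

    ∑r₄ : ∑ r₄ ≡ card D * card D * (card D * card D)
    ∑r₄ = trans (∑-convolution (correlation D) (correlation D)) (cong₂ _*_ (∑-correlation D) (∑-correlation D))

    codegree≤r : ∀ a b → codegree a b ≤ correlation D (a ⊝ b)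
    codegree≤r a b = begin
      ∑ (λ v → α v * (e v a * e v b))  ≤⟨ ∑-mono (λ v → ⟦⟧*≤ (A v) λ _ → ≤-refl) ⟩
      ∑ (λ v → ⟦ D (a ⊝ v) ⟧ * ⟦ D (b ⊝ v) ⟧)  ≡⟨ ∑-cong (λ v → trans (*-comm ⟦ D (a ⊝ v) ⟧ _) (cong (λ z → ⟦ D (b ⊝ v) ⟧ * ⟦ D z ⟧) (rearrange a b v))) ⟩
      ∑ (λ v → ⟦ D (b ⊝ v) ⟧ * ⟦ D (b ⊝ v ⊕ (a ⊝ b)) ⟧)  ≡⟨ ∑-reflect b (λ u → ⟦ D u ⟧ * ⟦ D (u ⊕ (a ⊝ b)) ⟧) ⟩
      correlation D (a ⊝ b)  ∎
      where
      rearrange : ∀ a b v → a ⊝ v ≡ b ⊝ v ⊕ (a ⊝ b)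
      rearrange = solve 3 (λ a b v → a :- v := b :- v :+ (a :- b)) refl

    codegree-sym : ∀ a b → codegree a b ≡ codegree b a
    codegree-sym a b = ∑-cong λ v → cong (α v *_) (*-comm (e v a) (e v b))

    -- Each common good partner b splits a - a′ into (a - b) + (b - a′), and each summand is a
    -- difference of elements of D in at least N / θ ways. Distinct b give distinct splittings.
    many-paths : ∀ {a a′} → A′ a ≡ true → A′ a′ ≡ true → δ * (N * N) ≤ 2 * (θ * θ) * r₄ (a ⊝ a′)
    many-paths {a} {a′} a∈A′ a′∈A′ = begin
      δ * (N * N)  ≤⟨ *-monoˡ-≤ (N * N) δ≤2g ⟩
      2 * card good * (N * N)  ≡⟨ *-assoc 2 (card good) (N * N) ⟩
      2 * (card good * (N * N))  ≡⟨ cong (2 *_) (∑-*ʳ (N * N) (λ b → ⟦ good b ⟧)) ⟩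
      2 * ∑ (λ b → ⟦ good b ⟧ * (N * N))  ≤⟨ *-monoʳ-≤ 2 (∑-mono λ b → ⟦⟧*≤ (good b) (good-paths b)) ⟩
      2 * ∑ (λ b → θ * θ * (correlation D (a ⊝ b) * correlation D (a ⊝ a′ ⊝ (a ⊝ b))))  ≡⟨ cong (2 *_) (*-∑ (θ * θ) (λ b → correlation D (a ⊝ b) * correlation D (a ⊝ a′ ⊝ (a ⊝ b)))) ⟨
      2 * (θ * θ * ∑ (λ b → correlation D (a ⊝ b) * correlation D (a ⊝ a′ ⊝ (a ⊝ b))))  ≡⟨ cong (λ x → 2 * (θ * θ * x)) (∑-reflect a (λ v → correlation D v * correlation D (a ⊝ a′ ⊝ v))) ⟩
      2 * (θ * θ * r₄ (a ⊝ a′))  ≡⟨ *-assoc 2 (θ * θ) _ ⟨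
      2 * (θ * θ) * r₄ (a ⊝ a′)  ∎
      where
      few-bad : ∀ {c} → A′ c ≡ true → 4 * bd c ≤ δ
      few-bad {c} c∈A′ = ⌊⌋-true (4 * bd c ≤? δ) (proj₂ (∧-true (V c) _ c∈A′))
      good : Fin p → Bool
      good b = V b ∧ (not (bad a b) ∧ not (bad a′ b))
      pointwise : ∀ b → ⟦ V b ⟧ ≤ ⟦ V b ⟧ * ⟦ bad a b ⟧ + ⟦ V b ⟧ * ⟦ bad a′ b ⟧ + ⟦ good b ⟧
      pointwise b with V b | bad a b | bad a′ b
      ... | false | _     | _     = z≤n
      ... | true  | true  | _     = s≤s z≤n
      ... | true  | false | true  = s≤s z≤n
      ... | true  | false | false = s≤s z≤n
      δ≤ : δ ≤ bd a + bd a′ + card good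
      δ≤ = ≤-trans (∑-mono pointwise) (≤-reflexive (trans (∑-+ _ _) (cong (_+ card good) (∑-+ _ _))))
      δ≤2g : δ ≤ 2 * card good
      δ≤2g = *-cancelˡ-≤ 2 (+-cancelˡ-≤ (δ + δ) _ _ (begin
        δ + δ + 2 * δ  ≡⟨ eq₁ δ ⟩
        4 * δ  ≤⟨ *-monoʳ-≤ 4 δ≤ ⟩
        4 * (bd a + bd a′ + card good)  ≡⟨ eq₂ (bd a) (bd a′) (card good) ⟩
        4 * bd a + 4 * bd a′ + 4 * card good  ≤⟨ +-monoˡ-≤ _ (+-mono-≤ (few-bad a∈A′) (few-bad a′∈A′)) ⟩
        δ + δ + 4 * card good  ≡⟨ cong (_+_ (δ + δ)) (*-assoc 2 2 (card good)) ⟩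
        δ + δ + 2 * (2 * card good)  ∎))
        where
        eq₁ : ∀ d → d + d + 2 * d ≡ 4 * d
        eq₁ = solve-∀
        eq₂ : ∀ x y z → 4 * (x + y + z) ≡ 4 * x + 4 * y + 4 * z
        eq₂ = solve-∀
      not-bad : ∀ c b → not (bad c b) ≡ true → N ≤ θ * codegree c b
      not-bad c b h with bad c b in eq
      ... | false = ≮⇒≥ (⌊⌋-false (θ * codegree c b <? N) eq)
      good-paths : ∀ b → good b ≡ true → N * N ≤ θ * θ * (correlation D (a ⊝ b) * correlation D (a ⊝ a′ ⊝ (a ⊝ b)))
      good-paths b h = begin
        N * N  ≤⟨ *-mono-≤ (not-bad a b (proj₁ nots)) (not-bad a′ b (proj₂ nots)) ⟩
        θ * codegree a b * (θ * codegree a′ b)  ≡⟨ eq θ (codegree a b) (codegree a′ b) ⟩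
        θ * θ * (codegree a b * codegree a′ b)  ≡⟨ cong (λ x → θ * θ * (codegree a b * x)) (codegree-sym a′ b) ⟩
        θ * θ * (codegree a b * codegree b a′)  ≤⟨ *-monoʳ-≤ (θ * θ) (*-mono-≤ (codegree≤r a b) (codegree≤r b a′)) ⟩
        θ * θ * (correlation D (a ⊝ b) * correlation D (b ⊝ a′))  ≡⟨ cong (λ z → θ * θ * (correlation D (a ⊝ b) * correlation D z)) (rearrange a a′ b) ⟩
        θ * θ * (correlation D (a ⊝ b) * correlation D (a ⊝ a′ ⊝ (a ⊝ b)))  ∎
        where
        nots : not (bad a b) ≡ true × not (bad a′ b) ≡ true
        nots = ∧-true _ _ (proj₂ (∧-true (V b) _ h))
        eq : ∀ t x y → t * x * (t * y) ≡ t * t * (x * y)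
        eq = solve-∀
        rearrange : ∀ a a′ b → b ⊝ a′ ≡ a ⊝ a′ ⊝ (a ⊝ b)
        rearrange = solve 3 (λ a a′ b → b :- a′ := a :- a′ :- (a :- b)) refl

    E : Fin p → Bool
    E = differenceSet A′

  A′⊆A : ∀ {a} → A′ a ≡ true → A a ≡ true
  A′⊆A {a} h = proj₁ (∧-true (A a) _ (proj₁ (∧-true (V a) _ h)))

  private
    ≤K : ∀ {c} → c ≤ 16 → c ≤ K
    ≤K c≤16 = ≤-trans c≤16 16≤K

  card-A≤ : card A ≤ K ^ 2 * card A′
  card-A≤ = begin
    card A  ≤⟨ N≤2Kδ ⟩
    2 * K * δ  ≤⟨ *-monoʳ-≤ (2 * K) δ≤2∣A′∣ ⟩
    2 * K * (2 * card A′)  ≡⟨ eq₁ K (card A′) ⟩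
    4 * (K * card A′)  ≤⟨ *-monoˡ-≤ _ (≤K (toWitness {a? = 4 ≤? 16} tt)) ⟩
    K * (K * card A′)  ≡⟨ eq₂ K (card A′) ⟩
    K ^ 2 * card A′  ∎
    where
    eq₁ : ∀ K a → 2 * K * (2 * a) ≡ 4 * (K * a)
    eq₁ = solve-∀
    eq₂ : ∀ K a → K * (K * a) ≡ K ^ 2 * a
    eq₂ = +-*-Solver.solve 2 (λ K a → K :* (K :* a) :≡ K :^ 2 :* a) refl

  -- Double counting: there are |D|⁴ quadruples in all, and by `many-paths` each difference uses
  -- many of them. The exponent is 7 from 2θ², 4 from |D|⁴, 3 from N² ≤ 2K²δ² and 1 from δ ≤ 2|A′|;
  -- numerical constants are absorbed by 16 ≤ K.
  card-differenceSet≤ : card (differenceSet A′) ≤ K ^ 15 * card A′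
  card-differenceSet≤ = *-cancelʳ-≤ _ _ δ (*-cancelʳ-≤ _ _ (N * N) {{m*n≢0 N N}} (begin
    card E * δ * (N * N)  ≡⟨ *-assoc (card E) δ (N * N) ⟩
    card E * (δ * (N * N))  ≡⟨ ∑-*ʳ (δ * (N * N)) (λ z → ⟦ E z ⟧) ⟩
    ∑ (λ z → ⟦ E z ⟧ * (δ * (N * N)))  ≤⟨ ∑-mono (λ z → ⟦⟧*≤ (E z) (pointwise z)) ⟩
    ∑ (λ z → 2 * (θ * θ) * r₄ z)  ≡⟨ *-∑ (2 * (θ * θ)) r₄ ⟨
    2 * (θ * θ) * ∑ r₄  ≡⟨ cong (2 * (θ * θ) *_) ∑r₄ ⟩
    2 * (θ * θ) * (card D * card D * (card D * card D))  ≤⟨ *-mono-≤ 2θ²≤ (*-mono-≤ (*-mono-≤ card-D card-D) (*-mono-≤ card-D card-D)) ⟩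
    x * (K * N * (K * N) * (K * N * (K * N)))  ≡⟨ eq₁ x K N ⟩
    y * (N * N) * (N * N)  ≤⟨ *-monoˡ-≤ (N * N) (*-monoʳ-≤ y N²≤2K²δ²) ⟩
    y * (2 * (K * K) * (δ * δ)) * (N * N)  ≤⟨ *-monoˡ-≤ (N * N) (*-monoʳ-≤ y (*-monoˡ-≤ (δ * δ) (*-monoˡ-≤ (K * K) (≤K 2≤16)))) ⟩
    y * (K * (K * K) * (δ * δ)) * (N * N)  ≡⟨ eq₂ y (K * (K * K)) δ (N * N) ⟩
    y * (K * (K * K)) * δ * δ * (N * N)  ≤⟨ *-monoˡ-≤ (N * N) (*-monoˡ-≤ δ (*-monoʳ-≤ (y * (K * (K * K))) (≤-trans δ≤2∣A′∣ (*-monoˡ-≤ (card A′) (≤K 2≤16))))) ⟩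
    y * (K * (K * K)) * (K * card A′) * δ * (N * N)  ≡⟨ cong (λ z → z * δ * (N * N)) (*-assoc (y * (K * (K * K))) K (card A′)) ⟨
    y * (K * (K * K)) * K * card A′ * δ * (N * N)  ≡⟨ cong (λ z → z * card A′ * δ * (N * N)) (eq₃ K) ⟩
    K ^ 15 * card A′ * δ * (N * N)  ∎))
    where
    2≤16 : 2 ≤ 16
    2≤16 = toWitness {a? = 2 ≤? 16} tt
    x y : ℕ
    x = K * (K * (K * K) * (K * (K * K)))
    y = x * (K * K * (K * K))
    2θ²≤ : 2 * (θ * θ) ≤ x
    2θ²≤ = *-mono-≤ (≤K 2≤16) (*-mono-≤ (*-monoˡ-≤ (K * K) 16≤K) (*-monoˡ-≤ (K * K) 16≤K))
    eq₁ : ∀ x K N → x * (K * N * (K * N) * (K * N * (K * N))) ≡ x * (K * K * (K * K)) * (N * N) * (N * N)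
    eq₁ = solve-∀
    eq₂ : ∀ y c d m → y * (c * (d * d)) * m ≡ y * c * d * d * m
    eq₂ = solve-∀
    eq₃ : ∀ K → K * (K * (K * K) * (K * (K * K))) * (K * K * (K * K)) * (K * (K * K)) * K ≡ K ^ 15
    eq₃ = +-*-Solver.solve 1 (λ K → K :* (K :* (K :* K) :* (K :* (K :* K))) :* (K :* K :* (K :* K)) :* (K :* (K :* K)) :* K :≡ K :^ 15) refl
    pointwise : ∀ z → E z ≡ true → δ * (N * N) ≤ 2 * (θ * θ) * r₄ z
    pointwise z z∈E =
      let a , a′ , a∈A′ , a′∈A′ , z≡ = differenceSet-∈ A′ z z∈E
      in subst (λ z → δ * (N * N) ≤ 2 * (θ * θ) * r₄ z) (sym z≡) (many-paths a∈A′ a′∈A′)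

-- Ruzsa covering

module RuzsaCovering {p} (𝔽 : PrimeField p) where
  open PrimeField 𝔽
  open FieldSums 𝔽
  open Solver using (solve; _:=_; _:+_; _:-_)

  representations : (X U : Fin p → Bool) → Fin p → ℕ
  representations X U z = ∑ λ x → ⟦ X x ⟧ * ⟦ U (z ⊝ x) ⟧

  sumset : (X U : Fin p → Bool) → Fin p → Bool
  sumset X U z = ⌊ 0 <? representations X U z ⌋

  ∈-sumset : ∀ X U {x u} → X x ≡ true → U u ≡ true → sumset X U (x ⊕ u) ≡ true
  ∈-sumset X U {x} {u} x∈X u∈U = true-⌊⌋ (0 <? representations X U (x ⊕ u))
    (<-≤-trans z<s (≤-trans (≤-reflexive term) (≤-∑ (λ y → ⟦ X y ⟧ * ⟦ U (x ⊕ u ⊝ y) ⟧) x)))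
    where
    x⊕u⊝x : ∀ x u → x ⊕ u ⊝ x ≡ u
    x⊕u⊝x = solve 2 (λ x u → x :+ u :- x := u) refl
    term : 1 ≡ ⟦ X x ⟧ * ⟦ U (x ⊕ u ⊝ x) ⟧
    term rewrite x∈X | x⊕u⊝x x u | u∈U = refl

  sumset-∈ : ∀ X U z → sumset X U z ≡ true → ∃[ x ] ∃[ u ] (X x ≡ true × U u ≡ true × z ≡ x ⊕ u)
  sumset-∈ X U z z∈ =
    let x , 0<term = ∑>0⇒∃ (λ x → ⟦ X x ⟧ * ⟦ U (z ⊝ x) ⟧) (⌊⌋-true (0 <? representations X U z) z∈)
        x∈X , u∈U = ∧-true (X x) (U (z ⊝ x)) (⟦⟧>0 _ (subst (0 <_) (sym (⟦∧⟧ (X x) (U (z ⊝ x)))) 0<term))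
    in x , z ⊝ x , x∈X , u∈U , solve 2 (λ x z → z := x :+ (z :- x)) refl x z

  multiplicity : (U : Fin p → Bool) → List (Fin p) → Fin p → ℕ
  multiplicity U []      z = 0
  multiplicity U (t ∷ T) z = ⟦ U (z ⊝ t) ⟧ + multiplicity U T z

  ∑-multiplicity : ∀ U T → ∑ (multiplicity U T) ≡ length T * card U
  ∑-multiplicity U []      = trans (∑-const p 0) (*-zeroʳ p)
  ∑-multiplicity U (t ∷ T) = trans (∑-+ (λ z → ⟦ U (z ⊝ t) ⟧) (multiplicity U T))
    (cong₂ _+_ (∑-unshift t λ z → ⟦ U z ⟧) (∑-multiplicity U T))

  multiplicity>0 : ∀ U T {z} → 0 < multiplicity U T z → ∃[ t ] (t ∈ T × U (z ⊝ t) ≡ true)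
  multiplicity>0 U (t ∷ T) {z} h with U (z ⊝ t) in eq
  ... | true  = t , here refl , eq
  ... | false = let t′ , t′∈T , h′ = multiplicity>0 U T h in t′ , there t′∈T , h′

  ∈⇒multiplicity>0 : ∀ U {T t z} → t ∈ T → U (z ⊝ t) ≡ true → 0 < multiplicity U T z
  ∈⇒multiplicity>0 U (here refl) h = ≤-trans (≤-reflexive (cong ⟦_⟧ (sym h))) (m≤m+n _ _)
  ∈⇒multiplicity>0 U (there t∈T) h = ≤-trans (∈⇒multiplicity>0 U t∈T h) (m≤n+m _ _)

  module _ (X U : Fin p → Bool) {u₀ : Fin p} (u₀∈U : U u₀ ≡ true) where
    private
      Near : List (Fin p) → Fin p → Set
      Near T x = ∃[ t ] ∃[ u ] ∃[ u′ ] (t ∈ T × U u ≡ true × U u′ ≡ true × x ≡ t ⊕ (u ⊝ u′))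

      -- One inequality says that the translates t + U are pairwise disjoint and lie inside X + U;
      -- summing it over z bounds the length of T.
      Packing : List (Fin p) → Set
      Packing T = ∀ z → multiplicity U T z ≤ ⟦ sumset X U z ⟧

      meets? : ∀ T x → Dec (∃[ z ] (U (z ⊝ x) ≡ true × 0 < multiplicity U T z))
      meets? T x = Fin.any? λ z → (U (z ⊝ x) Bool.≟ true) ×-dec (0 <? multiplicity U T z)

      near-here : ∀ {T} x → Near (x ∷ T) x
      near-here x = x , u₀ , u₀ , here refl , u₀∈U , u₀∈U , solve 2 (λ x u → x := x :+ (u :- u)) refl x u₀

      near-there : ∀ {T y x} → Near T x → Near (y ∷ T) x
      near-there (t , u , u′ , t∈T , rest) = t , u , u′ , there t∈T , rest

      meets⇒near : ∀ {T x} → ∃[ z ] (U (z ⊝ x) ≡ true × 0 < multiplicity U T z) → Near T x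
      meets⇒near {T} {x} (z , z-x∈U , h) =
        let t , t∈T , z-t∈U = multiplicity>0 U T h
        in t , z ⊝ t , z ⊝ x , t∈T , z-t∈U , z-x∈U , solve 3 (λ x t z → x := t :+ ((z :- t) :- (z :- x))) refl x t z

      extend : ∀ {T x} → X x ≡ true → Packing T → ¬ (∃[ z ] (U (z ⊝ x) ≡ true × 0 < multiplicity U T z)) → Packing (x ∷ T)
      extend {T} {x} x∈X packing disjoint z = split (U (z ⊝ x)) refl
        where
        x⊕z⊝x : ∀ x z → x ⊕ (z ⊝ x) ≡ z
        x⊕z⊝x = solve 2 (λ x z → x :+ (z :- x) := z) refl
        split : ∀ b → U (z ⊝ x) ≡ b → ⟦ b ⟧ + multiplicity U T z ≤ ⟦ sumset X U z ⟧
        split false _  = packing z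
        split true  eq = ≤-reflexive (trans (cong suc (n≤0⇒n≡0 (≮⇒≥ λ h → disjoint (z , eq , h))))
          (cong ⟦_⟧ (sym (subst (λ y → sumset X U y ≡ true) (x⊕z⊝x x z) (∈-sumset X U x∈X eq)))))

      -- An element x is added when x + U is disjoint from the translates chosen before. Otherwise a
      -- common point z gives x = t + ((z - t) - (z - x)), which is near t.
      greedy : ∀ xs → ∃[ T ] (Packing T × ∀ {x} → x ∈ xs → X x ≡ true → Near T x)
      greedy [] = [] , (λ _ → z≤n) , λ ()
      greedy (x ∷ xs) with greedy xs | X x in eq
      ... | T , packing , near | false = T , packing , λ where
        (here refl) x∈X → ⊥-elim (false≢true (trans (sym eq) x∈X))
        (there y∈xs) y∈X → near y∈xs y∈X
      ... | T , packing , near | true with meets? T x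
      ...   | yes meets = T , packing , λ where
        (here refl) _ → meets⇒near meets
        (there y∈xs) y∈X → near y∈xs y∈X
      ...   | no disjoint = x ∷ T , extend {T} eq packing disjoint , λ where
        (here refl) _ → near-here x
        (there y∈xs) y∈X → near-there (near y∈xs y∈X)

    ruzsa-covering : ∃[ T ] (length T * card U ≤ card (sumset X U) ×
      (∀ x → X x ≡ true → ∃[ t ] ∃[ u ] ∃[ u′ ] (t ∈ T × U u ≡ true × U u′ ≡ true × x ≡ t ⊕ (u ⊝ u′))))
    ruzsa-covering = let T , packing , near = greedy (allFin p) in
      T , ≤-trans (≤-reflexive (sym (∑-multiplicity U T))) (∑-mono packing) , λ x → near (∈-allFin x)

-- Approximate rings

length-cartesianProductWith : ∀ {A B C : Set} (f : A → B → C) xs ys → length (cartesianProductWith f xs ys) ≡ length xs * length ys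
length-cartesianProductWith f []       ys = refl
length-cartesianProductWith f (x ∷ xs) ys = trans (length-++ (map (f x) ys)) (cong₂ _+_ (length-map (f x) ys) (length-cartesianProductWith f xs ys))

module ApproximateRing {p} (𝔽 : PrimeField p) (A : Fin p → Bool) (k : ℕ)
  (2≤k : 2 ≤ k) {a₀ : Fin p} (a₀∈A : A a₀ ≡ true)
  (card-E : card (FieldSums.differenceSet 𝔽 A) ≤ k * card A) where

  open PrimeField 𝔽
  open FieldSums 𝔽
  open RuzsaCovering 𝔽
  open Solver using (solve; _:=_; _:+_; _:*_; _:-_; :-_)

  private
    instance
      k≢0 : NonZero k
      k≢0 = >-nonZero (≤-trans (s≤s z≤n) 2≤k)

    a : ℕ
    a = card A

    0<a : 0 < a
    0<a = ≤-trans (≤-reflexive (cong ⟦_⟧ (sym a₀∈A))) (≤-∑ (λ x → ⟦ A x ⟧) a₀)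

    instance
      a≢0 : NonZero a
      a≢0 = >-nonZero 0<a

    E : Fin p → Bool
    E = differenceSet A

    r : Fin p → ℕ
    r = correlation A

  S : Fin p → Bool
  S z = ⌊ a ≤? 2 * k * r z ⌋

  -- Covering by translates of S produces translates of S - S, hence this choice. As S is symmetric,
  -- B also consists of sums of two popular differences.
  B : Fin p → Bool
  B = differenceSet S

  private
    r-neg : ∀ z → r (⊖ z) ≡ r z
    r-neg z = trans (sym (∑-shift z λ t → ⟦ A t ⟧ * ⟦ A (t ⊕ ⊖ z) ⟧))
      (∑-cong λ t → trans (cong (λ x → ⟦ A (t ⊕ z) ⟧ * ⟦ A x ⟧) (⊝-⊕-cancel z t)) (*-comm ⟦ A (t ⊕ z) ⟧ ⟦ A t ⟧))

    S-neg : ∀ {z} → S z ≡ true → S (⊖ z) ≡ true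
    S-neg {z} z∈S = trans (cong (λ x → ⌊ a ≤? 2 * k * x ⌋) (r-neg z)) z∈S

    -- Unpopular differences account for at most |E| a / (2k), hence for at most half of the a²
    -- pairs, and each popular one for at most a.
    a≤2∣S∣ : a ≤ 2 * card S
    a≤2∣S∣ = *-cancelʳ-≤ _ _ (k * a) {{m*n≢0 k a}} (+-cancelˡ-≤ (k * a * a) _ _ (begin
      k * a * a + a * (k * a)  ≡⟨ eq₁ k a ⟩
      2 * k * (a * a)  ≡⟨ cong (2 * k *_) (∑-correlation A) ⟨
      2 * k * ∑ r  ≡⟨ *-∑ (2 * k) r ⟩
      ∑ (λ z → 2 * k * r z)  ≤⟨ ∑-mono (λ z → pointwise (S z) (E z) (correlation≤card A z) (small z) (zero-off z)) ⟩
      ∑ (λ z → ⟦ S z ⟧ * (2 * k * a) + ⟦ E z ⟧ * a)  ≡⟨ ∑-+ (λ z → ⟦ S z ⟧ * (2 * k * a)) (λ z → ⟦ E z ⟧ * a) ⟩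
      ∑ (λ z → ⟦ S z ⟧ * (2 * k * a)) + ∑ (λ z → ⟦ E z ⟧ * a)  ≡⟨ cong₂ _+_ (∑-*ʳ (2 * k * a) (λ z → ⟦ S z ⟧)) (∑-*ʳ a (λ z → ⟦ E z ⟧)) ⟨
      card S * (2 * k * a) + card E * a  ≤⟨ +-monoʳ-≤ _ (*-monoˡ-≤ a card-E) ⟩
      card S * (2 * k * a) + k * a * a  ≡⟨ eq₂ (card S) k a ⟩
      k * a * a + 2 * card S * (k * a)  ∎))
      where
      open ≤-Reasoning
      eq₁ : ∀ k a → k * a * a + a * (k * a) ≡ 2 * k * (a * a)
      eq₁ = solve-∀
      eq₂ : ∀ s k a → s * (2 * k * a) + k * a * a ≡ k * a * a + 2 * s * (k * a)
      eq₂ = solve-∀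
      small : ∀ z → S z ≡ false → 2 * k * r z ≤ a
      small z h = <⇒≤ (≰⇒> (⌊⌋-false (a ≤? 2 * k * r z) h))
      zero-off : ∀ z → E z ≡ false → r z ≡ 0
      zero-off z h = n≤0⇒n≡0 (≮⇒≥ (⌊⌋-false (0 <? r z) h))
      pointwise : ∀ s e {r} → r ≤ a → (s ≡ false → 2 * k * r ≤ a) → (e ≡ false → r ≡ 0) → 2 * k * r ≤ ⟦ s ⟧ * (2 * k * a) + ⟦ e ⟧ * a
      pointwise true  _     r≤a _ _ = ≤-trans (*-monoʳ-≤ (2 * k) r≤a) (≤-trans (≤-reflexive (sym (*-identityˡ _))) (m≤m+n _ _))
      pointwise false true  _ h _ = ≤-trans (h refl) (≤-reflexive (sym (*-identityˡ a)))
      pointwise false false _ _ h = ≤-reflexive (trans (cong (2 * k *_) (h refl)) (*-zeroʳ (2 * k)))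

  card-A≤kS : a ≤ k * card S
  card-A≤kS = ≤-trans a≤2∣S∣ (*-monoˡ-≤ (card S) 2≤k)

  s₀∈S : ∃[ s ] S s ≡ true
  s₀∈S = let s , h = ∑>0⇒∃ (λ s → ⟦ S s ⟧) (n≢0⇒n>0 λ eq → <⇒≱ 0<a (≤-trans card-A≤kS (≤-reflexive (trans (cong (k *_) eq) (*-zeroʳ k)))))
         in s , ⟦⟧>0 (S s) h

  -- An element of A followed by m popular differences. Popularity replaces the Plünnecke
  -- inequality: it lets repeated sums be counted through intermediate points of A.
  data Reach : ℕ → Fin p → Set where
    start : ∀ {x} → A x ≡ true → Reach 0 x
    step  : ∀ {m x s} → Reach m x → S s ≡ true → Reach (suc m) (x ⊕ s)

  private
    e : ℕ → Fin p → ℕ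
    e zero    z = ⟦ E z ⟧
    e (suc m) z = ∑ λ y → e m y * ⟦ E (z ⊝ y) ⟧

    ∑e : ∀ m → ∑ (e m) ≡ card E ^ suc m
    ∑e zero    = sym (*-identityʳ _)
    ∑e (suc m) = trans (∑-convolution (e m) (λ z → ⟦ E z ⟧)) (trans (cong (_* card E) (∑e m)) (*-comm (card E ^ suc m) (card E)))

    -- A popular s has at least a / (2k) points t with t and t + s in A, and x + s - b = (x - t) +
    -- (t + s - b). The second summand lies in E, and the first is handled by induction. So x - b
    -- has at least (a / (2k))^m representations as a sum of m + 1 elements of E.
    reach-count : ∀ {m x b} → Reach m x → A b ≡ true → a ^ m ≤ (2 * k) ^ m * e m (x ⊝ b)
    reach-count (start x∈A) b∈A = ≤-reflexive (trans (cong ⟦_⟧ (sym (∈-differenceSet A x∈A b∈A))) (sym (*-identityˡ _)))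
    reach-count {suc m} {_} {b} (step {x = x} {s} reach s∈S) b∈A = begin
      a * a ^ m  ≤⟨ *-monoˡ-≤ (a ^ m) (⌊⌋-true (a ≤? 2 * k * r s) s∈S) ⟩
      2 * k * r s * a ^ m  ≡⟨ *-assoc (2 * k) (r s) (a ^ m) ⟩
      2 * k * (r s * a ^ m)  ≡⟨ cong (2 * k *_) (∑-*ʳ (a ^ m) (λ t → ⟦ A t ⟧ * ⟦ A (t ⊕ s) ⟧)) ⟩
      2 * k * ∑ (λ t → ⟦ A t ⟧ * ⟦ A (t ⊕ s) ⟧ * a ^ m)  ≤⟨ *-monoʳ-≤ (2 * k) (∑-mono pointwise) ⟩
      2 * k * ∑ (λ t → (2 * k) ^ m * (e m (x ⊝ t) * ⟦ E (x ⊕ s ⊝ b ⊝ (x ⊝ t)) ⟧))  ≡⟨ cong (2 * k *_) (*-∑ ((2 * k) ^ m) (λ t → e m (x ⊝ t) * ⟦ E (x ⊕ s ⊝ b ⊝ (x ⊝ t)) ⟧)) ⟨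
      2 * k * ((2 * k) ^ m * ∑ (λ t → e m (x ⊝ t) * ⟦ E (x ⊕ s ⊝ b ⊝ (x ⊝ t)) ⟧))  ≡⟨ cong (λ y → 2 * k * ((2 * k) ^ m * y)) (∑-reflect x (λ y → e m y * ⟦ E (x ⊕ s ⊝ b ⊝ y) ⟧)) ⟩
      2 * k * ((2 * k) ^ m * e (suc m) (x ⊕ s ⊝ b))  ≡⟨ *-assoc (2 * k) ((2 * k) ^ m) _ ⟨
      2 * k * (2 * k) ^ m * e (suc m) (x ⊕ s ⊝ b)  ∎
      where
      open ≤-Reasoning
      rearrange : ∀ x s b t → t ⊕ s ⊝ b ≡ x ⊕ s ⊝ b ⊝ (x ⊝ t)
      rearrange = solve 4 (λ x s b t → t :+ s :- b := x :+ s :- b :- (x :- t)) refl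
      in-E : ∀ t → A (t ⊕ s) ≡ true → 1 ≡ ⟦ E (x ⊕ s ⊝ b ⊝ (x ⊝ t)) ⟧
      in-E t h = cong ⟦_⟧ (sym (subst (λ z → E z ≡ true) (rearrange x s b t) (∈-differenceSet A h b∈A)))
      pointwise : ∀ t → ⟦ A t ⟧ * ⟦ A (t ⊕ s) ⟧ * a ^ m ≤ (2 * k) ^ m * (e m (x ⊝ t) * ⟦ E (x ⊕ s ⊝ b ⊝ (x ⊝ t)) ⟧)
      pointwise t = ≤-trans (≤-reflexive (cong (_* a ^ m) (sym (⟦∧⟧ (A t) (A (t ⊕ s)))))) (⟦⟧*≤ (A t ∧ A (t ⊕ s)) λ h →
        let t∈A , t+s∈A = ∧-true (A t) (A (t ⊕ s)) h in
        ≤-trans (reach-count reach t∈A) (≤-reflexive (cong ((2 * k) ^ m *_) (trans (sym (*-identityʳ (e m (x ⊝ t)))) (cong (e m (x ⊝ t) *_) (in-E t t+s∈A))))))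

  -- Divides the |E|^(m + 1) available sums by the multiplicity from `reach-count`. The exponent is
  -- 2m from (2k)^m and m + 1 from |E| ≤ k a.
  reach-card : ∀ m (Z : Fin p → Bool) → (∀ z → Z z ≡ true → ∃[ x ] ∃[ b ] (Reach m x × A b ≡ true × z ≡ x ⊝ b)) →
    card Z ≤ k ^ (m + m + suc m) * card A
  reach-card m Z reach = *-cancelʳ-≤ _ _ (a ^ m) {{m^n≢0 a m}} (begin
    card Z * a ^ m  ≡⟨ ∑-*ʳ (a ^ m) (λ z → ⟦ Z z ⟧) ⟩
    ∑ (λ z → ⟦ Z z ⟧ * a ^ m)  ≤⟨ ∑-mono (λ z → ⟦⟧*≤ (Z z) (pointwise z)) ⟩
    ∑ (λ z → (2 * k) ^ m * e m z)  ≡⟨ *-∑ ((2 * k) ^ m) (e m) ⟨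
    (2 * k) ^ m * ∑ (e m)  ≡⟨ cong ((2 * k) ^ m *_) (∑e m) ⟩
    (2 * k) ^ m * card E ^ suc m  ≤⟨ *-mono-≤ (^-monoˡ-≤ m (*-monoˡ-≤ k 2≤k)) (^-monoˡ-≤ (suc m) card-E) ⟩
    (k * k) ^ m * (k * a) ^ suc m  ≡⟨ cong₂ _*_ (^-distribʳ-* m k k) (^-distribʳ-* (suc m) k a) ⟩
    k ^ m * k ^ m * (k ^ suc m * a ^ suc m)  ≡⟨ eq (k ^ m) (k ^ suc m) a (a ^ m) ⟩
    k ^ m * k ^ m * k ^ suc m * a * a ^ m  ≡⟨ cong (λ y → y * a * a ^ m) (trans (^-distribˡ-+-* k (m + m) (suc m)) (cong (_* k ^ suc m) (^-distribˡ-+-* k m m))) ⟨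
    k ^ (m + m + suc m) * a * a ^ m  ∎)
    where
    open ≤-Reasoning
    eq : ∀ x y a z → x * x * (y * (a * z)) ≡ x * x * y * a * z
    eq = solve-∀
    pointwise : ∀ z → Z z ≡ true → a ^ m ≤ (2 * k) ^ m * e m z
    pointwise z z∈Z = let x , b , reached , b∈A , z≡ = reach z z∈Z in
      subst (λ z → a ^ m ≤ (2 * k) ^ m * e m z) (sym z≡) (reach-count reached b∈A)

  Covered : ℕ → (Fin p → Set) → Set
  Covered M P = ∃[ T ] (length T ≤ M × ∀ x → P x → ∃[ t ] ∃[ z ] (t ∈ T × B z ≡ true × x ≡ t ⊕ z))

  _⊞_ : (Fin p → Set) → (Fin p → Set) → Fin p → Set
  (P ⊞ Q) x = ∃[ y ] ∃[ z ] (P y × Q z × x ≡ y ⊕ z)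

  ⟨B⟩ : Fin p → Set
  ⟨B⟩ x = B x ≡ true

  _·B : Fin p → Fin p → Set
  (ξ ·B) x = ∃[ z ] (B z ≡ true × x ≡ ξ ⊗ z)

  Good : ℕ → Fin p → Set
  Good M ξ = Covered M (ξ ·B)

  private
    B-neg : ∀ {z} → B z ≡ true → B (⊖ z) ≡ true
    B-neg {z} z∈B = let s , s′ , s∈S , s′∈S , z≡ = differenceSet-∈ S z z∈B in
      subst (λ z → B z ≡ true) (trans (flip s s′) (cong ⊖_ (sym z≡))) (∈-differenceSet S s′∈S s∈S)
      where
      flip : ∀ s s′ → s′ ⊝ s ≡ ⊖ (s ⊝ s′)
      flip = solve 2 (λ s s′ → s′ :- s := :- (s :- s′)) refl

    cancel-a : ∀ {M} u c → u * card S ≤ k ^ c * a → k ^ suc c ≡ M → u ≤ M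
    cancel-a u c h refl = *-cancelʳ-≤ _ _ (card S) {{>-nonZero (≤-trans (≤-reflexive (cong ⟦_⟧ (sym (proj₂ s₀∈S)))) (≤-∑ (λ s → ⟦ S s ⟧) (proj₁ s₀∈S)))}}
      (≤-trans h (≤-trans (*-monoʳ-≤ (k ^ c) card-A≤kS) (≤-reflexive (eq (k ^ c) k (card S)))))
      where
      eq : ∀ x k s → x * (k * s) ≡ k * x * s
      eq = solve-∀

    reach-B : ∀ {m x z} → Reach m x → B z ≡ true → Reach (2 + m) (x ⊕ z)
    reach-B {m} {x} {z} reach z∈B = let s , s′ , s∈S , s′∈S , z≡ = differenceSet-∈ S z z∈B in
      subst (Reach (2 + m)) (trans (regroup x s s′) (cong (x ⊕_) (sym z≡))) (step (step reach s∈S) (S-neg s′∈S))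
      where
      regroup : ∀ x s s′ → x ⊕ s ⊕ ⊖ s′ ≡ x ⊕ (s ⊝ s′)
      regroup = solve 3 (λ x s s′ → x :+ s :+ (:- s′) := x :+ (s :- s′)) refl

  E-covered : Covered (k ^ 5) (λ x → differenceSet A x ≡ true)
  E-covered = let T , size , cover = ruzsa-covering E S (proj₂ s₀∈S) in
    T , cancel-a (length T) 4 (≤-trans size bound) refl ,
    λ x x∈E → let t , u , u′ , t∈T , u∈S , u′∈S , x≡ = cover x x∈E in t , u ⊝ u′ , t∈T , ∈-differenceSet S u∈S u′∈S , x≡
    where
    regroup : ∀ x b u → x ⊝ b ⊕ u ≡ x ⊕ u ⊝ b
    regroup = solve 3 (λ x b u → x :- b :+ u := x :+ u :- b) refl
    bound : card (sumset E S) ≤ k ^ 4 * a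
    bound = reach-card 1 (sumset E S) λ z z∈ →
      let y , u , y∈E , u∈S , z≡ = sumset-∈ E S z z∈
          x , b , x∈A , b∈A , y≡ = differenceSet-∈ A y y∈E
      in x ⊕ u , b , step (start x∈A) u∈S , b∈A , trans z≡ (trans (cong (_⊕ u) y≡) (regroup x b u))

  -- An element of B + B + S takes five popular steps, giving the exponent 5 + 5 + 6 = 16; passing
  -- from card A to card S costs one more.
  B⊞B-covered : Covered (k ^ 17) (⟨B⟩ ⊞ ⟨B⟩)
  B⊞B-covered = let T , size , cover = ruzsa-covering (sumset B B) S (proj₂ s₀∈S) in
    T , cancel-a (length T) 16 (≤-trans size bound) refl ,
    λ x (y , z , y∈B , z∈B , x≡) →
      let t , u , u′ , t∈T , u∈S , u′∈S , x≡′ = cover x (subst (λ x → sumset B B x ≡ true) (sym x≡) (∈-sumset B B y∈B z∈B))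
      in t , u ⊝ u′ , t∈T , ∈-differenceSet S u∈S u′∈S , x≡′
    where
    regroup : ∀ a y w u → y ⊕ w ⊕ u ≡ a ⊕ y ⊕ w ⊕ u ⊝ a
    regroup = solve 4 (λ a y w u → y :+ w :+ u := a :+ y :+ w :+ u :- a) refl
    bound : card (sumset (sumset B B) S) ≤ k ^ 16 * a
    bound = reach-card 5 (sumset (sumset B B) S) λ z z∈ →
      let x , u , x∈BB , u∈S , z≡ = sumset-∈ (sumset B B) S z z∈
          y , w , y∈B , w∈B , x≡ = sumset-∈ B B x x∈BB
      in a₀ ⊕ y ⊕ w ⊕ u , a₀ , step (reach-B (reach-B (start a₀∈A) y∈B) w∈B) u∈S , a₀∈A ,
         trans z≡ (trans (cong (_⊕ u) x≡) (regroup a₀ y w u))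

  card-B≤ : card B ≤ k ^ 7 * a
  card-B≤ = reach-card 2 B λ z z∈B → a₀ ⊕ z , a₀ , reach-B (start a₀∈A) z∈B , a₀∈A , solve 2 (λ a z → z := a :+ z :- a) refl a₀ z

  card-S≤card-B : card S ≤ card B
  card-S≤card-B = ≤-trans (∑-mono λ s → ⟦⟧≤ (S s) λ s∈S → ≤-reflexive (cong ⟦_⟧ (sym (∈-differenceSet S s∈S (proj₂ s₀∈S)))))
    (≤-reflexive (∑-unshift (proj₁ s₀∈S) λ z → ⟦ B z ⟧))

  covered-⊞ : ∀ {M M′ P Q} → Covered M P → Covered M′ Q → Covered (M * M′ * k ^ 17) (P ⊞ Q)
  covered-⊞ (T , ∣T∣≤ , cover) (T′ , ∣T′∣≤ , cover′) = let T″ , ∣T″∣≤ , cover″ = B⊞B-covered in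
    cartesianProductWith _⊕_ (cartesianProductWith _⊕_ T T′) T″ ,
    ≤-trans (≤-reflexive (trans (length-cartesianProductWith _⊕_ (cartesianProductWith _⊕_ T T′) T″) (cong (_* length T″) (length-cartesianProductWith _⊕_ T T′))))
      (*-mono-≤ (*-mono-≤ ∣T∣≤ ∣T′∣≤) ∣T″∣≤) ,
    λ x (y , y′ , Py , Qy′ , x≡) →
      let t , z , t∈T , z∈B , y≡ = cover y Py
          t′ , z′ , t′∈T′ , z′∈B , y′≡ = cover′ y′ Qy′
          t″ , z″ , t″∈T″ , z″∈B , zz′≡ = cover″ (z ⊕ z′) (z , z′ , z∈B , z′∈B , refl)
      in t ⊕ t′ ⊕ t″ , z″ , ∈-cartesianProductWith⁺ _⊕_ (∈-cartesianProductWith⁺ _⊕_ t∈T t′∈T′) t″∈T″ , z″∈B ,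
         trans x≡ (trans (cong₂ _⊕_ y≡ y′≡) (trans (regroup t z t′ z′) (trans (cong (t ⊕ t′ ⊕_) zz′≡) (sym (assoc t t′ t″ z″)))))
    where
    regroup : ∀ t z t′ z′ → (t ⊕ z) ⊕ (t′ ⊕ z′) ≡ t ⊕ t′ ⊕ (z ⊕ z′)
    regroup = solve 4 (λ t z t′ z′ → (t :+ z) :+ (t′ :+ z′) := t :+ t′ :+ (z :+ z′)) refl
    assoc : ∀ t t′ t″ z → t ⊕ t′ ⊕ t″ ⊕ z ≡ t ⊕ t′ ⊕ (t″ ⊕ z)
    assoc = solve 4 (λ t t′ t″ z → t :+ t′ :+ t″ :+ z := t :+ t′ :+ (t″ :+ z)) refl

  covered-mono : ∀ {M M′ P Q} → M ≤ M′ → (∀ x → Q x → P x) → Covered M P → Covered M′ Q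
  covered-mono M≤M′ Q⊆P (T , ∣T∣≤ , cover) = T , ≤-trans ∣T∣≤ M≤M′ , λ x Qx → cover x (Q⊆P x Qx)

  good-⊖ : ∀ {M ξ} → Good M ξ → Good M (⊖ ξ)
  good-⊖ {ξ = ξ} = covered-mono ≤-refl λ x (z , z∈B , x≡) → ⊖ z , B-neg z∈B , trans x≡ (solve 2 (λ ξ z → (:- ξ) :* z := ξ :* (:- z)) refl ξ z)

  good-⊕ : ∀ {M M′ ξ ξ′} → Good M ξ → Good M′ ξ′ → Good (M * M′ * k ^ 17) (ξ ⊕ ξ′)
  good-⊕ {ξ = ξ} {ξ′} good good′ = covered-mono ≤-refl (λ x (z , z∈B , x≡) →
    ξ ⊗ z , ξ′ ⊗ z , (z , z∈B , refl) , (z , z∈B , refl) , trans x≡ (solve 3 (λ ξ ξ′ z → (ξ :+ ξ′) :* z := ξ :* z :+ ξ′ :* z) refl ξ ξ′ z))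
    (covered-⊞ good good′)

  good-⊗ : ∀ {M M′ ξ ξ′} → Good M ξ → Good M′ ξ′ → Good (M′ * M) (ξ ⊗ ξ′)
  good-⊗ {ξ = ξ} {ξ′} (T , ∣T∣≤ , cover) (T′ , ∣T′∣≤ , cover′) =
    cartesianProductWith (λ t′ t → ξ ⊗ t′ ⊕ t) T′ T ,
    ≤-trans (≤-reflexive (length-cartesianProductWith _ T′ T)) (*-mono-≤ ∣T′∣≤ ∣T∣≤) ,
    λ x (z , z∈B , x≡) →
      let t′ , z′ , t′∈T′ , z′∈B , ξ′z≡ = cover′ (ξ′ ⊗ z) (z , z∈B , refl)
          t , z″ , t∈T , z″∈B , ξz′≡ = cover (ξ ⊗ z′) (z′ , z′∈B , refl)
      in ξ ⊗ t′ ⊕ t , z″ , ∈-cartesianProductWith⁺ _ t′∈T′ t∈T , z″∈B ,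
         trans x≡ (trans (solve 3 (λ ξ ξ′ z → ξ :* ξ′ :* z := ξ :* (ξ′ :* z)) refl ξ ξ′ z) (trans (cong (ξ ⊗_) ξ′z≡)
           (trans (solve 3 (λ ξ t z → ξ :* (t :+ z) := ξ :* t :+ ξ :* z) refl ξ t′ z′) (trans (cong (ξ ⊗ t′ ⊕_) ξz′≡)
             (solve 3 (λ a b c → a :+ (b :+ c) := a :+ b :+ c) refl (ξ ⊗ t′) t z″)))))

  module _ (h : Fin p) (h≢0 : h ≢ 0̂) (popular : a ≤ 2 * k * ∑ (λ y → ⟦ A y ⟧ * ⟦ A (h ⊗ y) ⟧)) where
    private
      h⁻¹ : Fin p
      h⁻¹ = inverse h h≢0

      U X : Fin p → Bool
      U z = A z ∧ A (h⁻¹ ⊗ z)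
      X z = B (h⁻¹ ⊗ z)

      card-U : ∑ (λ y → ⟦ A y ⟧ * ⟦ A (h ⊗ y) ⟧) ≡ card U
      card-U = trans (∑-cong λ y → trans (*-comm ⟦ A y ⟧ _) (trans (cong (λ z → ⟦ A (h ⊗ y) ⟧ * ⟦ A z ⟧) (sym (c⁻¹⊗c⊗ h h≢0 y))) (sym (⟦∧⟧ (A (h ⊗ y)) _))))
        (∑-dilate h h≢0 λ z → ⟦ U z ⟧)

      0<card-U : 0 < card U
      0<card-U = n≢0⇒n>0 λ eq → <⇒≱ 0<a (≤-trans popular (≤-reflexive (trans (cong (2 * k *_) (trans card-U eq)) (*-zeroʳ (2 * k)))))

      u₀∈U : ∃[ u ] U u ≡ true
      u₀∈U = let u , h = ∑>0⇒∃ (λ u → ⟦ U u ⟧) 0<card-U in u , ⟦⟧>0 (U u) h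

      bound : card (sumset X U) ≤ k ^ 7 * a
      bound = ≤-trans (≤-reflexive (trans (sym (∑-dilate h h≢0 λ z → ⟦ sumset X U z ⟧)) (sym (∑-shift a₀ λ z → ⟦ sumset X U (h ⊗ z) ⟧))))
        (reach-card 2 (λ z → sumset X U (h ⊗ (z ⊕ a₀))) λ z z∈ →
          let x , u , x∈X , u∈U , hz≡ = sumset-∈ X U (h ⊗ (z ⊕ a₀)) z∈
              z≡ = trans (sym (c⁻¹⊗c⊗ h h≢0 (z ⊕ a₀))) (cong (h⁻¹ ⊗_) hz≡)
          in h⁻¹ ⊗ u ⊕ h⁻¹ ⊗ x , a₀ , reach-B (start (proj₂ (∧-true (A u) _ u∈U))) x∈X , a₀∈A ,
             trans (solve 2 (λ z a → z := z :+ a :- a) refl z a₀) (cong (_⊝ a₀) (trans z≡ (solve 3 (λ h x u → h :* (x :+ u) := h :* u :+ h :* x) refl h⁻¹ x u))))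

      size≤ : ∀ l → l * card U ≤ card (sumset X U) → l ≤ k ^ 9
      size≤ l h = *-cancelʳ-≤ _ _ (card U) {{>-nonZero 0<card-U}} (begin
        l * card U  ≤⟨ ≤-trans h bound ⟩
        k ^ 7 * a  ≤⟨ *-monoʳ-≤ (k ^ 7) (≤-trans popular (*-mono-≤ (*-monoˡ-≤ k 2≤k) (≤-reflexive card-U))) ⟩
        k ^ 7 * (k * k * card U)  ≡⟨ eq (k ^ 7) k (card U) ⟩
        k * (k * k ^ 7) * card U  ∎)
        where
        open ≤-Reasoning
        eq : ∀ x k u → x * (k * k * u) ≡ k * (k * x) * u
        eq = solve-∀

    -- Here U is the intersection of A with its dilate hA, a positive proportion of A. Since h⁻¹(hB
    -- + U) lies in B + A, the set hB + U is small, and covering hB by U puts it into T + (A - A);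
    -- then `E-covered` returns to translates of B. The count is k^(9 + 5), rounded up to the k^17
    -- that every sum costs.
    good-dilate : Good (k ^ 17) h
    good-dilate =
      let T , size , cover = ruzsa-covering X U (proj₂ u₀∈U)
          T′ , ∣T′∣≤ , cover′ = E-covered
      in cartesianProductWith _⊕_ T T′ ,
         ≤-trans (≤-reflexive (length-cartesianProductWith _⊕_ T T′))
           (≤-trans (*-mono-≤ (size≤ (length T) size) ∣T′∣≤) (≤-trans (≤-reflexive (sym (^-distribˡ-+-* k 9 5))) (^-monoʳ-≤ k (m≤m+n 14 3)))) ,
         λ x (z , z∈B , x≡) →
           let t , u , u′ , t∈T , u∈U , u′∈U , x≡′ = cover x (subst (λ y → B y ≡ true) (trans (sym (c⁻¹⊗c⊗ h h≢0 z)) (cong (h⁻¹ ⊗_) (sym x≡))) z∈B)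
               t′ , z′ , t′∈T′ , z′∈B , uu′≡ = cover′ (u ⊝ u′) (∈-differenceSet A (proj₁ (∧-true (A u) _ u∈U)) (proj₁ (∧-true (A u′) _ u′∈U)))
           in t ⊕ t′ , z′ , ∈-cartesianProductWith⁺ _⊕_ t∈T t′∈T′ , z′∈B ,
              trans x≡′ (trans (cong (t ⊕_) uu′≡) (solve 3 (λ a b c → a :+ (b :+ c) := a :+ b :+ c) refl t t′ z′))

-- Growth of quotient sets

module QuotientGrowth {p} (𝔽 : PrimeField p) where
  open PrimeField 𝔽
  open FieldSums 𝔽
  open RuzsaCovering 𝔽
  open Solver using (solve; _:=_; _:+_; _:*_; _:-_)

  -- The set (X - X)/(X - X), with the denominator multiplied out.
  Quotient : (Fin p → Bool) → Fin p → Set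
  Quotient X ξ = ∃[ x₁ ] ∃[ x₂ ] ∃[ x₃ ] ∃[ x₄ ]
    (X x₁ ≡ true × X x₂ ≡ true × X x₃ ≡ true × X x₄ ≡ true × x₃ ≢ x₄ × ξ ⊗ (x₃ ⊝ x₄) ≡ x₁ ⊝ x₂)

  quotient? : ∀ X ξ → Dec (Quotient X ξ)
  quotient? X ξ = Fin.any? λ x₁ → Fin.any? λ x₂ → Fin.any? λ x₃ → Fin.any? λ x₄ →
    (X x₁ Bool.≟ true) ×-dec (X x₂ Bool.≟ true) ×-dec (X x₃ Bool.≟ true) ×-dec (X x₄ Bool.≟ true) ×-dec
    ¬? (x₃ Fin.≟ x₄) ×-dec (ξ ⊗ (x₃ ⊝ x₄) Fin.≟ x₁ ⊝ x₂)

  two-elements : (X : Fin p → Bool) → 2 ≤ card X → ∃[ x ] ∃[ y ] (X x ≡ true × X y ≡ true × x ≢ y)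
  two-elements X 2≤ = decidable-stable
    (Fin.any? λ x → Fin.any? λ y → (X x Bool.≟ true) ×-dec (X y Bool.≟ true) ×-dec ¬? (x Fin.≟ y))
    λ none → <⇒≱ 2≤ (card-unique X λ i j Xi Xj → decidable-stable (i Fin.≟ j) λ i≢j → none (i , j , Xi , Xj , i≢j))

  quotient-0 : (X : Fin p → Bool) → 2 ≤ card X → Quotient X 0̂
  quotient-0 X 2≤ = let x , y , x∈X , y∈X , x≢y = two-elements X 2≤ in
    x , x , x , y , x∈X , x∈X , x∈X , y∈X , x≢y , trans (⊗-zeroˡ (x ⊝ y)) (sym (⊝-self x))

  -- The quotient set contains 0, so if adding 1 never leaves it, it is the whole field by
  -- `1̂-generates`.
  full-or-gap : (X : Fin p → Bool) → 2 ≤ card X → (∀ ξ → Quotient X ξ) ⊎ ∃[ ξ ] (Quotient X ξ × ¬ Quotient X (ξ ⊕ 1̂))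
  full-or-gap X 2≤ with Fin.any? (λ ξ → quotient? X ξ ×-dec ¬? (quotient? X (ξ ⊕ 1̂)))
  ... | yes gap = inj₂ gap
  ... | no ¬gap = inj₁ (1̂-generates (Quotient X) (quotient-0 X 2≤) λ ξ Qξ →
    decidable-stable (quotient? X (ξ ⊕ 1̂)) λ ¬Q → ¬gap (ξ , Qξ , ¬Q))

  module _ (X : Fin p → Bool) {ξ x₁ x₂ x₃ x₄ : Fin p} (x₁∈X : X x₁ ≡ true) (x₃∈X : X x₃ ≡ true) (x₄∈X : X x₄ ≡ true)
    (x₃≢x₄ : x₃ ≢ x₄) (ξ≡ : ξ ⊗ (x₃ ⊝ x₄) ≡ x₁ ⊝ x₂) (gap : ¬ Quotient X (ξ ⊕ 1̂)) where
    private
      u v : Fin p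
      u = x₃ ⊝ x₄
      v = x₁ ⊝ x₂ ⊕ u

      u≢0 : u ≢ 0̂
      u≢0 = ⊝≢0 x₃≢x₄

      v≡ : v ≡ u ⊗ (ξ ⊕ 1̂)
      v≡ = trans (cong (_⊕ u) (sym ξ≡)) (trans (cong (ξ ⊗ u ⊕_) (sym (⊗-identityʳ u))) (solve 3 (λ ξ u i → ξ :* u :+ u :* i := u :* (ξ :+ i)) refl ξ u 1̂))

      -- Otherwise ξ + 1 would be 0, which is itself a quotient of differences.
      v≢0 : v ≢ 0̂
      v≢0 v≡0 with integral u (ξ ⊕ 1̂) (trans (sym v≡) v≡0)
      ... | inj₁ u≡0 = u≢0 u≡0
      ... | inj₂ ξ+1≡0 = gap (x₁ , x₁ , x₃ , x₄ , x₁∈X , x₁∈X , x₃∈X , x₄∈X , x₃≢x₄ ,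
        trans (cong (_⊗ u) ξ+1≡0) (trans (⊗-zeroˡ u) (sym (⊝-self x₁))))

      dilate : ∀ c → c ≢ 0̂ → Fin p → Bool
      dilate c c≢0 z = X (inverse c c≢0 ⊗ z)

      card-dilate : ∀ c c≢0 → card (dilate c c≢0) ≡ card X
      card-dilate c c≢0 = trans (sym (∑-dilate c c≢0 λ z → ⟦ dilate c c≢0 z ⟧)) (∑-cong λ z → cong (λ y → ⟦ X y ⟧) (c⁻¹⊗c⊗ c c≢0 z))

    grown : Fin p → Bool
    grown = sumset (dilate u u≢0) (dilate v v≢0)

    grown-∈ : ∀ z → grown z ≡ true → ∃[ x ] ∃[ y ] (X x ≡ true × X y ≡ true × z ≡ (x₃ ⊝ x₄) ⊗ x ⊕ (x₁ ⊝ x₂ ⊕ (x₃ ⊝ x₄)) ⊗ y)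
    grown-∈ z z∈ = let x , y , x∈ , y∈ , z≡ = sumset-∈ (dilate u u≢0) (dilate v v≢0) z z∈ in
      inverse u u≢0 ⊗ x , inverse v v≢0 ⊗ y , x∈ , y∈ , trans z≡ (sym (cong₂ _⊕_ (c⊗c⁻¹⊗ u u≢0 x) (c⊗c⁻¹⊗ v v≢0 y)))

    private
      -- A coincidence with b ≠ b′ would give u (a - a′) = v (b′ - b) = u (ξ + 1)(b′ - b), which
      -- exhibits ξ + 1 as a quotient of differences.
      sums-distinct : ∀ {a b a′ b′} → X a ≡ true → X b ≡ true → X a′ ≡ true → X b′ ≡ true →
        u ⊗ a ⊕ v ⊗ b ≡ u ⊗ a′ ⊕ v ⊗ b′ → b ≡ b′
      sums-distinct {a} {b} {a′} {b′} a∈X b∈X a′∈X b′∈X eq = decidable-stable (b Fin.≟ b′) λ b≢b′ →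
        gap (a , a′ , b′ , b , a∈X , a′∈X , b′∈X , b∈X , (λ b′≡b → b≢b′ (sym b′≡b)) , ⊗-cancelˡ u u≢0 (sym (begin
          u ⊗ (a ⊝ a′)  ≡⟨ solve 4 (λ u a a′ vb → u :* (a :- a′) := (u :* a :+ vb) :- (u :* a′ :+ vb)) refl u a a′ (v ⊗ b) ⟩
          (u ⊗ a ⊕ v ⊗ b) ⊝ (u ⊗ a′ ⊕ v ⊗ b)  ≡⟨ cong (_⊝ (u ⊗ a′ ⊕ v ⊗ b)) eq ⟩
          (u ⊗ a′ ⊕ v ⊗ b′) ⊝ (u ⊗ a′ ⊕ v ⊗ b)  ≡⟨ solve 4 (λ ua′ v b b′ → (ua′ :+ v :* b′) :- (ua′ :+ v :* b) := v :* (b′ :- b)) refl (u ⊗ a′) v b b′ ⟩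
          v ⊗ (b′ ⊝ b)  ≡⟨ cong (_⊗ (b′ ⊝ b)) v≡ ⟩
          u ⊗ (ξ ⊕ 1̂) ⊗ (b′ ⊝ b)  ≡⟨ ⊗-assoc u (ξ ⊕ 1̂) (b′ ⊝ b) ⟩
          u ⊗ ((ξ ⊕ 1̂) ⊗ (b′ ⊝ b))  ∎)))
        where open ≡-Reasoning

      unique-representation : ∀ z → representations (dilate u u≢0) (dilate v v≢0) z ≤ 1
      unique-representation z = ≤-trans (≤-reflexive (∑-cong λ x → sym (⟦∧⟧ (dilate u u≢0 x) _)))
        (card-unique (λ x → dilate u u≢0 x ∧ dilate v v≢0 (z ⊝ x)) λ x x′ h h′ →
          let a∈ , b∈ = ∧-true _ _ h
              a′∈ , b′∈ = ∧-true _ _ h′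
              b≡ = sums-distinct a∈ b∈ a′∈ b′∈ (trans (total x) (sym (total x′)))
              z⊝x≡ = trans (sym (c⊗c⁻¹⊗ v v≢0 (z ⊝ x))) (trans (cong (v ⊗_) b≡) (c⊗c⁻¹⊗ v v≢0 (z ⊝ x′)))
          in trans (sym (⊝-involutive z x)) (trans (cong (z ⊝_) z⊝x≡) (⊝-involutive z x′)))
        where
        total : ∀ x → u ⊗ (inverse u u≢0 ⊗ x) ⊕ v ⊗ (inverse v v≢0 ⊗ (z ⊝ x)) ≡ z
        total x = trans (cong₂ _⊕_ (c⊗c⁻¹⊗ u u≢0 x) (c⊗c⁻¹⊗ v v≢0 (z ⊝ x))) (solve 2 (λ x z → x :+ (z :- x) := z) refl x z)

    card-grown : card X * card X ≤ card grown
    card-grown = begin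
      card X * card X  ≡⟨ cong₂ _*_ (card-dilate u u≢0) (card-dilate v v≢0) ⟨
      card (dilate u u≢0) * card (dilate v v≢0)  ≡⟨ ∑-convolution (λ x → ⟦ dilate u u≢0 x ⟧) (λ y → ⟦ dilate v v≢0 y ⟧) ⟨
      ∑ (representations (dilate u u≢0) (dilate v v≢0))  ≤⟨ ∑-mono pointwise ⟩
      card grown  ∎
      where
      open ≤-Reasoning
      at-most : ∀ {r} (0<r? : Dec (0 < r)) → r ≤ 1 → r ≤ ⟦ ⌊ 0<r? ⌋ ⟧
      at-most {zero}  _ _ = z≤n
      at-most {suc r} 0<r? r≤1 = ≤-trans r≤1 (≤-reflexive (cong ⟦_⟧ (sym (true-⌊⌋ 0<r? z<s))))
      pointwise : ∀ z → representations (dilate u u≢0) (dilate v v≢0) z ≤ ⟦ grown z ⟧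
      pointwise z = at-most (0 <? representations (dilate u u≢0) (dilate v v≢0) z) (unique-representation z)

  -- If the elements of X are good at level M, those of grown X are good at level bump M.
  cube bump : ℕ → ℕ
  cube M = M * M * M
  bump M = cube (cube (cube M) * cube (cube M))

  iterate : ℕ → (ℕ → ℕ) → ℕ → ℕ
  iterate zero    f x = x
  iterate (suc r) f x = iterate r f (f x)

  ≤-cube : ∀ M → M ≤ cube M
  ≤-cube zero    = z≤n
  ≤-cube (suc M) = ≤-trans (m≤n*m (suc M) (suc M)) (m≤m*n (suc M * suc M) (suc M))

  ≤-square : ∀ M → M ≤ M * M
  ≤-square zero    = z≤n
  ≤-square (suc M) = m≤m*n (suc M) (suc M)

  ≤-bump : ∀ M → M ≤ bump M
  ≤-bump M = ≤-trans (≤-cube M) (≤-trans (≤-cube (cube M)) (≤-trans (≤-square (cube (cube M))) (≤-cube _)))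

  ≤-iterate-bump : ∀ r M → M ≤ iterate r bump M
  ≤-iterate-bump zero    M = ≤-refl
  ≤-iterate-bump (suc r) M = ≤-trans (≤-bump M) (≤-iterate-bump r (bump M))

  module _ (Good : ℕ → Fin p → Set) (κ : ℕ)
    (good-mono : ∀ {M M′ ξ} → M ≤ M′ → Good M ξ → Good M′ ξ)
    (good-⊖ : ∀ {M ξ} → Good M ξ → Good M (⊖ ξ))
    (good-⊕ : ∀ {M M′ ξ ξ′} → Good M ξ → Good M′ ξ′ → Good (M * M′ * κ) (ξ ⊕ ξ′))
    (good-⊗ : ∀ {M M′ ξ ξ′} → Good M ξ → Good M′ ξ′ → Good (M′ * M) (ξ ⊗ ξ′)) where

    good-cube : ∀ {M ξ ξ′} → κ ≤ M → Good M ξ → Good M ξ′ → Good (cube M) (ξ ⊕ ξ′)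
    good-cube {M} κ≤M g g′ = good-mono (*-monoʳ-≤ (M * M) κ≤M) (good-⊕ g g′)

    -- Each gap squares the cardinality, so one unit of r is spent while the hypothesis on p is
    -- preserved.
    generates : ∀ r X M → κ ≤ M → (∀ x → X x ≡ true → Good M x) → 2 ≤ card X → p < card X ^ (2 ^ r) →
      ∃[ X′ ] ((∀ x → X′ x ≡ true → Good (iterate r bump M) x) × ∀ ξ → Quotient X′ ξ)
    -- With no rounds left the hypothesis reads p < card X, which no subset of the field satisfies;
    -- the iteration must therefore have ended in the full case earlier.
    generates zero X M κ≤M good 2≤X p< = ⊥-elim (<⇒≱ p< (≤-trans (≤-reflexive (*-identityʳ (card X))) (card≤n X)))
    generates (suc r) X M κ≤M good 2≤X p< with full-or-gap X 2≤X
    ... | inj₁ full = X , (λ x x∈X → good-mono (≤-iterate-bump (suc r) M) (good x x∈X)) , full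
    ... | inj₂ (ξ , (x₁ , x₂ , x₃ , x₄ , x₁∈X , x₂∈X , x₃∈X , x₄∈X , x₃≢x₄ , ξ≡) , gap) =
      generates r (grown X x₁∈X x₃∈X x₄∈X x₃≢x₄ ξ≡ gap) (bump M) (≤-trans κ≤M (≤-bump M)) good′
        (≤-trans 2≤X (≤-trans (≤-square (card X)) (card-grown X x₁∈X x₃∈X x₄∈X x₃≢x₄ ξ≡ gap)))
        (<-≤-trans p< (≤-trans (≤-reflexive power) (^-monoˡ-≤ (2 ^ r) (card-grown X x₁∈X x₃∈X x₄∈X x₃≢x₄ ξ≡ gap))))
      where
      power : card X ^ (2 * 2 ^ r) ≡ (card X * card X) ^ (2 ^ r)
      power = trans (sym (^-*-assoc (card X) 2 (2 ^ r))) (cong (λ y → (card X * y) ^ (2 ^ r)) (*-identityʳ (card X)))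
      lift : ∀ {x} → Good M x → Good (cube (cube M)) x
      lift = good-mono (≤-trans (≤-cube M) (≤-cube (cube M)))
      u-good : Good (cube M) (x₃ ⊝ x₄)
      u-good = good-cube κ≤M (good x₃ x₃∈X) (good-⊖ (good x₄ x₄∈X))
      v-good : Good (cube (cube M)) (x₁ ⊝ x₂ ⊕ (x₃ ⊝ x₄))
      v-good = good-cube (≤-trans κ≤M (≤-cube M)) (good-cube κ≤M (good x₁ x₁∈X) (good-⊖ (good x₂ x₂∈X))) u-good
      good′ : ∀ z → grown X x₁∈X x₃∈X x₄∈X x₃≢x₄ ξ≡ gap z ≡ true → Good (bump M) z
      good′ z z∈ = let x , y , x∈X , y∈X , z≡ = grown-∈ X x₁∈X x₃∈X x₄∈X x₃≢x₄ ξ≡ gap z z∈ in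
        subst (Good (bump M)) (sym z≡) (good-cube (≤-trans κ≤M (≤-trans (≤-cube M) (≤-trans (≤-cube (cube M)) (≤-square _))))
          (good-⊗ (good-mono (≤-cube (cube M)) u-good) (lift (good x x∈X)))
          (good-⊗ v-good (lift (good y y∈X))))

-- Energies of dilates

module DilateEnergy {p} (𝔽 : PrimeField p) (B : Fin p → Bool) where
  open PrimeField 𝔽
  open FieldSums 𝔽
  open RuzsaCovering 𝔽
  open Solver using (solve; _:=_; _:+_; _:*_; _:-_)

  private
    β : Fin p → ℕ
    β b = ⟦ B b ⟧

    r : Fin p → Fin p → ℕ
    r ξ z = ∑ λ b → β b * ⟦ B (z ⊝ ξ ⊗ b) ⟧

    ∑r : ∀ ξ → ∑ (r ξ) ≡ card B * card B
    ∑r ξ = begin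
      ∑ (λ z → ∑ λ b → β b * ⟦ B (z ⊝ ξ ⊗ b) ⟧)  ≡⟨ ∑-comm (λ z b → β b * ⟦ B (z ⊝ ξ ⊗ b) ⟧) ⟩
      ∑ (λ b → ∑ λ z → β b * ⟦ B (z ⊝ ξ ⊗ b) ⟧)  ≡⟨ ∑-cong (λ b → trans (sym (*-∑ (β b) (λ z → ⟦ B (z ⊝ ξ ⊗ b) ⟧))) (cong (β b *_) (∑-unshift (ξ ⊗ b) β))) ⟩
      ∑ (λ b → β b * card B)  ≡⟨ ∑-*ʳ (card B) β ⟨
      card B * card B  ∎
      where open ≡-Reasoning

    energy : Fin p → ℕ
    energy ξ = ∑ λ z → r ξ z * r ξ z

    energy≡ : ∀ ξ → energy ξ ≡ ∑ λ c → β c * ∑ λ b → β b * correlation B (ξ ⊗ (c ⊝ b))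
    energy≡ ξ = begin
      ∑ (λ z → r ξ z * r ξ z)  ≡⟨ ∑-swap (r ξ) β (λ z c → ⟦ B (z ⊝ ξ ⊗ c) ⟧) ⟩
      ∑ (λ c → β c * ∑ λ z → r ξ z * ⟦ B (z ⊝ ξ ⊗ c) ⟧)  ≡⟨ ∑-cong (λ c → cong (β c *_) (∑-cong λ z → *-comm (r ξ z) ⟦ B (z ⊝ ξ ⊗ c) ⟧)) ⟩
      ∑ (λ c → β c * ∑ λ z → ⟦ B (z ⊝ ξ ⊗ c) ⟧ * r ξ z)  ≡⟨ ∑-cong (λ c → cong (β c *_) (∑-swap (λ z → ⟦ B (z ⊝ ξ ⊗ c) ⟧) β (λ z b → ⟦ B (z ⊝ ξ ⊗ b) ⟧))) ⟩
      ∑ (λ c → β c * ∑ λ b → β b * ∑ λ z → ⟦ B (z ⊝ ξ ⊗ c) ⟧ * ⟦ B (z ⊝ ξ ⊗ b) ⟧)  ≡⟨ ∑-cong (λ c → cong (β c *_) (∑-cong λ b → cong (β b *_) (shifted c b))) ⟩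
      ∑ (λ c → β c * ∑ λ b → β b * correlation B (ξ ⊗ (c ⊝ b)))  ∎
      where
      open ≡-Reasoning
      rearrange : ∀ z ξ c b → z ⊝ ξ ⊗ b ≡ z ⊝ ξ ⊗ c ⊕ ξ ⊗ (c ⊝ b)
      rearrange = solve 4 (λ z ξ c b → z :- ξ :* b := z :- ξ :* c :+ ξ :* (c :- b)) refl
      shifted : ∀ c b → ∑ (λ z → ⟦ B (z ⊝ ξ ⊗ c) ⟧ * ⟦ B (z ⊝ ξ ⊗ b) ⟧) ≡ correlation B (ξ ⊗ (c ⊝ b))
      shifted c b = trans (∑-cong λ z → cong (λ y → ⟦ B (z ⊝ ξ ⊗ c) ⟧ * ⟦ B y ⟧) (rearrange z ξ c b))
        (∑-unshift (ξ ⊗ c) λ z → ⟦ B z ⟧ * ⟦ B (z ⊕ ξ ⊗ (c ⊝ b)) ⟧)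

    ∑-pull : (v : Fin p → Fin p → ℕ) → ∑ (λ ξ → ∑ λ c → β c * v ξ c) ≡ ∑ λ c → β c * ∑ λ ξ → v ξ c
    ∑-pull v = trans (∑-comm (λ ξ c → β c * v ξ c)) (∑-cong λ c → sym (*-∑ (β c) (λ ξ → v ξ c)))

    -- Off the diagonal ξ (c - b) runs once through the field, which gives |B|². On the diagonal
    -- each ξ contributes at most |B|.
    ∑-correlation-dilates : ∀ c b → ∑ (λ ξ → correlation B (ξ ⊗ (c ⊝ b))) ≤ card B * card B + ⟦ ⌊ c Fin.≟ b ⌋ ⟧ * (p * card B)
    ∑-correlation-dilates c b = split (c Fin.≟ b)
      where
      split : (c≟b : Dec (c ≡ b)) → ∑ (λ ξ → correlation B (ξ ⊗ (c ⊝ b))) ≤ card B * card B + ⟦ ⌊ c≟b ⌋ ⟧ * (p * card B)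
      split (yes c≡b) = begin
        ∑ (λ ξ → correlation B (ξ ⊗ (c ⊝ b)))  ≤⟨ ∑-mono (λ ξ → correlation≤card B (ξ ⊗ (c ⊝ b))) ⟩
        ∑ {p} (λ ξ → card B)  ≡⟨ ∑-const p (card B) ⟩
        p * card B  ≡⟨ *-identityˡ _ ⟨
        1 * (p * card B)  ≡⟨ cong (λ t → ⟦ t ⟧ * (p * card B)) (true-⌊⌋ (yes c≡b) c≡b) ⟨
        ⟦ ⌊ yes c≡b ⌋ ⟧ * (p * card B)  ≤⟨ m≤n+m _ _ ⟩
        card B * card B + ⟦ ⌊ yes c≡b ⌋ ⟧ * (p * card B)  ∎
        where open ≤-Reasoning
      split (no c≢b) = ≤-trans (≤-reflexive (trans (∑-cong λ ξ → cong (correlation B) (⊗-comm ξ (c ⊝ b)))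
        (trans (∑-dilate (c ⊝ b) (⊝≢0 c≢b) (correlation B)) (∑-correlation B)))) (m≤m+n _ _)

    ∑-diagonal : ∀ c → ∑ (λ b → β b * ⟦ ⌊ c Fin.≟ b ⌋ ⟧) ≤ 1
    ∑-diagonal c = ≤-trans (∑-mono λ b → ⟦⟧*≤ (B b) λ _ → ≤-refl) (card-unique (λ b → ⌊ c Fin.≟ b ⌋) λ i j ci cj →
      trans (sym (⌊⌋-true (c Fin.≟ i) ci)) (⌊⌋-true (c Fin.≟ j) cj))

    ∑-energy : ∑ energy ≤ card B * (card B * (card B * card B) + p * card B)
    ∑-energy = begin
      ∑ energy  ≡⟨ ∑-cong energy≡ ⟩
      ∑ (λ ξ → ∑ λ c → β c * ∑ λ b → β b * correlation B (ξ ⊗ (c ⊝ b)))  ≡⟨ ∑-pull (λ ξ c → ∑ λ b → β b * correlation B (ξ ⊗ (c ⊝ b))) ⟩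
      ∑ (λ c → β c * ∑ λ ξ → ∑ λ b → β b * correlation B (ξ ⊗ (c ⊝ b)))  ≡⟨ ∑-cong (λ c → cong (β c *_) (∑-pull (λ ξ b → correlation B (ξ ⊗ (c ⊝ b))))) ⟩
      ∑ (λ c → β c * ∑ λ b → β b * ∑ λ ξ → correlation B (ξ ⊗ (c ⊝ b)))  ≤⟨ ∑-mono (λ c → *-monoʳ-≤ (β c) (inner c)) ⟩
      ∑ (λ c → β c * (card B * (card B * card B) + p * card B))  ≡⟨ ∑-*ʳ (card B * (card B * card B) + p * card B) β ⟨
      card B * (card B * (card B * card B) + p * card B)  ∎
      where
      open ≤-Reasoning
      inner : ∀ c → ∑ (λ b → β b * ∑ λ ξ → correlation B (ξ ⊗ (c ⊝ b))) ≤ card B * (card B * card B) + p * card B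
      inner c = begin
        ∑ (λ b → β b * ∑ λ ξ → correlation B (ξ ⊗ (c ⊝ b)))  ≤⟨ ∑-mono (λ b → *-monoʳ-≤ (β b) (∑-correlation-dilates c b)) ⟩
        ∑ (λ b → β b * (card B * card B + ⟦ ⌊ c Fin.≟ b ⌋ ⟧ * (p * card B)))  ≡⟨ ∑-cong (λ b → distrib (β b) (card B * card B) ⟦ ⌊ c Fin.≟ b ⌋ ⟧ (p * card B)) ⟩
        ∑ (λ b → β b * (card B * card B) + β b * ⟦ ⌊ c Fin.≟ b ⌋ ⟧ * (p * card B))  ≡⟨ ∑-+ (λ b → β b * (card B * card B)) (λ b → β b * ⟦ ⌊ c Fin.≟ b ⌋ ⟧ * (p * card B)) ⟩
        ∑ (λ b → β b * (card B * card B)) + ∑ (λ b → β b * ⟦ ⌊ c Fin.≟ b ⌋ ⟧ * (p * card B))  ≡⟨ cong₂ _+_ (∑-*ʳ (card B * card B) β) (∑-*ʳ (p * card B) (λ b → β b * ⟦ ⌊ c Fin.≟ b ⌋ ⟧)) ⟨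
        card B * (card B * card B) + ∑ (λ b → β b * ⟦ ⌊ c Fin.≟ b ⌋ ⟧) * (p * card B)  ≤⟨ +-monoʳ-≤ _ (*-monoˡ-≤ (p * card B) (∑-diagonal c)) ⟩
        card B * (card B * card B) + 1 * (p * card B)  ≡⟨ cong (_+_ (card B * (card B * card B))) (*-identityˡ (p * card B)) ⟩
        card B * (card B * card B) + p * card B  ∎
        where
        distrib : ∀ b x t y → b * (x + t * y) ≡ b * x + b * t * y
        distrib = solve-∀

  -- For ξ = u / v the closure properties give a covering of vB + uB; scaling by v clears the
  -- denominator without changing any cardinality.
  CoveredDilate : ℕ → Fin p → Set
  CoveredDilate m ξ = ∃[ v ] ∃[ T ] (v ≢ 0̂ × length T ≤ m ×
    (∀ b b′ → B b ≡ true → B b′ ≡ true → ∃[ t ] (t ∈ T × B (v ⊗ (b ⊕ ξ ⊗ b′) ⊝ t) ≡ true)))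

  -- A sumset B + ξB of at most m |B| elements has energy at least |B|³ / m, whereas on average over
  -- ξ the energy is at most |B|⁴ / p + |B|². Hence |B| is at most of order m or at least of order p
  -- / m.
  covered-dilates⇒large : ∀ m → 0 < card B → (∀ ξ → CoveredDilate m ξ) → p * card B ≤ m * (card B * card B + p)
  covered-dilates⇒large m 0<B covered = *-cancelˡ-≤ (c * c * c) {{m*n≢0 (c * c) c {{m*n≢0 c c}}}} (begin
    c * c * c * (p * c)  ≡⟨ eq₁ c p ⟩
    p * (c * c * (c * c))  ≡⟨ ∑-const p (c * c * (c * c)) ⟨
    ∑ {p} (λ ξ → c * c * (c * c))  ≤⟨ ∑-mono (λ ξ → energy-lower ξ) ⟩
    ∑ (λ ξ → m * c * energy ξ)  ≡⟨ *-∑ (m * c) energy ⟨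
    m * c * ∑ energy  ≤⟨ *-monoʳ-≤ (m * c) ∑-energy ⟩
    m * c * (c * (c * (c * c) + p * c))  ≡⟨ eq₂ m c p ⟩
    c * c * c * (m * (c * c + p))  ∎)
    where
    open ≤-Reasoning
    c : ℕ
    c = card B
    instance
      c≢0 : NonZero c
      c≢0 = >-nonZero 0<B
    eq₁ : ∀ c p → c * c * c * (p * c) ≡ p * (c * c * (c * c))
    eq₁ = solve-∀
    eq₂ : ∀ m c p → m * c * (c * (c * (c * c) + p * c)) ≡ c * c * c * (m * (c * c + p))
    eq₂ = solve-∀
    energy-lower : ∀ ξ → c * c * (c * c) ≤ m * c * energy ξ
    energy-lower ξ = let v , T , v≢0 , ∣T∣≤m , cover = covered ξ in
      ≤-trans (≤-reflexive (cong₂ _*_ (sym (∑r ξ)) (sym (∑r ξ))))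
        (≤-trans (cauchy-schwarz-support (r ξ) (λ z → multiplicity B T (v ⊗ z)) (λ z → supported v T cover z (r ξ z) refl))
          (*-monoˡ-≤ (energy ξ) (≤-trans (≤-reflexive (trans (∑-dilate v v≢0 (multiplicity B T)) (∑-multiplicity B T))) (*-monoˡ-≤ c ∣T∣≤m))))
      where
      supported : ∀ v T → (∀ b b′ → B b ≡ true → B b′ ≡ true → ∃[ t ] (t ∈ T × B (v ⊗ (b ⊕ ξ ⊗ b′) ⊝ t) ≡ true)) →
        ∀ z k → r ξ z ≡ k → r ξ z ≡ 0 ⊎ 1 ≤ multiplicity B T (v ⊗ z)
      supported v T cover z zero    eq = inj₁ eq
      supported v T cover z (suc k) eq =
        let b′ , h = ∑>0⇒∃ (λ b → β b * ⟦ B (z ⊝ ξ ⊗ b) ⟧) (subst (0 <_) (sym eq) z<s)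
            b′∈B , b∈B = ∧-true (B b′) (B (z ⊝ ξ ⊗ b′)) (⟦⟧>0 _ (subst (0 <_) (sym (⟦∧⟧ (B b′) _)) h))
            t , t∈T , inB = cover (z ⊝ ξ ⊗ b′) b′ b∈B b′∈B
        in inj₂ (∈⇒multiplicity>0 B t∈T (subst (λ y → B (v ⊗ y ⊝ t) ≡ true) (⊕-⊝-cancel (ξ ⊗ b′) z) inB))

-- Dilations by subgroup elements under which a set meets itself often

module PopularDilates {p} (𝔽 : PrimeField p) {G : Fin p → Bool} (isSubgroup : IsSubgroup 𝔽 G)
  (A A′ : Fin p → Bool) (k : ℕ) (A-invariant : ∀ {g} → G g ≡ true → ∀ y → A (PrimeField._⊗_ 𝔽 g y) ≡ A y)
  (A′⊆A : ∀ {y} → A′ y ≡ true → A y ≡ true) (0<n : 0 < card G) (0<A′ : 0 < card A′) (card-A≤ : card A ≤ k * card A′) where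
  open PrimeField 𝔽
  open FieldSums 𝔽
  open IsSubgroup isSubgroup
  open Solver using (solve; _:=_; _:*_)
  open ≤-Reasoning

  meeting : Fin p → ℕ
  meeting h = ∑ λ y → ⟦ A′ y ⟧ * ⟦ A′ (h ⊗ y) ⟧

  popular : Fin p → Bool
  popular h = G h ∧ ⌊ card A′ ≤? 2 * k * meeting h ⌋

  private
    n a : ℕ
    n = card G
    a = card A′

    instance
      n≢0 : NonZero n
      n≢0 = >-nonZero 0<n
      a≢0 : NonZero a
      a≢0 = >-nonZero 0<A′

    γ : Fin p → ℕ
    γ g = ⟦ G g ⟧

    μ : Fin p → ℕ
    μ y = ∑ λ g → γ g * ⟦ A′ (g ⊗ y) ⟧

    C : ℕ
    C = ∑ λ h → γ h * meeting h

    weighted-cong : (u : ℕ) (v : Fin p → ℕ) → (∀ g → G g ≡ true → v g ≡ u) → ∑ (λ g → γ g * v g) ≡ n * u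
    weighted-cong u v h = trans (∑-cong λ g → on-G (G g) (h g)) (sym (∑-*ʳ u γ))
      where
      on-G : ∀ b {x} → (b ≡ true → x ≡ u) → ⟦ b ⟧ * x ≡ ⟦ b ⟧ * u
      on-G false _ = refl
      on-G true  h = cong (1 *_) (h refl)

    ∑μ : ∑ μ ≡ n * a
    ∑μ = trans (∑-comm (λ y g → γ g * ⟦ A′ (g ⊗ y) ⟧)) (trans (∑-cong λ g → sym (*-∑ (γ g) (λ y → ⟦ A′ (g ⊗ y) ⟧)))
      (weighted-cong a (λ g → ∑ λ y → ⟦ A′ (g ⊗ y) ⟧) λ g g∈G → ∑-dilate g (nonzero g∈G) λ y → ⟦ A′ y ⟧))

    μ-invariant : ∀ {g} → G g ≡ true → ∀ y → μ (g ⊗ y) ≡ μ y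
    μ-invariant {g} g∈G y = trans (∑-cong λ h → cong₂ _*_ (cong ⟦_⟧ (sym (mul-invariant h g∈G))) (cong (λ z → ⟦ A′ z ⟧) (rearrange g h y)))
      (∑-dilate g (nonzero g∈G) λ h → γ h * ⟦ A′ (h ⊗ y) ⟧)
      where
      rearrange : ∀ g h y → h ⊗ (g ⊗ y) ≡ g ⊗ h ⊗ y
      rearrange = solve 3 (λ g h y → h :* (g :* y) := g :* h :* y) refl

    μ-supported : ∀ y → μ y ≡ 0 ⊎ 1 ≤ ⟦ A y ⟧
    μ-supported y = split (μ y) refl
      where
      split : ∀ m → μ y ≡ m → μ y ≡ 0 ⊎ 1 ≤ ⟦ A y ⟧
      split zero    eq = inj₁ eq
      split (suc m) eq =
        let g , h = ∑>0⇒∃ (λ g → γ g * ⟦ A′ (g ⊗ y) ⟧) (subst (0 <_) (sym eq) z<s)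
            g∈G , gy∈A′ = ∧-true (G g) (A′ (g ⊗ y)) (⟦⟧>0 _ (subst (0 <_) (sym (⟦∧⟧ (G g) _)) h))
        in inj₂ (≤-reflexive (cong ⟦_⟧ (trans (sym (A′⊆A gy∈A′)) (A-invariant g∈G y))))

    ∑μ² : ∑ (λ y → μ y * μ y) ≡ n * C
    ∑μ² = begin-equality
      ∑ (λ y → μ y * μ y)  ≡⟨ ∑-swap μ γ (λ y g → ⟦ A′ (g ⊗ y) ⟧) ⟩
      ∑ (λ g → γ g * ∑ λ y → μ y * ⟦ A′ (g ⊗ y) ⟧)  ≡⟨ weighted-cong (∑ λ y → μ y * ⟦ A′ y ⟧) (λ g → ∑ λ y → μ y * ⟦ A′ (g ⊗ y) ⟧) (λ g g∈G →
                                                                  trans (∑-cong λ y → cong (_* ⟦ A′ (g ⊗ y) ⟧) (sym (μ-invariant g∈G y))) (∑-dilate g (nonzero g∈G) λ y → μ y * ⟦ A′ y ⟧)) ⟩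
      n * ∑ (λ y → μ y * ⟦ A′ y ⟧)  ≡⟨ cong (n *_) (∑-cong λ y → *-comm (μ y) ⟦ A′ y ⟧) ⟩
      n * ∑ (λ y → ⟦ A′ y ⟧ * μ y)  ≡⟨ cong (n *_) (∑-swap (λ y → ⟦ A′ y ⟧) γ (λ y h → ⟦ A′ (h ⊗ y) ⟧)) ⟩
      n * C  ∎

    -- `μ` counts how often the G-orbit of y enters A′; it has sum n a and vanishes off A, because A
    -- is invariant. Since |A| ≤ k a, Cauchy-Schwarz makes the sum of its squares large, and that
    -- sum is n times the total overlap `C`.
    na≤kC : n * a ≤ k * C
    na≤kC = *-cancelʳ-≤ _ _ (n * a) {{m*n≢0 n a}} (begin
      n * a * (n * a)  ≡⟨ cong₂ _*_ ∑μ ∑μ ⟨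
      ∑ μ * ∑ μ  ≤⟨ cauchy-schwarz-support μ (λ y → ⟦ A y ⟧) μ-supported ⟩
      card A * ∑ (λ y → μ y * μ y) ≡⟨ cong (card A *_) ∑μ² ⟩
      card A * (n * C)  ≤⟨ *-monoˡ-≤ (n * C) card-A≤ ⟩
      k * a * (n * C)  ≡⟨ eq k a n C ⟩
      k * C * (n * a)  ∎)
      where
      eq : ∀ k a n c → k * a * (n * c) ≡ k * c * (n * a)
      eq = solve-∀

    meeting≤a : ∀ h → meeting h ≤ a
    meeting≤a h = ∑-mono λ y → ≤-trans (*-monoʳ-≤ ⟦ A′ y ⟧ (⟦⟧≤1 (A′ (h ⊗ y)))) (≤-reflexive (*-identityʳ _))

  -- The overlaps over G add up to at least n a / k. Unpopular h supply at most half of this, and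
  -- each popular h at most a.
  card-popular : card G ≤ 2 * k * card popular
  card-popular = *-cancelʳ-≤ _ _ a (+-cancelˡ-≤ (n * a) _ _ (begin
    n * a + n * a  ≤⟨ +-mono-≤ na≤kC na≤kC ⟩
    k * C + k * C  ≡⟨ eq₁ k C ⟩
    2 * k * C  ≡⟨ ∑-*-pull (2 * k) γ meeting ⟩
    ∑ (λ h → γ h * (2 * k * meeting h))  ≤⟨ ∑-mono (λ h → split (G h) ⌊ card A′ ≤? 2 * k * meeting h ⌋ (meeting≤a h) λ eq → <⇒≤ (≰⇒> (⌊⌋-false (card A′ ≤? 2 * k * meeting h) eq))) ⟩
    ∑ (λ h → ⟦ popular h ⟧ * (2 * k * a) + γ h * a)  ≡⟨ ∑-+ (λ h → ⟦ popular h ⟧ * (2 * k * a)) (λ h → γ h * a) ⟩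
    ∑ (λ h → ⟦ popular h ⟧ * (2 * k * a)) + ∑ (λ h → γ h * a)  ≡⟨ cong₂ _+_ (∑-*ʳ (2 * k * a) (λ h → ⟦ popular h ⟧)) (∑-*ʳ a γ) ⟨
    card popular * (2 * k * a) + n * a  ≡⟨ eq₂ (card popular) k a (n * a) ⟩
    n * a + 2 * k * card popular * a  ∎))
    where
    eq₁ : ∀ k c → k * c + k * c ≡ 2 * k * c
    eq₁ = solve-∀
    eq₂ : ∀ x k a y → x * (2 * k * a) + y ≡ y + 2 * k * x * a
    eq₂ = solve-∀
    split : ∀ g t {o} → o ≤ a → (t ≡ false → 2 * k * o ≤ a) → ⟦ g ⟧ * (2 * k * o) ≤ ⟦ g ∧ t ⟧ * (2 * k * a) + ⟦ g ⟧ * a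
    split false _     _ _ = z≤n
    split true  true  o≤a _ = ≤-trans (+-monoˡ-≤ 0 (*-monoʳ-≤ (2 * k) o≤a)) (m≤m+n _ _)
    split true  false _ h = +-monoˡ-≤ 0 (h refl)

-- The sum-product contradiction

cubeᵉ bumpᵉ : ℕ → ℕ
cubeᵉ e = e + e + e
bumpᵉ e = cubeᵉ (cubeᵉ (cubeᵉ e) + cubeᵉ (cubeᵉ e))

iterateᵉ : ℕ → ℕ → ℕ
iterateᵉ zero    e = e
iterateᵉ (suc r) e = iterateᵉ r (bumpᵉ e)

-- k ^ finalExponent r ≡ cube (cube (iterate r bump (k ^ 17)))
opaque
  finalExponent : ℕ → ℕ
  finalExponent r = cubeᵉ (cubeᵉ (iterateᵉ r 17))

n≤2^n : ∀ n → n ≤ 2 ^ n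
n≤2^n zero    = z≤n
n≤2^n (suc n) = ≤-trans (+-mono-≤ (m^n>0 2 n) (n≤2^n n)) (≤-reflexive (cong (_+_ (2 ^ n)) (sym (+-identityʳ (2 ^ n)))))

module SumProduct {p} (𝔽 : PrimeField p) {G : Fin p → Bool} (isSubgroup : IsSubgroup 𝔽 G)
  (A : Fin p → Bool) (A-invariant : ∀ {g} → G g ≡ true → ∀ y → A (PrimeField._⊗_ 𝔽 g y) ≡ A y)
  (b K : ℕ) (n≤A : card G ≤ card A) (An≤pK : card A * card G ≤ p * K) (p<n^b : p < card G ^ b) where

  open PrimeField 𝔽
  open FieldSums 𝔽
  open QuotientGrowth 𝔽
  open Solver using (solve; _:=_; _:+_; _:*_; _:-_)

  private
    n : ℕ
    n = card G

  module _ (A′ : Fin p → Bool) (A′⊆A : ∀ {y} → A′ y ≡ true → A y ≡ true) (k : ℕ) (2≤k : 2 ≤ k) (K≤k : K ≤ k)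
    {a₀ : Fin p} (a₀∈A′ : A′ a₀ ≡ true) (card-A≤ : card A ≤ k * card A′) (card-E≤ : card (differenceSet A′) ≤ k * card A′)
    (large : k ^ (finalExponent (2 * b) + 9) < n) where

    private
      instance
        k≢0 : NonZero k
        k≢0 = >-nonZero (≤-trans (s≤s z≤n) 2≤k)
        n≢0 : NonZero n
        n≢0 = >-nonZero (≤-trans (s≤s z≤n) large)

      0<A′ : 0 < card A′
      0<A′ = ≤-trans (≤-reflexive (cong ⟦_⟧ (sym a₀∈A′))) (≤-∑ (λ x → ⟦ A′ x ⟧) a₀)

      open ApproximateRing 𝔽 A′ k 2≤k a₀∈A′ card-E≤
      open PopularDilates 𝔽 isSubgroup A A′ k A-invariant A′⊆A (≤-trans (s≤s z≤n) large) 0<A′ card-A≤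
      open DilateEnergy 𝔽 B
      open ≤-Reasoning

      -- `M` is the level of goodness after r rounds of growth from k^17. Two further cubes are due:
      -- one for the differences in numerator and denominator of a quotient, one for the sum of the
      -- two dilates. Taking r = 2 * b suffices because p < n^b ≤ x^(2 * b).
      r e M m : ℕ
      r = 2 * b
      e = finalExponent r
      M = iterate r bump (k ^ 17)
      m = cube (cube M)

      cube-^ : ∀ x → cube (k ^ x) ≡ k ^ cubeᵉ x
      cube-^ x = sym (trans (^-distribˡ-+-* k (x + x) x) (cong (_* k ^ x) (^-distribˡ-+-* k x x)))

      bump-^ : ∀ x → bump (k ^ x) ≡ k ^ bumpᵉ x
      bump-^ x = trans (cong (λ y → cube (y * y)) (trans (cong cube (cube-^ x)) (cube-^ (cubeᵉ x))))
        (trans (cong cube (sym (^-distribˡ-+-* k (cubeᵉ (cubeᵉ x)) (cubeᵉ (cubeᵉ x))))) (cube-^ (cubeᵉ (cubeᵉ x) + cubeᵉ (cubeᵉ x))))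

      iterate-^ : ∀ r x → iterate r bump (k ^ x) ≡ k ^ iterateᵉ r x
      iterate-^ zero    x = refl
      iterate-^ (suc r) x = trans (cong (iterate r bump) (bump-^ x)) (iterate-^ r (bumpᵉ x))

      opaque
        unfolding finalExponent
        m≡ : m ≡ k ^ e
        m≡ = trans (cong (λ y → cube (cube y)) (iterate-^ r 17)) (trans (cong cube (cube-^ (iterateᵉ r 17))) (cube-^ (cubeᵉ (iterateᵉ r 17))))

      k^4≤n : k ^ 4 ≤ n
      k^4≤n = ≤-trans (^-monoʳ-≤ k (≤-trans (m≤m+n 4 5) (m≤n+m 9 e))) (<⇒≤ large)

      x : ℕ
      x = card popular

      n≤k²x : n ≤ k * k * x
      n≤k²x = ≤-trans card-popular (*-monoˡ-≤ x (*-monoˡ-≤ k 2≤k))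

      -- The loss k² in `n≤k²x` is absorbed by k^4 ≤ n; this trades it for doubling the exponent b.
      n≤x² : n ≤ x * x
      n≤x² = *-cancelˡ-≤ n (begin
        n * n  ≤⟨ *-mono-≤ n≤k²x n≤k²x ⟩
        k * k * x * (k * k * x)  ≡⟨ eq k x ⟩
        k * (k * (k * (k * 1))) * (x * x) ≤⟨ *-monoˡ-≤ (x * x) k^4≤n ⟩
        n * (x * x)  ∎)
        where
        eq : ∀ k x → k * k * x * (k * k * x) ≡ k * (k * (k * (k * 1))) * (x * x)
        eq = solve-∀

      16≤n : 16 ≤ n
      16≤n = ≤-trans (^-monoˡ-≤ 4 2≤k) k^4≤n

      2≤x : 2 ≤ x
      2≤x = ≮⇒≥ λ x<2 → <⇒≱ (≤-trans (toWitness {a? = 2 ≤? 16} tt) 16≤n) (≤-trans n≤x² (*-mono-≤ (s≤s⁻¹ x<2) (s≤s⁻¹ x<2)))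

      p<x^ : p < x ^ (2 ^ r)
      p<x^ = begin-strict
        p  <⟨ p<n^b ⟩
        n ^ b  ≤⟨ ^-monoˡ-≤ b n≤x² ⟩
        (x * x) ^ b  ≡⟨ cong (λ y → (x * y) ^ b) (*-identityʳ x) ⟨
        (x ^ 2) ^ b  ≡⟨ ^-*-assoc x 2 b ⟩
        x ^ (2 * b)  ≤⟨ ^-monoʳ-≤ x {{>-nonZero (≤-trans (s≤s z≤n) 2≤x)}} (n≤2^n r) ⟩
        x ^ (2 ^ r)  ∎

      good-mono : ∀ {M M′ ξ} → M ≤ M′ → Good M ξ → Good M′ ξ
      good-mono M≤M′ = covered-mono M≤M′ λ _ q → q

      popular-good : ∀ h → popular h ≡ true → Good (k ^ 17) h
      popular-good h h∈ = let h∈G , often = ∧-true (G h) _ h∈ in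
        good-dilate h (IsSubgroup.nonzero isSubgroup h∈G) (⌊⌋-true (card A′ ≤? 2 * k * meeting h) often)

      κ≤M : k ^ 17 ≤ M
      κ≤M = ≤-iterate-bump r (k ^ 17)

      opaque
        generated : ∃[ X ] ((∀ x → X x ≡ true → Good M x) × ∀ ξ → Quotient X ξ)
        generated = generates Good (k ^ 17) good-mono good-⊖ good-⊕ good-⊗ r popular (k ^ 17) ≤-refl popular-good 2≤x p<x^

      good-difference : ∀ {M} → k ^ 17 ≤ M → ∀ {x y} → Good M x → Good M y → Good (cube M) (x ⊝ y)
      good-difference κ≤M good-x good-y = good-cube Good (k ^ 17) good-mono good-⊖ good-⊕ good-⊗ κ≤M good-x (good-⊖ good-y)

      covered-dilate : ∀ {M ξ u v} → v ≢ 0̂ → ξ ⊗ v ≡ u → Covered M ((v ·B) ⊞ (u ·B)) → CoveredDilate M ξ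
      covered-dilate {M} {ξ} {u} {v} v≢0 ξv≡u (T , ∣T∣≤ , cover) = v , T , v≢0 , ∣T∣≤ , near
        where
        expand : ∀ v ξ y y′ → v ⊗ (y ⊕ ξ ⊗ y′) ≡ v ⊗ y ⊕ ξ ⊗ v ⊗ y′
        expand = solve 4 (λ v ξ y y′ → v :* (y :+ ξ :* y′) := v :* y :+ ξ :* v :* y′) refl
        cancel : ∀ t z → t ⊕ z ⊝ t ≡ z
        cancel = solve 2 (λ t z → t :+ z :- t := z) refl
        near : ∀ y y′ → B y ≡ true → B y′ ≡ true → ∃[ t ] (t ∈ T × B (v ⊗ (y ⊕ ξ ⊗ y′) ⊝ t) ≡ true)
        near y y′ y∈B y′∈B =
          let t , z , t∈T , z∈B , eq = cover (v ⊗ y ⊕ u ⊗ y′) (v ⊗ y , u ⊗ y′ , (y , y∈B , refl) , (y′ , y′∈B , refl) , refl)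
              w≡ = trans (expand v ξ y y′) (trans (cong (λ w → v ⊗ y ⊕ w ⊗ y′) ξv≡u) eq)
          in t , t∈T , subst (λ w → B w ≡ true) (sym (trans (cong (_⊝ t) w≡) (cancel t z))) z∈B

      covered-by-quotient : ∀ M → k ^ 17 ≤ M → ∀ X → (∀ x → X x ≡ true → Good M x) → ∀ ξ → Quotient X ξ → CoveredDilate (cube (cube M)) ξ
      covered-by-quotient M κ≤M X good ξ (x₁ , x₂ , x₃ , x₄ , x₁∈X , x₂∈X , x₃∈X , x₄∈X , x₃≢x₄ , ξ≡) =
        covered-dilate (⊝≢0 x₃≢x₄) ξ≡ (covered-mono (*-monoʳ-≤ (cube M * cube M) (≤-trans κ≤M (≤-cube M))) (λ _ q → q)
          (covered-⊞ (good-difference κ≤M (good x₃ x₃∈X) (good x₄ x₄∈X)) (good-difference κ≤M (good x₁ x₁∈X) (good x₂ x₂∈X))))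

      covered : ∀ ξ → CoveredDilate m ξ
      covered ξ = covered-by-quotient M κ≤M (proj₁ generated) (proj₁ (proj₂ generated)) ξ (proj₂ (proj₂ generated) ξ)

      c : ℕ
      c = card B

      A≤k²c : card A ≤ k * (k * c)
      A≤k²c = ≤-trans card-A≤ (*-monoʳ-≤ k (≤-trans card-A≤kS (*-monoʳ-≤ k card-S≤card-B)))

      0<p : 0 < p
      0<p = ≤-trans 0<A′ (card≤n A′)

      0<c : 0 < c
      0<c = n≢0⇒n>0 λ c≡0 → <⇒≱ (≤-trans (≤-trans (s≤s z≤n) 16≤n) n≤A)
        (≤-trans A≤k²c (≤-reflexive (trans (cong (λ y → k * (k * y)) c≡0) (trans (cong (k *_) (*-zeroʳ k)) (*-zeroʳ k)))))

      large-B : p * c ≤ m * (c * c + p)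
      large-B = covered-dilates⇒large m 0<c covered

      mk^9<n : m * k ^ 9 < n
      mk^9<n = ≤-<-trans (≤-reflexive (trans (cong (_* k ^ 9) m≡) (sym (^-distribˡ-+-* k e 9)))) large

      -- B cannot be tiny: the level set A contains at least n elements and is at most k² times
      -- larger than B.
      small-case : c < 2 * m → ⊥
      small-case c<2m = <⇒≱ mk^9<n (begin
        n  ≤⟨ ≤-trans n≤A A≤k²c ⟩
        k * (k * c)  ≤⟨ *-monoʳ-≤ k (*-monoʳ-≤ k (≤-trans (<⇒≤ c<2m) (*-monoˡ-≤ m 2≤k))) ⟩
        k * (k * (k * m))  ≡⟨ eq k m ⟩
        m * (k * (k * (k * 1)))  ≤⟨ *-monoʳ-≤ m (^-monoʳ-≤ k (m≤m+n 3 6)) ⟩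
        m * k ^ 9  ∎)
        where
        eq : ∀ k m → k * (k * (k * m)) ≡ m * (k * (k * (k * 1)))
        eq = solve-∀

      -- The energy bound now gives p ≤ 2 m c, against card A * n ≤ p K. The 9 in the hypothesis
      -- `large` comes from here: 1 for the factor 2, 7 for `card-B≤` and 1 for K ≤ k.
      large-case : 2 * m ≤ c → ⊥
      large-case 2m≤c = <⇒≱ mk^9<n (*-cancelʳ-≤ _ _ p {{>-nonZero 0<p}} (begin
        n * p  ≤⟨ *-monoʳ-≤ n p≤2mc ⟩
        n * (2 * m * c)  ≤⟨ *-monoʳ-≤ n (*-mono-≤ (*-monoˡ-≤ m 2≤k) (≤-trans card-B≤ (*-monoʳ-≤ (k ^ 7) A′≤A))) ⟩
        n * (k * m * (k ^ 7 * card A))  ≡⟨ eq₁ n k m (k ^ 7) (card A) ⟩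
        k * m * k ^ 7 * (card A * n)  ≤⟨ *-monoʳ-≤ (k * m * k ^ 7) (≤-trans An≤pK (*-monoʳ-≤ p K≤k)) ⟩
        k * m * k ^ 7 * (p * k)  ≡⟨ eq₂ k m (k ^ 7) p ⟩
        m * (k * (k * k ^ 7)) * p  ∎))
        where
        A′≤A : card A′ ≤ card A
        A′≤A = ∑-mono λ y → ⟦⟧≤ (A′ y) λ y∈A′ → ≤-reflexive (cong ⟦_⟧ (sym (A′⊆A y∈A′)))
        p≤2mc : p ≤ 2 * m * c
        p≤2mc = *-cancelʳ-≤ _ _ c {{>-nonZero 0<c}} (+-cancelˡ-≤ (p * c) _ _ (begin
          p * c + p * c  ≡⟨ eq₃ (p * c) ⟩
          2 * (p * c)  ≤⟨ *-monoʳ-≤ 2 large-B ⟩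
          2 * (m * (c * c + p))  ≡⟨ eq₄ m c p ⟩
          p * (2 * m) + 2 * m * c * c  ≤⟨ +-monoˡ-≤ _ (*-monoʳ-≤ p 2m≤c) ⟩
          p * c + 2 * m * c * c  ∎))
          where
          eq₃ : ∀ y → y + y ≡ 2 * y
          eq₃ = solve-∀
          eq₄ : ∀ m c p → 2 * (m * (c * c + p)) ≡ p * (2 * m) + 2 * m * c * c
          eq₄ = solve-∀
        eq₁ : ∀ n k m y a → n * (k * m * (y * a)) ≡ k * m * y * (a * n)
        eq₁ = solve-∀
        eq₂ : ∀ k m y p → k * m * y * (p * k) ≡ m * (k * (k * y)) * p
        eq₂ = solve-∀

    small-doubling-impossible : ⊥
    small-doubling-impossible with 2 * m ≤? c
    ... | yes 2m≤c = large-case 2m≤c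
    ... | no  2m≰c = small-case (≰⇒> 2m≰c)

  additive-structure-impossible : (D : Fin p → Bool) → 16 ≤ K → card D ≤ K * card A →
    card A * card A ≤ K * pairs 𝔽 A D → (K ^ 15) ^ (finalExponent (2 * b) + 9) < n → ⊥
  additive-structure-impossible D 16≤K card-D pairs≥ large =
    -- A single constant K^15 serves for the doubling of A′ and also exceeds K², the loss in passing
    -- from A to A′.
    small-doubling-impossible A′ A′⊆A (K ^ 15) (≤-trans (≤-trans (toWitness {a? = 2 ≤? 16} tt) 16≤K) K≤k) K≤k
      (⟦⟧>0 (A′ a₀) a₀∈) (≤-trans card-A≤ (*-monoˡ-≤ (card A′) (^-monoʳ-≤ K (m≤m+n 2 13)))) card-differenceSet≤ large
    where
    instance
      K≢0 : NonZero K
      K≢0 = >-nonZero (≤-trans (s≤s z≤n) 16≤K)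
    0<A : 0 < card A
    0<A = ≤-trans (≤-trans (s≤s z≤n) large) n≤A
    open BalogSzemerédiGowers 𝔽 A D K 16≤K 0<A card-D pairs≥
    K≤k : K ≤ K ^ 15
    K≤k = ≤-trans (≤-reflexive (sym (*-identityʳ K))) (^-monoʳ-≤ K (m≤m+n 1 14))
    0<A′ : 0 < card A′
    0<A′ = n≢0⇒n>0 λ eq → <⇒≱ 0<A (≤-trans card-A≤ (≤-reflexive (trans (cong (K ^ 2 *_) eq) (*-zeroʳ (K ^ 2)))))
    a₀ : Fin p
    a₀ = proj₁ (∑>0⇒∃ (λ y → ⟦ A′ y ⟧) 0<A′)
    a₀∈ : 0 < ⟦ A′ a₀ ⟧
    a₀∈ = proj₂ (∑>0⇒∃ (λ y → ⟦ A′ y ⟧) 0<A′)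

-- Pigeonhole along the chain of level sets

module LargeCorrelation {p} (𝔽 : PrimeField p) {G : Fin p → Bool} (isSubgroup : IsSubgroup 𝔽 G)
  (f : Fin p → ℤ) (∑f≡0 : ∑ᶻ f ≡ + 0) where

  open PrimeField 𝔽
  open FieldSums 𝔽
  open IsSubgroup isSubgroup
  open Correlation 𝔽 isSubgroup f ∑f≡0
  open LevelSets 𝔽 isSubgroup f ∑f≡0

  module _ (0<w : 0 < w) {x : Fin p} (x≢0 : x ≢ 0̂) (R b I : ℕ) (16≤R : 16 ≤ R) (correlated : n * w ≤ R * s x)
    (p<n^b : p < n ^ b) (p<K^I : p < (R ^ (3 ^ I)) ^ I)
    (large : ((R ^ (3 ^ I)) ^ 15) ^ (finalExponent (2 * b) + 9) < n) where

    private
      K : ℕ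
      K = R ^ (3 ^ I)

      -- The thresholds are cubed from one level to the next, since `level-pairs` needs 2q² ≤ q′ and
      -- q is at least 2.
      q : ℕ → ℕ
      q i = R ^ (3 ^ i)

      0<n : 0 < n
      0<n = ≤-trans (s≤s z≤n) large

      instance
        R≢0 : NonZero R
        R≢0 = >-nonZero (≤-trans (s≤s z≤n) 16≤R)

      R≤q : ∀ i → R ≤ q i
      R≤q i = ≤-trans (≤-reflexive (sym (*-identityʳ R))) (^-monoʳ-≤ R (m^n>0 3 i))

      2q²≤ : ∀ i → 2 * (q i * q i) ≤ q (suc i)
      2q²≤ i = ≤-trans (*-monoˡ-≤ (q i * q i) (≤-trans (≤-trans (s≤s (s≤s z≤n)) 16≤R) (R≤q i))) (≤-reflexive (sym (trans
        (^-distribˡ-+-* R (3 ^ i) (3 ^ i + (3 ^ i + 0))) (cong (q i *_) (trans (^-distribˡ-+-* R (3 ^ i) (3 ^ i + 0)) (cong (λ e → q i * R ^ e) (+-identityʳ (3 ^ i))))))))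

      q≤K : ∀ {i} → i ≤ I → q i ≤ K
      q≤K i≤I = ^-monoʳ-≤ R (^-monoʳ-≤ 3 i≤I)

      x∈level : ∀ i → level (q i) x ≡ true
      x∈level i = true-⌊⌋ (n * w ≤? q i * s x) (≤-trans correlated (*-monoˡ-≤ (s x) (R≤q i)))

      -- Each level set contains x and is G-invariant, so it contains the whole coset of x.
      n≤card-level : ∀ i → n ≤ card (level (q i))
      n≤card-level i = ≤-trans (∑-mono λ g → ⟦⟧≤ (G g) λ g∈G → ≤-reflexive (cong ⟦_⟧ (sym
        (trans (cong (level (q i)) (⊗-comm x g)) (trans (level-invariant (q i) g∈G x) (x∈level i))))))
        (≤-reflexive (∑-dilate x x≢0 λ y → ⟦ level (q i) y ⟧))

    -- If every step grew by more than K, the last level set would outgrow the field. At a slow step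
    -- K also dominates the losses 2q² and q² of `level-pairs` and `level-card`, because i < I.
    large-correlation-impossible : ⊥
    large-correlation-impossible with slow-growth K (λ i → card (level (q i))) (≤-trans 0<n (n≤card-level 0)) I
    ... | inj₂ K^I≤c = <⇒≱ p<K^I (≤-trans K^I≤c (card≤n (level (q I))))
    ... | inj₁ (i , i<I , slow) = additive-structure-impossible (level (q (suc i))) (≤-trans 16≤R (R≤q I)) slow
      (≤-trans (level-pairs 0<n 0<w (q i) (q (suc i)) (2q²≤ i)) (*-monoˡ-≤ _ 2q²≤K)) large
      where
      2q²≤K : 2 * (q i * q i) ≤ K
      2q²≤K = ≤-trans (2q²≤ i) (q≤K i<I)
      open SumProduct 𝔽 isSubgroup (level (q i)) (level-invariant (q i)) b K (n≤card-level i)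
        (≤-trans (level-card 0<n 0<w (q i)) (*-monoʳ-≤ p (≤-trans (m≤m+n (q i * q i) _) 2q²≤K))) p<n^b

-- Residues modulo a prime

module Residues (p : ℕ) .{{_ : NonZero p}} where

  lift : Fin p → ℤ
  lift x = + toℕ x

  private
    small-multiple : ∀ m → p ∣ m → m < p → m ≡ 0
    small-multiple zero    _   _   = refl
    small-multiple (suc m) p∣m m<p = ⊥-elim (<⇒≱ m<p (∣⇒≤ p∣m))

  residue-unique : ∀ {m n} → m < p → n < p → + p ∣ᶻ (+ m ℤ.- + n) → m ≡ n
  residue-unique {m} {n} m<p n<p p∣ = ℤₚ.+-injective (ℤₚ.i-j≡0⇒i≡j (+ m) (+ n) (ℤₚ.∣i∣≡0⇒i≡0 (small-multiple _ (ℤ∣.∣⇒∣ᵤ p∣)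
    (≤-<-trans (≤-trans (≤-reflexive (cong ∣_∣ (ℤₚ.m-n≡m⊖n m n))) (ℤₚ.∣m⊝n∣≤m⊔n m n)) (⊔-lub m<p n<p)))))

  opaque
    reduce : ℤ → Fin p
    reduce i = fromℕ< (ℤ.n%ℕd<d i p)

    lift-reduce : ∀ i → + p ∣ᶻ (i ℤ.- lift (reduce i))
    lift-reduce i = ℤ∣.divides (i ℤ./ℕ p) (trans (cong (λ y → i ℤ.- + y) (Fin.toℕ-fromℕ< (ℤ.n%ℕd<d i p)))
      (trans (cong (ℤ._- + (i ℤ.%ℕ p)) (ℤ.a≡a%ℕn+[a/ℕn]*n i p)) (cancel (+ (i ℤ.%ℕ p)) (i ℤ./ℕ p ℤ.* + p))))
      where
      cancel : ∀ a b → a ℤ.+ b ℤ.- a ≡ b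
      cancel = solveᶻ-∀

  reduce-cong : ∀ {i j} → + p ∣ᶻ (i ℤ.- j) → reduce i ≡ reduce j
  reduce-cong {i} {j} p∣ = Fin.toℕ-injective (residue-unique (Fin.toℕ<n (reduce i)) (Fin.toℕ<n (reduce j))
    (subst (+ p ∣ᶻ_) (regroup i j (lift (reduce i)) (lift (reduce j)))
      (ℤ∣.∣m∣n⇒∣m+n (ℤ∣.∣m∣n⇒∣m-n p∣ (lift-reduce i)) (lift-reduce j))))
    where
    regroup : ∀ i j a b → i ℤ.- j ℤ.- (i ℤ.- a) ℤ.+ (j ℤ.- b) ≡ a ℤ.- b
    regroup = solveᶻ-∀

  reduce-lift : ∀ x → reduce (lift x) ≡ x
  reduce-lift x = sym (Fin.toℕ-injective (residue-unique (Fin.toℕ<n x) (Fin.toℕ<n (reduce (lift x))) (lift-reduce (lift x))))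

  reduce-≡⇒∣ : ∀ {i j} → reduce i ≡ reduce j → + p ∣ᶻ (i ℤ.- j)
  reduce-≡⇒∣ {i} {j} eq = subst (+ p ∣ᶻ_) (regroup i j (lift (reduce j)))
    (ℤ∣.∣m∣n⇒∣m-n (subst (λ x → + p ∣ᶻ (i ℤ.- lift x)) eq (lift-reduce i)) (lift-reduce j))
    where
    regroup : ∀ i j a → i ℤ.- a ℤ.- (j ℤ.- a) ≡ i ℤ.- j
    regroup = solveᶻ-∀

  infixl 6 _+ₚ_
  infixl 7 _*ₚ_
  _+ₚ_ _*ₚ_ : Fin p → Fin p → Fin p
  x +ₚ y = reduce (lift x ℤ.+ lift y)
  x *ₚ y = reduce (lift x ℤ.* lift y)

  -ₚ_ : Fin p → Fin p
  -ₚ x = reduce (ℤ.- lift x)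

  reduce-+ : ∀ i j → reduce (i ℤ.+ j) ≡ reduce i +ₚ reduce j
  reduce-+ i j = reduce-cong (subst (+ p ∣ᶻ_) (regroup i j (lift (reduce i)) (lift (reduce j))) (ℤ∣.∣m∣n⇒∣m+n (lift-reduce i) (lift-reduce j)))
    where
    regroup : ∀ i j a b → i ℤ.- a ℤ.+ (j ℤ.- b) ≡ i ℤ.+ j ℤ.- (a ℤ.+ b)
    regroup = solveᶻ-∀

  reduce-* : ∀ i j → reduce (i ℤ.* j) ≡ reduce i *ₚ reduce j
  reduce-* i j = reduce-cong (subst (+ p ∣ᶻ_) (regroup i j (lift (reduce i)) (lift (reduce j)))
    (ℤ∣.∣m∣n⇒∣m+n (ℤ∣.∣m⇒∣m*n j (lift-reduce i)) (ℤ∣.∣n⇒∣m*n (lift (reduce i)) (lift-reduce j))))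
    where
    regroup : ∀ i j a b → (i ℤ.- a) ℤ.* j ℤ.+ a ℤ.* (j ℤ.- b) ≡ i ℤ.* j ℤ.- a ℤ.* b
    regroup = solveᶻ-∀

  reduce-neg : ∀ i → reduce (ℤ.- i) ≡ -ₚ reduce i
  reduce-neg i = reduce-cong (subst (+ p ∣ᶻ_) (regroup i (lift (reduce i))) (ℤ∣.∣m⇒∣-m (lift-reduce i)))
    where
    regroup : ∀ i a → ℤ.- (i ℤ.- a) ≡ ℤ.- i ℤ.- ℤ.- a
    regroup = solveᶻ-∀

  reduce≡0 : ∀ {i} → reduce i ≡ reduce (+ 0) → + p ∣ᶻ i
  reduce≡0 {i} eq = subst (+ p ∣ᶻ_) (ℤₚ.+-identityʳ i) (reduce-≡⇒∣ eq)

  private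
    lift₁ : {f g : Fin p → Fin p} → (∀ i → f (reduce i) ≡ g (reduce i)) → ∀ x → f x ≡ g x
    lift₁ {f} {g} h x = subst (λ x → f x ≡ g x) (reduce-lift x) (h (lift x))

    +-assocₚ : ∀ x y z → (x +ₚ y) +ₚ z ≡ x +ₚ (y +ₚ z)
    +-assocₚ x y z = begin
      reduce (X ℤ.+ Y) +ₚ z  ≡⟨ cong (reduce (X ℤ.+ Y) +ₚ_) (reduce-lift z) ⟨
      reduce (X ℤ.+ Y) +ₚ reduce Z  ≡⟨ reduce-+ (X ℤ.+ Y) Z ⟨
      reduce (X ℤ.+ Y ℤ.+ Z)  ≡⟨ cong reduce (ℤₚ.+-assoc X Y Z) ⟩
      reduce (X ℤ.+ (Y ℤ.+ Z))  ≡⟨ reduce-+ X (Y ℤ.+ Z) ⟩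
      reduce X +ₚ reduce (Y ℤ.+ Z)  ≡⟨ cong (_+ₚ reduce (Y ℤ.+ Z)) (reduce-lift x) ⟩
      x +ₚ (y +ₚ z)  ∎
      where
      open ≡-Reasoning
      X = lift x
      Y = lift y
      Z = lift z

    *-assocₚ : ∀ x y z → (x *ₚ y) *ₚ z ≡ x *ₚ (y *ₚ z)
    *-assocₚ x y z = begin
      reduce (X ℤ.* Y) *ₚ z  ≡⟨ cong (reduce (X ℤ.* Y) *ₚ_) (reduce-lift z) ⟨
      reduce (X ℤ.* Y) *ₚ reduce Z  ≡⟨ reduce-* (X ℤ.* Y) Z ⟨
      reduce (X ℤ.* Y ℤ.* Z)  ≡⟨ cong reduce (ℤₚ.*-assoc X Y Z) ⟩
      reduce (X ℤ.* (Y ℤ.* Z))  ≡⟨ reduce-* X (Y ℤ.* Z) ⟩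
      reduce X *ₚ reduce (Y ℤ.* Z)  ≡⟨ cong (_*ₚ reduce (Y ℤ.* Z)) (reduce-lift x) ⟩
      x *ₚ (y *ₚ z)  ∎
      where
      open ≡-Reasoning
      X = lift x
      Y = lift y
      Z = lift z

    +-commₚ : ∀ x y → x +ₚ y ≡ y +ₚ x
    +-commₚ x y = cong reduce (ℤₚ.+-comm (lift x) (lift y))

    *-commₚ : ∀ x y → x *ₚ y ≡ y *ₚ x
    *-commₚ x y = cong reduce (ℤₚ.*-comm (lift x) (lift y))

    +-identityˡₚ : ∀ x → reduce (+ 0) +ₚ x ≡ x
    +-identityˡₚ = lift₁ λ i → trans (sym (reduce-+ (+ 0) i)) (cong reduce (ℤₚ.+-identityˡ i))

    *-identityˡₚ : ∀ x → reduce (+ 1) *ₚ x ≡ x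
    *-identityˡₚ = lift₁ λ i → trans (sym (reduce-* (+ 1) i)) (cong reduce (ℤₚ.*-identityˡ i))

    +-inverseˡₚ : ∀ x → -ₚ x +ₚ x ≡ reduce (+ 0)
    +-inverseˡₚ = lift₁ λ i → trans (cong (_+ₚ reduce i) (sym (reduce-neg i))) (trans (sym (reduce-+ (ℤ.- i) i)) (cong reduce (ℤₚ.+-inverseˡ i)))

    distribˡₚ : ∀ x y z → x *ₚ (y +ₚ z) ≡ x *ₚ y +ₚ x *ₚ z
    distribˡₚ x y z = begin
      x *ₚ (y +ₚ z)  ≡⟨ cong (_*ₚ (y +ₚ z)) (reduce-lift x) ⟨
      reduce X *ₚ reduce (Y ℤ.+ Z)  ≡⟨ reduce-* X (Y ℤ.+ Z) ⟨
      reduce (X ℤ.* (Y ℤ.+ Z))  ≡⟨ cong reduce (ℤₚ.*-distribˡ-+ X Y Z) ⟩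
      reduce (X ℤ.* Y ℤ.+ X ℤ.* Z)  ≡⟨ reduce-+ (X ℤ.* Y) (X ℤ.* Z) ⟩
      x *ₚ y +ₚ x *ₚ z  ∎
      where
      open ≡-Reasoning
      X = lift x
      Y = lift y
      Z = lift z

  module _ (p-prime : Prime p) where
    private
      0ₚ 1ₚ : Fin p
      0ₚ = reduce (+ 0)
      1ₚ = reduce (+ 1)

      toℕ≡0⇒≡0 : ∀ {x} → p ∣ toℕ x → x ≡ 0ₚ
      toℕ≡0⇒≡0 {x} p∣x = trans (sym (reduce-lift x)) (cong (λ m → reduce (+ m)) (small-multiple (toℕ x) p∣x (Fin.toℕ<n x)))

      integralₚ : ∀ x y → x *ₚ y ≡ 0ₚ → x ≡ 0ₚ ⊎ y ≡ 0ₚ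
      integralₚ x y eq with euclidsLemma (toℕ x) (toℕ y) p-prime (subst (p ∣_) (ℤₚ.abs-* (lift x) (lift y)) (ℤ∣.∣⇒∣ᵤ (reduce≡0 eq)))
      ... | inj₁ p∣x = inj₁ (toℕ≡0⇒≡0 p∣x)
      ... | inj₂ p∣y = inj₂ (toℕ≡0⇒≡0 p∣y)

      inverse-of : ∀ x → x ≢ 0ₚ → ∃[ y ] x *ₚ y ≡ 1ₚ
      inverse-of x x≢0 = from-identity (coprime-Bézout (prime⇒coprime p-prime {{≢-nonZero λ eq → x≢0 (trans (sym (reduce-lift x)) (cong (λ m → reduce (+ m)) eq))}} (Fin.toℕ<n x)))
        where
        from-identity : Bézout.Identity 1 p (toℕ x) → ∃[ y ] x *ₚ y ≡ 1ₚ
        -- The Bézout coefficients are natural numbers: here 1 + b x = a p, so the inverse is -b; in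
        -- the other case 1 + a p = b x and it is b.
        from-identity (Bézout.+- a b eq) = reduce (ℤ.- + b) , trans (cong (_*ₚ reduce (ℤ.- + b)) (sym (reduce-lift x)))
          (trans (sym (reduce-* (lift x) (ℤ.- + b))) (reduce-cong (ℤ∣.divides (ℤ.- + a)
            (trans (regroup (lift x) (+ b)) (trans (cong ℤ.-_ (trans (cong (ℤ._+_ (+ 1)) (sym (ℤₚ.pos-* b (toℕ x)))) (trans (cong +_ eq) (ℤₚ.pos-* a p)))) (ℤₚ.neg-distribˡ-* (+ a) (+ p)))))))
          where
          regroup : ∀ x b → x ℤ.* ℤ.- b ℤ.- + 1 ≡ ℤ.- (+ 1 ℤ.+ b ℤ.* x)
          regroup = solveᶻ-∀
        from-identity (Bézout.-+ a b eq) = reduce (+ b) , trans (cong (_*ₚ reduce (+ b)) (sym (reduce-lift x)))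
          (trans (sym (reduce-* (lift x) (+ b))) (reduce-cong (ℤ∣.divides (+ a)
            (trans (cong (ℤ._- + 1) (trans (ℤₚ.*-comm (lift x) (+ b)) (trans (sym (ℤₚ.pos-* b (toℕ x))) (trans (cong +_ (sym eq)) (cong (ℤ._+_ (+ 1)) (ℤₚ.pos-* a p)))))) (cancel (+ a ℤ.* + p))))))
          where
          cancel : ∀ y → + 1 ℤ.+ y ℤ.- + 1 ≡ y
          cancel = solveᶻ-∀

      generates-ℕ : (P : Fin p → Set) → P 0ₚ → (∀ x → P x → P (x +ₚ 1ₚ)) → ∀ m → P (reduce (+ m))
      generates-ℕ P P0 step zero    = P0
      generates-ℕ P P0 step (suc m) = subst P (trans (sym (reduce-+ (+ m) (+ 1))) (cong (λ y → reduce (+ y)) (+-comm m 1))) (step (reduce (+ m)) (generates-ℕ P P0 step m))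

    primeField : PrimeField p
    primeField = record
      { _⊕_ = _+ₚ_ ; _⊗_ = _*ₚ_ ; ⊖_ = -ₚ_ ; 0̂ = 0ₚ ; 1̂ = 1ₚ
      ; isCommutativeRing = record
        { isRing = record
          { +-isAbelianGroup = record
            { isGroup = record
              { isMonoid = record
                { isSemigroup = record { isMagma = record { isEquivalence = isEquivalence ; ∙-cong = cong₂ _+ₚ_ } ; assoc = +-assocₚ }
                ; identity = +-identityˡₚ , λ x → trans (+-commₚ x 0ₚ) (+-identityˡₚ x) }
              ; inverse = +-inverseˡₚ , λ x → trans (+-commₚ x (-ₚ x)) (+-inverseˡₚ x)
              ; ⁻¹-cong = cong -ₚ_ }
            ; comm = +-commₚ }
          ; *-cong = cong₂ _*ₚ_
          ; *-assoc = *-assocₚ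
          ; *-identity = *-identityˡₚ , λ x → trans (*-commₚ x 1ₚ) (*-identityˡₚ x)
          ; distrib = distribˡₚ , λ x y z → trans (*-commₚ (y +ₚ z) x) (trans (distribˡₚ x y z) (cong₂ _+ₚ_ (*-commₚ x y) (*-commₚ x z))) }
        ; *-comm = *-commₚ }
      ; ⟨_⟩ = reduce ; ⟨⟩-+ = reduce-+ ; ⟨⟩-* = reduce-* ; ⟨⟩-neg = reduce-neg ; ⟨⟩-0 = refl ; ⟨⟩-1 = refl
      ; integral = integralₚ
      ; inverse = λ x x≢0 → proj₁ (inverse-of x x≢0)
      ; inverseʳ = λ x x≢0 → proj₂ (inverse-of x x≢0)
      ; 1̂-generates = λ P P0 step x → subst P (reduce-lift x) (generates-ℕ P P0 step (toℕ x))
      }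

-- Roots of unity

module RootsOfUnity {p} (𝔽 : PrimeField p) (1≢0 : PrimeField.1̂ 𝔽 ≢ PrimeField.0̂ 𝔽) where
  open PrimeField 𝔽
  open FieldSums 𝔽
  open Solver using (solve; _:=_; _:+_; _:*_; _:-_)
  private
    module Π = MonoidSum (CommutativeRing.*-commutativeMonoid commutativeRing)

  pow : Fin p → ℕ → Fin p
  pow x zero    = 1̂
  pow x (suc m) = x ⊗ pow x m

  pow-⊗ : ∀ x y m → pow (x ⊗ y) m ≡ pow x m ⊗ pow y m
  pow-⊗ x y zero    = sym (⊗-identityˡ 1̂)
  pow-⊗ x y (suc m) = trans (cong (x ⊗ y ⊗_) (pow-⊗ x y m)) (solve 4 (λ x y a b → x :* y :* (a :* b) := x :* a :* (y :* b)) refl x y (pow x m) (pow y m))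

  pow-+ : ∀ x l m → pow x (l + m) ≡ pow x l ⊗ pow x m
  pow-+ x zero    m = sym (⊗-identityˡ _)
  pow-+ x (suc l) m = trans (cong (x ⊗_) (pow-+ x l m)) (sym (⊗-assoc x (pow x l) (pow x m)))

  pow-* : ∀ x l m → pow x (m * l) ≡ pow (pow x l) m
  pow-* x l zero    = refl
  pow-* x l (suc m) = trans (pow-+ x l (m * l)) (cong (pow x l ⊗_) (pow-* x l m))

  nonzero : Fin p → Bool
  nonzero x = not ⌊ x Fin.≟ 0̂ ⌋

  nonzero-true : ∀ {x} → x ≢ 0̂ → nonzero x ≡ true
  nonzero-true {x} x≢0 with ⌊ x Fin.≟ 0̂ ⌋ in eq
  ... | false = refl
  ... | true  = ⊥-elim (x≢0 (⌊⌋-true (x Fin.≟ 0̂) eq))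

  nonzero-≢ : ∀ {x} → nonzero x ≡ true → x ≢ 0̂
  nonzero-≢ {x} h x≡0 with ⌊ x Fin.≟ 0̂ ⌋ in eq
  ... | false = ⌊⌋-false (x Fin.≟ 0̂) eq x≡0

  1+card-nonzero : suc (card nonzero) ≡ p
  1+card-nonzero = begin
    1 + card nonzero  ≡⟨ cong (_+ card nonzero) (≤-antisym (≤-trans (≤-reflexive (cong ⟦_⟧ (sym (true-⌊⌋ (0̂ Fin.≟ 0̂) refl)))) (≤-∑ (λ x → ⟦ ⌊ x Fin.≟ 0̂ ⌋ ⟧) 0̂)) (card-unique (λ x → ⌊ x Fin.≟ 0̂ ⌋) λ i j i≡0 j≡0 → trans (⌊⌋-true (i Fin.≟ 0̂) i≡0) (sym (⌊⌋-true (j Fin.≟ 0̂) j≡0)))) ⟩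
    card (λ x → ⌊ x Fin.≟ 0̂ ⌋) + card nonzero  ≡⟨ ∑-+ (λ x → ⟦ ⌊ x Fin.≟ 0̂ ⌋ ⟧) (λ x → ⟦ nonzero x ⟧) ⟨
    ∑ (λ x → ⟦ ⌊ x Fin.≟ 0̂ ⌋ ⟧ + ⟦ nonzero x ⟧)  ≡⟨ ∑-cong (λ x → complement ⌊ x Fin.≟ 0̂ ⌋) ⟩
    ∑ {p} (λ x → 1)  ≡⟨ trans (∑-const p 1) (*-identityʳ p) ⟩
    p  ∎
    where
    open ≡-Reasoning
    complement : ∀ t → ⟦ t ⟧ + ⟦ not t ⟧ ≡ 1
    complement true  = refl
    complement false = refl

  private
    -- Replaces 0 by 1, so that a product over the whole field becomes a product over the units.
    unit : Fin p → Fin p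
    unit y = if nonzero y then y else 1̂

    opaque
      unfolding ∑
      Π-indicator : ∀ {m} (P : Fin m → Bool) x → Π.sum (λ i → if P i then x else 1̂) ≡ pow x (card P)
      Π-indicator {zero}  P x = refl
      Π-indicator {suc m} P x with P zero
      ... | true  = cong (x ⊗_) (Π-indicator (λ i → P (suc i)) x)
      ... | false = trans (⊗-identityˡ _) (Π-indicator (λ i → P (suc i)) x)

    Π-≢0 : ∀ {m} (f : Fin m → Fin p) → (∀ i → f i ≢ 0̂) → Π.sum f ≢ 0̂
    Π-≢0 {zero}  f h eq = 1≢0 eq
    Π-≢0 {suc m} f h eq with integral (f zero) (Π.sum (λ i → f (suc i))) eq
    ... | inj₁ eq₀ = h zero eq₀
    ... | inj₂ eq₁ = Π-≢0 (λ i → f (suc i)) (λ i → h (suc i)) eq₁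

    unit-≢0 : ∀ y → unit y ≢ 0̂
    unit-≢0 y with nonzero y in eq
    ... | true  = nonzero-≢ eq
    ... | false = 1≢0

    ⊗-≢0 : ∀ {x y} → x ≢ 0̂ → y ≢ 0̂ → x ⊗ y ≢ 0̂
    ⊗-≢0 {x} {y} x≢0 y≢0 xy≡0 with integral x y xy≡0
    ... | inj₁ x≡0 = x≢0 x≡0
    ... | inj₂ y≡0 = y≢0 y≡0

    unit-⊗ : ∀ {x} → x ≢ 0̂ → ∀ y → unit (x ⊗ y) ≡ (if nonzero y then x else 1̂) ⊗ unit y
    unit-⊗ {x} x≢0 y = split (y Fin.≟ 0̂)
      where
      nonzero-0 : nonzero 0̂ ≡ false
      nonzero-0 = cong not (true-⌊⌋ (0̂ Fin.≟ 0̂) refl)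
      at-zero : unit (x ⊗ 0̂) ≡ (if nonzero 0̂ then x else 1̂) ⊗ unit 0̂
      at-zero rewrite ⊗-zeroʳ x | nonzero-0 = sym (⊗-identityˡ 1̂)
      split : Dec (y ≡ 0̂) → unit (x ⊗ y) ≡ (if nonzero y then x else 1̂) ⊗ unit y
      split (yes y≡0) = subst (λ y → unit (x ⊗ y) ≡ (if nonzero y then x else 1̂) ⊗ unit y) (sym y≡0) at-zero
      split (no y≢0) rewrite nonzero-true y≢0 | nonzero-true (⊗-≢0 x≢0 y≢0) = refl

  -- Multiplication by x permutes the units, and comparing the two products of all units leaves a
  -- power of x equal to 1.
  fermat : ∀ {x} → x ≢ 0̂ → pow x (card nonzero) ≡ 1̂
  fermat {x} x≢0 = ⊗-cancelˡ (Π.sum unit) (Π-≢0 unit unit-≢0) (begin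
    Π.sum unit ⊗ pow x (card nonzero)  ≡⟨ ⊗-comm (Π.sum unit) _ ⟩
    pow x (card nonzero) ⊗ Π.sum unit  ≡⟨ cong (_⊗ Π.sum unit) (Π-indicator nonzero x) ⟨
    Π.sum (λ y → if nonzero y then x else 1̂) ⊗ Π.sum unit  ≡⟨ Π.∑-distrib-+ (λ y → if nonzero y then x else 1̂) unit ⟨
    Π.sum (λ y → (if nonzero y then x else 1̂) ⊗ unit y)  ≡⟨ Π.sum-cong-≗ (unit-⊗ x≢0) ⟨
    Π.sum (λ y → unit (x ⊗ y))  ≡⟨ Π.sum-permute unit (permutation (x ⊗_) (c⁻¹ x x≢0 ⊗_) (c⊗c⁻¹⊗ x x≢0) (c⁻¹⊗c⊗ x x≢0)) ⟨
    Π.sum unit  ≡⟨ ⊗-identityʳ _ ⟨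
    Π.sum unit ⊗ 1̂  ∎)
    where open ≡-Reasoning

  -- The monic polynomial whose non-leading coefficients are listed from the constant term up.
  monic : ∀ {m} → Vec (Fin p) m → Fin p → Fin p
  monic []       x = 1̂
  monic (c ∷ cs) x = x ⊗ monic cs x ⊕ c

  private
    add-multiple : ∀ {m} → Fin p → Vec (Fin p) (suc m) → Vec (Fin p) m → Vec (Fin p) (suc m)
    add-multiple a (c ∷ cs)            []       = c ⊕ a ∷ cs
    add-multiple a (c ∷ cs@(_ ∷ _))    (d ∷ ds) = c ⊕ a ⊗ d ∷ add-multiple a cs ds

    add-multiple-monic : ∀ {m} a (cs : Vec (Fin p) (suc m)) (ds : Vec (Fin p) m) x → monic (add-multiple a cs ds) x ≡ monic cs x ⊕ a ⊗ monic ds x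
    add-multiple-monic a (c ∷ cs) [] x = trans (cong (λ y → x ⊗ monic cs x ⊕ (c ⊕ y)) (sym (⊗-identityʳ a)))
      (solve 3 (λ q c a → q :+ (c :+ a) := q :+ c :+ a) refl (x ⊗ monic cs x) c (a ⊗ 1̂))
    add-multiple-monic a (c ∷ cs@(_ ∷ _)) (d ∷ ds) x = trans (cong (λ y → x ⊗ y ⊕ (c ⊕ a ⊗ d)) (add-multiple-monic a cs ds x))
      (solve 6 (λ x q r c d a → x :* (q :+ a :* r) :+ (c :+ a :* d) := x :* q :+ c :+ a :* (x :* r :+ d)) refl x (monic cs x) (monic ds x) c d a)

    -- Synthetic division by x - a; the discarded remainder is the value at a, as `quotient-monic`
    -- records.
    quotient : ∀ {m} → Fin p → Vec (Fin p) (suc m) → Vec (Fin p) m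
    quotient a (c ∷ [])          = []
    quotient a (c ∷ cs@(_ ∷ _))  = add-multiple a cs (quotient a cs)

    quotient-monic : ∀ {m} a (cs : Vec (Fin p) (suc m)) x → monic cs x ⊝ monic cs a ≡ (x ⊝ a) ⊗ monic (quotient a cs) x
    quotient-monic a (c ∷ []) x = solve 4 (λ x a c i → (x :* i :+ c) :- (a :* i :+ c) := (x :- a) :* i) refl x a c 1̂
    quotient-monic a (c ∷ cs@(_ ∷ _)) x = begin
      (x ⊗ Qx ⊕ c) ⊝ (a ⊗ Qa ⊕ c)  ≡⟨ solve 5 (λ x a c q r → (x :* q :+ c) :- (a :* r :+ c) := (x :- a) :* q :+ a :* (q :- r)) refl x a c Qx Qa ⟩
      (x ⊝ a) ⊗ Qx ⊕ a ⊗ (Qx ⊝ Qa)  ≡⟨ cong (λ y → (x ⊝ a) ⊗ Qx ⊕ a ⊗ y) (quotient-monic a cs x) ⟩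
      (x ⊝ a) ⊗ Qx ⊕ a ⊗ ((x ⊝ a) ⊗ R)  ≡⟨ solve 4 (λ y a q r → y :* q :+ a :* (y :* r) := y :* (q :+ a :* r)) refl (x ⊝ a) a Qx R ⟩
      (x ⊝ a) ⊗ (Qx ⊕ a ⊗ R)  ≡⟨ cong ((x ⊝ a) ⊗_) (add-multiple-monic a cs (quotient a cs) x) ⟨
      (x ⊝ a) ⊗ monic (add-multiple a cs (quotient a cs)) x  ∎
      where
      open ≡-Reasoning
      Qx = monic cs x
      Qa = monic cs a
      R = monic (quotient a cs) x

    roots : ∀ {m} → Vec (Fin p) m → Fin p → Bool
    roots cs x = ⌊ monic cs x Fin.≟ 0̂ ⌋

    ⊝-0 : ∀ x {y} → y ≡ 0̂ → x ⊝ y ≡ x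
    ⊝-0 x {y} y≡0 = trans (cong (x ⊝_) y≡0) (trans (cong (_⊝ 0̂) (sym (⊕-identityʳ x))) (⊝-⊕-cancel 0̂ x))

    card-roots : ∀ {m} (cs : Vec (Fin p) m) → card (roots cs) ≤ m
    card-roots [] = ≤-reflexive (trans (∑-cong λ x → no-root x) (trans (∑-const p 0) (*-zeroʳ p)))
      where
      no-root : ∀ x → ⟦ roots [] x ⟧ ≡ 0
      no-root x with roots [] x in eq
      ... | false = refl
      ... | true  = ⊥-elim (1≢0 (⌊⌋-true (1̂ Fin.≟ 0̂) eq))
    card-roots {suc m} cs with Fin.any? (λ a → monic cs a Fin.≟ 0̂)
    ... | no none = ≤-trans (∑-mono λ x → ⟦⟧≤ (roots cs x) λ root → ⊥-elim (none (x , ⌊⌋-true (monic cs x Fin.≟ 0̂) root)))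
                      (≤-trans (≤-reflexive (trans (∑-const p 0) (*-zeroʳ p))) z≤n)
    ... | yes (a , root-a) = begin
      card (roots cs)  ≤⟨ ∑-mono (λ x → ⟦⟧≤ (roots cs x) (pointwise x)) ⟩
      ∑ (λ x → ⟦ ⌊ x Fin.≟ a ⌋ ⟧ + ⟦ roots (quotient a cs) x ⟧)  ≡⟨ ∑-+ (λ x → ⟦ ⌊ x Fin.≟ a ⌋ ⟧) (λ x → ⟦ roots (quotient a cs) x ⟧) ⟩
      card (λ x → ⌊ x Fin.≟ a ⌋) + card (roots (quotient a cs))  ≤⟨ +-mono-≤ (card-unique (λ x → ⌊ x Fin.≟ a ⌋) λ i j hi hj → trans (⌊⌋-true (i Fin.≟ a) hi) (sym (⌊⌋-true (j Fin.≟ a) hj))) (card-roots (quotient a cs)) ⟩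
      suc m  ∎
      where
      open ≤-Reasoning
      pointwise : ∀ x → roots cs x ≡ true → 1 ≤ ⟦ ⌊ x Fin.≟ a ⌋ ⟧ + ⟦ roots (quotient a cs) x ⟧
      pointwise x root with integral (x ⊝ a) (monic (quotient a cs) x) (trans (sym (quotient-monic a cs x)) (trans (⊝-0 (monic cs x) root-a) (⌊⌋-true (monic cs x Fin.≟ 0̂) root)))
      ... | inj₁ x⊝a≡0 = ≤-trans (≤-reflexive (cong ⟦_⟧ (sym (true-⌊⌋ (x Fin.≟ a) (⊝≡0⇒≡ x⊝a≡0))))) (m≤m+n _ _)
      ... | inj₂ Q≡0 = ≤-trans (≤-reflexive (cong ⟦_⟧ (sym (true-⌊⌋ (monic (quotient a cs) x Fin.≟ 0̂) Q≡0)))) (m≤n+m _ ⟦ ⌊ x Fin.≟ a ⌋ ⟧)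

    monic-zeros : ∀ m x → monic (replicate m 0̂) x ≡ pow x m
    monic-zeros zero    x = refl
    monic-zeros (suc m) x = trans (⊕-identityʳ _) (cong (x ⊗_) (monic-zeros m x))

  card-power-fibre : ∀ m → 0 < m → ∀ c → card (λ x → ⌊ pow x m Fin.≟ c ⌋) ≤ m
  card-power-fibre (suc m) _ c = ≤-trans (∑-mono λ x → ⟦⟧≤ ⌊ pow x (suc m) Fin.≟ c ⌋ λ h →
    ≤-reflexive (cong ⟦_⟧ (sym (true-⌊⌋ (monic (⊖ c ∷ replicate m 0̂) x Fin.≟ 0̂)
      (trans (cong (λ y → x ⊗ y ⊕ ⊖ c) (monic-zeros m x)) (trans (cong (_⊝ c) (⌊⌋-true (pow x (suc m) Fin.≟ c) h)) (⊝-self c)))))))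
    (card-roots (⊖ c ∷ replicate m 0̂))

  pow-0 : ∀ {n} → 0 < n → pow 0̂ n ≡ 0̂
  pow-0 {suc n} _ = ⊗-zeroˡ (pow 0̂ n)

  module _ (n : ℕ) (0<n : 0 < n) where

    rootsOfUnity : Fin p → Bool
    rootsOfUnity g = ⌊ pow g n Fin.≟ 1̂ ⌋

    rootsOfUnity-isSubgroup : IsSubgroup 𝔽 rootsOfUnity
    rootsOfUnity-isSubgroup = record
      { nonzero = λ {g} g∈ g≡0 → 1≢0 (trans (sym (⌊⌋-true (pow g n Fin.≟ 1̂) g∈)) (trans (cong (λ y → pow y n) g≡0) (pow-0 0<n)))
      ; mul-invariant = λ {g} h g∈ → cong (λ y → ⌊ y Fin.≟ 1̂ ⌋)
          (trans (pow-⊗ g h n) (trans (cong (_⊗ pow h n) (⌊⌋-true (pow g n Fin.≟ 1̂) g∈)) (⊗-identityˡ _)))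
      }

    -- With p - 1 = d n, raising to the power d sends units to n-th roots of unity by `fermat`, and
    -- its fibres have at most d elements. This avoids a primitive root.
    card-rootsOfUnity : 2 ≤ p → n ∣ p ∸ 1 → n ≤ card rootsOfUnity
    card-rootsOfUnity 2≤p (divides d p-1≡dn) = *-cancelʳ-≤ _ _ d {{>-nonZero 0<d}} (begin
      n * d  ≡⟨ nd≡ ⟩
      card nonzero  ≤⟨ ∑-mono (λ x → ⟦⟧≤ (nonzero x) (pointwise x)) ⟩
      ∑ (λ x → ∑ λ h → ⟦ rootsOfUnity h ⟧ * ⟦ ⌊ pow x d Fin.≟ h ⌋ ⟧)  ≡⟨ ∑-comm (λ x h → ⟦ rootsOfUnity h ⟧ * ⟦ ⌊ pow x d Fin.≟ h ⌋ ⟧) ⟩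
      ∑ (λ h → ∑ λ x → ⟦ rootsOfUnity h ⟧ * ⟦ ⌊ pow x d Fin.≟ h ⌋ ⟧)  ≡⟨ ∑-cong (λ h → *-∑ ⟦ rootsOfUnity h ⟧ (λ x → ⟦ ⌊ pow x d Fin.≟ h ⌋ ⟧)) ⟨
      ∑ (λ h → ⟦ rootsOfUnity h ⟧ * card (λ x → ⌊ pow x d Fin.≟ h ⌋))  ≤⟨ ∑-mono (λ h → *-monoʳ-≤ ⟦ rootsOfUnity h ⟧ (card-power-fibre d 0<d h)) ⟩
      ∑ (λ h → ⟦ rootsOfUnity h ⟧ * d)  ≡⟨ ∑-*ʳ d (λ h → ⟦ rootsOfUnity h ⟧) ⟨
      card rootsOfUnity * d  ∎)
      where
      open ≤-Reasoning
      units≡ : card nonzero ≡ d * n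
      units≡ = trans (cong (_∸ 1) 1+card-nonzero) p-1≡dn
      nd≡ : n * d ≡ card nonzero
      nd≡ = trans (*-comm n d) (sym units≡)
      0<d : 0 < d
      0<d = n≢0⇒n>0 λ d≡0 → <⇒≱ 2≤p (≤-reflexive (trans (sym 1+card-nonzero) (cong suc (trans units≡ (cong (_* n) d≡0)))))
      pointwise : ∀ x → nonzero x ≡ true → 1 ≤ ∑ λ h → ⟦ rootsOfUnity h ⟧ * ⟦ ⌊ pow x d Fin.≟ h ⌋ ⟧
      pointwise x x≢0 = ≤-trans (≤-reflexive (sym (cong₂ (λ s t → ⟦ s ⟧ * ⟦ t ⟧) in-H (true-⌊⌋ (pow x d Fin.≟ pow x d) refl))))
        (≤-∑ (λ h → ⟦ rootsOfUnity h ⟧ * ⟦ ⌊ pow x d Fin.≟ h ⌋ ⟧) (pow x d))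
        where
        in-H : rootsOfUnity (pow x d) ≡ true
        in-H = true-⌊⌋ (pow (pow x d) n Fin.≟ 1̂) (trans (sym (pow-* x d n)) (trans (cong (pow x) nd≡) (fermat (nonzero-≢ x≢0))))

-- Cosets avoiding an interval

∑ᶻ-const : ∀ n c → ∑ᶻ {n} (λ _ → c) ≡ + n ℤ.* c
∑ᶻ-const n c = begin
  ∑ᶻ {n} (λ _ → c)  ≡⟨ ∑ᶻ-cong (λ _ → ℤₚ.*-identityʳ c) ⟨
  ∑ᶻ {n} (λ _ → c ℤ.* + 1)  ≡⟨ *-∑ᶻ c (λ _ → + 1) ⟨
  c ℤ.* ∑ᶻ {n} (λ _ → + 1)  ≡⟨ cong (c ℤ.*_) (trans (∑ᶻ-pos {n} λ _ → 1) (cong +_ (trans (∑-const n 1) (*-identityʳ n)))) ⟩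
  c ℤ.* + n  ≡⟨ ℤₚ.*-comm c (+ n) ⟩
  + n ℤ.* c  ∎
  where open ≡-Reasoning

opaque
  unfolding ∑
  card-below : ∀ n L → L ≤ n → card {n} (λ t → ⌊ toℕ t <? L ⌋) ≡ L
  card-below n zero _ = trans (∑-cong {n} {g = λ _ → 0} λ t → none t) (trans (∑-const n 0) (*-zeroʳ n))
    where
    none : ∀ (t : Fin n) → ⟦ ⌊ toℕ t <? 0 ⌋ ⟧ ≡ 0
    none t with ⌊ toℕ t <? 0 ⌋ in eq
    ... | false = refl
    ... | true with () ← ⌊⌋-true (toℕ t <? 0) eq
  card-below (suc n) (suc L) (s≤s L≤n) = cong₂ _+_ (cong ⟦_⟧ (true-⌊⌋ (0 <? suc L) z<s))
    (trans (∑-cong {n} λ t → cong ⟦_⟧ (⌊⌋-suc (toℕ t))) (card-below n L L≤n))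
    where
    ⌊⌋-suc : ∀ m → ⌊ suc m <? suc L ⌋ ≡ ⌊ m <? L ⌋
    ⌊⌋-suc m with ⌊ m <? L ⌋ in eq
    ... | true  = true-⌊⌋ (suc m <? suc L) (s≤s (⌊⌋-true (m <? L) eq))
    ... | false with ⌊ suc m <? suc L ⌋ in eq′
    ...   | false = refl
    ...   | true  = ⊥-elim (⌊⌋-false (m <? L) eq (s≤s⁻¹ (⌊⌋-true (suc m <? suc L) eq′)))

module BalancedIndicator {p} (𝔽 : PrimeField p) {G : Fin p → Bool} (isSubgroup : IsSubgroup 𝔽 G) (J : Fin p → Bool) where
  open PrimeField 𝔽
  open FieldSums 𝔽

  private
    L : ℕ
    L = card J

    P Λ : ℤ
    P = + p
    Λ = + L

    ι : Fin p → ℤ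
    ι t = + ⟦ J t ⟧

    ∑ι : ∑ᶻ ι ≡ Λ
    ∑ι = ∑ᶻ-pos λ t → ⟦ J t ⟧

  -- The indicator of J minus its mean L / p, scaled by p to remain integral.
  balanced : Fin p → ℤ
  balanced t = P ℤ.* ι t ℤ.+ ℤ.- Λ

  ∑-balanced : ∑ᶻ balanced ≡ + 0
  ∑-balanced = begin
    ∑ᶻ (λ t → P ℤ.* ι t ℤ.+ ℤ.- Λ)  ≡⟨ ∑ᶻ-+ (λ t → P ℤ.* ι t) (λ _ → ℤ.- Λ) ⟩
    ∑ᶻ (λ t → P ℤ.* ι t) ℤ.+ ∑ᶻ {p} (λ _ → ℤ.- Λ)  ≡⟨ cong₂ ℤ._+_ (trans (sym (*-∑ᶻ P ι)) (cong (P ℤ.*_) ∑ι)) (∑ᶻ-const p (ℤ.- Λ)) ⟩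
    P ℤ.* Λ ℤ.+ P ℤ.* ℤ.- Λ  ≡⟨ cancel P Λ ⟩
    + 0  ∎
    where
    open ≡-Reasoning
    cancel : ∀ a b → a ℤ.* b ℤ.+ a ℤ.* ℤ.- b ≡ + 0
    cancel = solveᶻ-∀

  open Correlation 𝔽 isSubgroup balanced ∑-balanced public

  ψ-balanced : ∀ y → ψ y ≡ P ℤ.* (P ℤ.* + correlation J y) ℤ.- P ℤ.* (Λ ℤ.* Λ)
  ψ-balanced y = begin
    ∑ᶻ (λ t → (P ℤ.* ι t ℤ.+ ℤ.- Λ) ℤ.* (P ℤ.* ι (t ⊕ y) ℤ.+ ℤ.- Λ))  ≡⟨ ∑ᶻ-cong (λ t → expand P Λ (ι t) (ι (t ⊕ y))) ⟩
    ∑ᶻ (λ t → P² ℤ.* (ι t ℤ.* ι (t ⊕ y)) ℤ.+ (C ℤ.* ι t ℤ.+ (C ℤ.* ι (t ⊕ y) ℤ.+ Λ ℤ.* Λ)))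
      ≡⟨ ∑ᶻ-+ (λ t → P² ℤ.* (ι t ℤ.* ι (t ⊕ y))) (λ t → C ℤ.* ι t ℤ.+ (C ℤ.* ι (t ⊕ y) ℤ.+ Λ ℤ.* Λ)) ⟩
    ∑ᶻ (λ t → P² ℤ.* (ι t ℤ.* ι (t ⊕ y))) ℤ.+ ∑ᶻ (λ t → C ℤ.* ι t ℤ.+ (C ℤ.* ι (t ⊕ y) ℤ.+ Λ ℤ.* Λ))
      ≡⟨ cong₂ ℤ._+_ quadratic (trans (∑ᶻ-+ (λ t → C ℤ.* ι t) (λ t → C ℤ.* ι (t ⊕ y) ℤ.+ Λ ℤ.* Λ)) (cong₂ ℤ._+_ (linear ι ∑ι)
           (trans (∑ᶻ-+ (λ t → C ℤ.* ι (t ⊕ y)) (λ _ → Λ ℤ.* Λ)) (cong₂ ℤ._+_ (linear (λ t → ι (t ⊕ y)) (trans (∑ᶻ-shift y ι) ∑ι)) (∑ᶻ-const p (Λ ℤ.* Λ)))))) ⟩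
    P² ℤ.* + correlation J y ℤ.+ (C ℤ.* Λ ℤ.+ (C ℤ.* Λ ℤ.+ P ℤ.* (Λ ℤ.* Λ)))  ≡⟨ collect P Λ (+ correlation J y) ⟩
    P ℤ.* (P ℤ.* + correlation J y) ℤ.- P ℤ.* (Λ ℤ.* Λ)  ∎
    where
    open ≡-Reasoning
    P² C : ℤ
    P² = P ℤ.* P
    C = ℤ.- (P ℤ.* Λ)
    expand : ∀ P L a b → (P ℤ.* a ℤ.+ ℤ.- L) ℤ.* (P ℤ.* b ℤ.+ ℤ.- L) ≡
      P ℤ.* P ℤ.* (a ℤ.* b) ℤ.+ (ℤ.- (P ℤ.* L) ℤ.* a ℤ.+ (ℤ.- (P ℤ.* L) ℤ.* b ℤ.+ L ℤ.* L))
    expand = solveᶻ-∀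
    collect : ∀ P L x → P ℤ.* P ℤ.* x ℤ.+ (ℤ.- (P ℤ.* L) ℤ.* L ℤ.+ (ℤ.- (P ℤ.* L) ℤ.* L ℤ.+ P ℤ.* (L ℤ.* L))) ≡ P ℤ.* (P ℤ.* x) ℤ.- P ℤ.* (L ℤ.* L)
    collect = solveᶻ-∀
    linear : ∀ (u : Fin p → ℤ) → ∑ᶻ u ≡ Λ → ∑ᶻ (λ t → C ℤ.* u t) ≡ C ℤ.* Λ
    linear u ∑u = trans (sym (*-∑ᶻ C u)) (cong (C ℤ.*_) ∑u)
    quadratic : ∑ᶻ (λ t → P² ℤ.* (ι t ℤ.* ι (t ⊕ y))) ≡ P² ℤ.* + correlation J y
    quadratic = trans (sym (*-∑ᶻ P² (λ t → ι t ℤ.* ι (t ⊕ y)))) (cong (P² ℤ.*_)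
      (trans (∑ᶻ-cong λ t → sym (ℤₚ.pos-* ⟦ J t ⟧ ⟦ J (t ⊕ y) ⟧)) (∑ᶻ-pos λ t → ⟦ J t ⟧ * ⟦ J (t ⊕ y) ⟧)))

  private
    correlation-0 : correlation J 0̂ ≡ L
    correlation-0 = ∑-cong λ t → trans (cong (λ z → ⟦ J t ⟧ * ⟦ J z ⟧) (⊕-identityʳ t)) (⟦⟧-idem (J t))

  w-balanced : w + p * (L * L) ≡ p * (p * L)
  w-balanced = ℤₚ.+-injective (begin
    + (w + p * (L * L))  ≡⟨ cong (ℤ._+_ (+ w)) (pos³ p L L) ⟩
    + w ℤ.+ P ℤ.* (Λ ℤ.* Λ)  ≡⟨ cong (λ v → v ℤ.+ P ℤ.* (Λ ℤ.* Λ)) (trans (sym ψ0≡w) (trans (ψ-balanced 0̂) (cong (λ c → P ℤ.* (P ℤ.* + c) ℤ.- P ℤ.* (Λ ℤ.* Λ)) correlation-0))) ⟩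
    P ℤ.* (P ℤ.* Λ) ℤ.- P ℤ.* (Λ ℤ.* Λ) ℤ.+ P ℤ.* (Λ ℤ.* Λ)  ≡⟨ cancel (P ℤ.* (P ℤ.* Λ)) (P ℤ.* (Λ ℤ.* Λ)) ⟩
    P ℤ.* (P ℤ.* Λ)  ≡⟨ pos³ p p L ⟨
    + (p * (p * L))  ∎)
    where
    open ≡-Reasoning
    pos³ : ∀ a b c → + (a * (b * c)) ≡ + a ℤ.* (+ b ℤ.* + c)
    pos³ a b c = trans (ℤₚ.pos-* a (b * c)) (cong (ℤ._*_ (+ a)) (ℤₚ.pos-* b c))
    cancel : ∀ a b → a ℤ.- b ℤ.+ b ≡ a
    cancel = solveᶻ-∀

  -- When the correlations along the coset vanish, only the mean term survives in ψ. It is the same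
  -- negative number for every g, so nothing cancels in S.
  s-avoiding : ∀ x → (∀ g → G g ≡ true → correlation J (x ⊗ g) ≡ 0) → s x ≡ n * (p * (L * L))
  s-avoiding x avoids = begin
    ∣ S x ∣  ≡⟨ cong ∣_∣ (∑ᶻ-cong λ g → on-G (G g) (λ g∈G → at-g g (avoids g g∈G))) ⟩
    ∣ ∑ᶻ (λ g → γ g ℤ.* ℤ.- + (p * (L * L))) ∣  ≡⟨ cong ∣_∣ (sym (∑ᶻ-*ʳ (ℤ.- + (p * (L * L))) γ)) ⟩
    ∣ ∑ᶻ γ ℤ.* ℤ.- + (p * (L * L)) ∣  ≡⟨ ℤₚ.abs-* (∑ᶻ γ) _ ⟩
    ∣ ∑ᶻ γ ∣ * ∣ ℤ.- + (p * (L * L)) ∣  ≡⟨ cong₂ _*_ (cong ∣_∣ (∑ᶻ-pos λ g → ⟦ G g ⟧)) (ℤₚ.∣-i∣≡∣i∣ (+ (p * (L * L)))) ⟩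
    n * (p * (L * L))  ∎
    where
    open ≡-Reasoning
    vanish : ∀ a b → a ℤ.* (a ℤ.* + 0) ℤ.- b ≡ ℤ.- b
    vanish = solveᶻ-∀
    at-g : ∀ g → correlation J (x ⊗ g) ≡ 0 → ψ (x ⊗ g) ≡ ℤ.- + (p * (L * L))
    at-g g eq = trans (ψ-balanced (x ⊗ g)) (trans (cong (λ c → P ℤ.* (P ℤ.* + c) ℤ.- P ℤ.* (Λ ℤ.* Λ)) eq)
      (trans (vanish P (P ℤ.* (Λ ℤ.* Λ))) (cong ℤ.-_ (sym (trans (ℤₚ.pos-* p (L * L)) (cong (P ℤ.*_) (ℤₚ.pos-* L L)))))))
    on-G : ∀ t {u v} → (t ≡ true → u ≡ v) → + ⟦ t ⟧ ℤ.* u ≡ + ⟦ t ⟧ ℤ.* v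
    on-G false _ = refl
    on-G true  h = cong (ℤ._*_ (+ 1)) (h refl)

  module _ {x : Fin p} (x≢0 : x ≢ 0̂) (avoids : ∀ g → G g ≡ true → correlation J (x ⊗ g) ≡ 0)
    (0<L : 0 < card J) (L<p : card J < p) (R b I : ℕ) (16≤R : 16 ≤ R) (p≤RL : p ≤ R * card J) (p<n^b : p < card G ^ b) (p<K^I : p < (R ^ (3 ^ I)) ^ I)
    (large : ((R ^ (3 ^ I)) ^ 15) ^ (finalExponent (2 * b) + 9) < card G) where

    avoiding-coset-impossible : ⊥
    avoiding-coset-impossible = LargeCorrelation.large-correlation-impossible 𝔽 isSubgroup balanced ∑-balanced 0<w x≢0 R b I 16≤R correlated p<n^b p<K^I large
      where
      open ≤-Reasoning
      instance
        L≢0 : NonZero L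
        L≢0 = >-nonZero 0<L
        p≢0 : NonZero p
        p≢0 = >-nonZero (<-trans 0<L L<p)
      0<w : 0 < w
      0<w = +-cancelʳ-< (p * (L * L)) 0 w (begin-strict
        p * (L * L)  <⟨ *-monoʳ-< p (*-monoˡ-< L L<p) ⟩
        p * (p * L)  ≡⟨ w-balanced ⟨
        w + p * (L * L)  ∎)
      -- By `w-balanced` w is at most p² L, and p ≤ R L exchanges one factor p for R L.
      correlated : n * w ≤ R * s x
      correlated = begin
        n * w  ≤⟨ *-monoʳ-≤ n (≤-trans (m≤m+n w (p * (L * L))) (≤-reflexive w-balanced)) ⟩
        n * (p * (p * L))  ≤⟨ *-monoʳ-≤ n (*-monoʳ-≤ p (*-monoˡ-≤ L p≤RL)) ⟩
        n * (p * (R * L * L))  ≡⟨ eq n p R L ⟩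
        R * (n * (p * (L * L)))  ≡⟨ cong (R *_) (s-avoiding x avoids) ⟨
        R * s x  ∎
        where
        eq : ∀ n p R L → n * (p * (R * L * L)) ≡ R * (n * (p * (L * L)))
        eq = solve-∀

-- Small representatives of cosets

module SmallRepresentatives (p : ℕ) (p-prime : Prime p) (n : ℕ) (0<n : 0 < n) (n∣p-1 : n ∣ p ∸ 1) where
  private
    instance
      p≢0 : NonZero p
      p≢0 = prime⇒nonZero p-prime

    1<p : 1 < p
    1<p = nonTrivial⇒n>1 p {{prime⇒nonTrivial p-prime}}

  open Residues p
  private
    𝔽 : PrimeField p
    𝔽 = primeField p-prime
  open PrimeField 𝔽
  open FieldSums 𝔽

  private
    1≢0 : 1̂ ≢ 0̂
    1≢0 eq = 1+n≢0 (residue-unique {1} {0} 1<p (<-trans z<s 1<p) (reduce-≡⇒∣ eq))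

  open RootsOfUnity 𝔽 1≢0

  reduce-^ : ∀ i m → reduce (i ℤ.^ m) ≡ pow (reduce i) m
  reduce-^ i zero    = refl
  reduce-^ i (suc m) = trans (reduce-* i (i ℤ.^ m)) (cong (reduce i ⊗_) (reduce-^ i m))

  H : Fin p → Bool
  H = rootsOfUnity n 0<n

  n≤card-H : n ≤ card H
  n≤card-H = card-rootsOfUnity n 0<n 1<p n∣p-1

  module _ (L : ℕ) (L<p : L < p) where

    Near : Fin p → Set
    Near y = toℕ y ≤ L ⊎ p ∸ toℕ y ≤ L

    near? : ∀ y → Dec (Near y)
    near? y = (toℕ y ≤? L) ⊎-dec (p ∸ toℕ y ≤? L)

    J : Fin p → Bool
    J t = ⌊ toℕ t <? L ⌋

    card-J : card J ≡ L
    card-J = card-below p L (<⇒≤ L<p)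

    -- Differences of elements of [0, L) lie strictly between -L and L. As p - y exceeds L, the sum
    -- t + y does not wrap around modulo p, so it bounds y from above by L.
    far⇒uncorrelated : ∀ y → ¬ Near y → correlation J y ≡ 0
    far⇒uncorrelated y far = n≤0⇒n≡0 (≮⇒≥ λ 0<corr →
      let t , h = ∑>0⇒∃ (λ t → ⟦ J t ⟧ * ⟦ J (t ⊕ y) ⟧) 0<corr
          Jt , Jt+y = ∧-true (J t) (J (t ⊕ y)) (⟦⟧>0 _ (subst (0 <_) (sym (⟦∧⟧ (J t) (J (t ⊕ y)))) h))
          t<L = ⌊⌋-true (toℕ t <? L) Jt
          t+y<L = ⌊⌋-true (toℕ (t ⊕ y) <? L) Jt+y
          t+y<p = <-≤-trans (+-monoˡ-< (toℕ y) t<L) (≤-trans (+-monoˡ-≤ (toℕ y) (<⇒≤ (≰⇒> λ h → far (inj₂ h)))) (≤-reflexive (m∸n+n≡m (<⇒≤ (Fin.toℕ<n y)))))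
          t+y≡ = residue-unique t+y<p (Fin.toℕ<n (t ⊕ y)) (lift-reduce (lift t ℤ.+ lift y))
      in far (inj₁ (≤-trans (m≤n+m (toℕ y) (toℕ t)) (≤-trans (≤-reflexive t+y≡) (<⇒≤ t+y<L)))))

    near⇒small : ∀ y → y ≢ 0̂ → Near y → ∃[ z ] (1 ≤ ∣ z ∣ × ∣ z ∣ ≤ L × reduce z ≡ y)
    near⇒small y y≢0 (inj₁ y≤L) = lift y , n≢0⇒n>0 (λ eq → y≢0 (trans (sym (reduce-lift y)) (cong (λ m → reduce (+ m)) eq))) , y≤L , reduce-lift y
    near⇒small y y≢0 (inj₂ p-y≤L) = ℤ.- + (p ∸ toℕ y) , ≤-trans (m<n⇒0<n∸m (Fin.toℕ<n y)) (≤-reflexive (sym abs)) , ≤-trans (≤-reflexive abs) p-y≤L ,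
      trans (reduce-cong (ℤ∣.divides (ℤ.- + 1) eq)) (reduce-lift y)
      where
      abs : ∣ ℤ.- + (p ∸ toℕ y) ∣ ≡ p ∸ toℕ y
      abs = ℤₚ.∣-i∣≡∣i∣ (+ (p ∸ toℕ y))
      regroup : ∀ a b → ℤ.- a ℤ.- b ≡ ℤ.- + 1 ℤ.* (a ℤ.+ b)
      regroup = solveᶻ-∀
      eq : ℤ.- + (p ∸ toℕ y) ℤ.- lift y ≡ ℤ.- + 1 ℤ.* + p
      eq = trans (regroup (+ (p ∸ toℕ y)) (lift y)) (cong (λ m → ℤ.- + 1 ℤ.* + m) (m∸n+n≡m (<⇒≤ (Fin.toℕ<n y))))

    covers : (∀ x → x ≢ 0̂ → ∃[ g ] (H g ≡ true × Near (x ⊗ g))) → Covers p n L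
    covers near m (0<m , m<p , y , p∣) =
      let g , g∈H , close = near x x≢0
          z , 1≤z , z≤L , z≡ = near⇒small (x ⊗ g) (λ xg≡0 → xg≢0 g g∈H (integral x g xg≡0)) close
          z^n≡ = trans (reduce-^ z n) (trans (cong (λ u → pow u n) z≡) (trans (pow-⊗ x g n)
            (trans (cong (pow x n ⊗_) (⌊⌋-true (pow g n Fin.≟ 1̂) g∈H)) (trans (⊗-identityʳ _) x^n≡))))
      in z , 1≤z , z≤L , ℤ∣.∣⇒∣ᵤ (reduce-≡⇒∣ z^n≡)
      where
      x : Fin p
      x = reduce y
      x^n≡ : pow x n ≡ reduce (+ m)
      x^n≡ = trans (sym (reduce-^ y n)) (reduce-cong (ℤ∣.∣ᵤ⇒∣ p∣))
      x≢0 : x ≢ 0̂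
      x≢0 x≡0 = <⇒≢ 0<m (sym (residue-unique m<p (<-trans z<s 1<p) (reduce-≡⇒∣ (trans (sym x^n≡) (trans (cong (λ u → pow u n) x≡0) (pow-0 0<n))))))
      xg≢0 : ∀ g → H g ≡ true → x ≡ 0̂ ⊎ g ≡ 0̂ → ⊥
      xg≢0 g g∈H (inj₁ x≡0) = x≢0 x≡0
      xg≢0 g g∈H (inj₂ g≡0) = IsSubgroup.nonzero (rootsOfUnity-isSubgroup n 0<n) g∈H g≡0

    module _ (0<L : 0 < L) (R b I : ℕ) (16≤R : 16 ≤ R) (p≤RL : p ≤ R * L) (p<n^b : p < n ^ b) (p<K^I : p < (R ^ (3 ^ I)) ^ I)
      (large : ((R ^ (3 ^ I)) ^ 15) ^ (finalExponent (2 * b) + 9) < n) where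

      near-exists : ∀ x → x ≢ 0̂ → ∃[ g ] (H g ≡ true × Near (x ⊗ g))
      near-exists x x≢0 = search (Fin.any? λ g → (H g Bool.≟ true) ×-dec near? (x ⊗ g))
        where
        open BalancedIndicator 𝔽 (rootsOfUnity-isSubgroup n 0<n) J
        search : Dec (∃[ g ] (H g ≡ true × Near (x ⊗ g))) → ∃[ g ] (H g ≡ true × Near (x ⊗ g))
        search (yes found) = found
        search (no none) = ⊥-elim (avoiding-coset-impossible x≢0
          (λ g g∈H → far⇒uncorrelated (x ⊗ g) λ close → none (g , g∈H , close))
          (subst (0 <_) (sym card-J) 0<L) (subst (_< p) (sym card-J) L<p) R b I 16≤R (subst (λ l → p ≤ R * l) (sym card-J) p≤RL)
          (<-≤-trans p<n^b (^-monoˡ-≤ b n≤card-H)) p<K^I (<-≤-trans large n≤card-H))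

      covers-small : Covers p n L
      covers-small = covers near-exists

-- Roots, exponents and the final bound

^-cancelʳ-< : ∀ {x y} E → x ^ E < y ^ E → x < y
^-cancelʳ-< {x} {y} E h = ≰⇒> λ y≤x → <⇒≱ h (^-monoˡ-≤ E y≤x)

-- Search downwards from m for the integer part of the root of order E + 1.
integer-root : ∀ E N → ∀ m → N < m ^ suc E → ∃[ R ] (R ^ suc E ≤ N × N < suc R ^ suc E)
integer-root E N (suc m) N< with N <? m ^ suc E
... | yes N<m^E = integer-root E N m N<m^E
... | no  N≮m^E = m , ≮⇒≥ N≮m^E , N<

opaque
  -- The power of K that n must exceed: 15 is the exponent of the doubling constant, and the
  -- successor makes positivity immediate.
  weight : ℕ → ℕ
  weight b = suc (15 * (finalExponent (2 * b) + 9))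

  power-weight : ∀ b K → 0 < K → (K ^ 15) ^ (finalExponent (2 * b) + 9) ≤ K ^ weight b
  power-weight b K 0<K = ≤-trans (≤-reflexive (^-*-assoc K 15 (finalExponent (2 * b) + 9))) (^-monoʳ-≤ K {{>-nonZero 0<K}} {15 * (finalExponent (2 * b) + 9)} (n≤1+n _))

  0<weight : ∀ b → 0 < weight b
  0<weight b = z<s

module Parameters (b : ℕ) (0<b : 0 < b) where
  -- For R near p^(a / E), two conditions fix these numbers: (K ^ W) ^ b = R ^ E ≤ p^a < n^b yields
  -- K ^ W < n, and K ^ I = R ^ (2 * E) exceeds p. The factor 2 in `I` pays for rounding the root
  -- down, through R + 1 ≤ R².
  W I E : ℕ
  W = weight b
  I = 2 * (W * b)
  E = 3 ^ I * W * b

  0<E : 0 < E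
  0<E = *-mono-< (*-mono-< (m^n>0 3 I) (0<weight b)) 0<b

  module _ (a : ℕ) (0<a : 0 < a) (p n k : ℕ) (p-prime : Prime p) (16^E≤p : 16 ^ E ≤ p) (0<n : 0 < n)
    (n∣p-1 : n ∣ p ∸ 1) (p^a<n^b : p ^ a < n ^ b) (isKpn : IsKpn p n k) where
    private
      open ≤-Reasoning

      instance
        p≢0 : NonZero p
        p≢0 = prime⇒nonZero p-prime

      p≤p^a : p ≤ p ^ a
      p≤p^a = ≤-trans (≤-reflexive (sym (*-identityʳ p))) (^-monoʳ-≤ p 0<a)

      -- R is the integer part of p^(a / E), the saving p^δ over the trivial bound for k.
      root : ∃[ R ] (R ^ E ≤ p ^ a × p ^ a < suc R ^ E)
      root = subst (λ E → ∃[ R ] (R ^ E ≤ p ^ a × p ^ a < suc R ^ E)) (suc-pred E {{>-nonZero 0<E}})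
        (integer-root (pred E) (p ^ a) (suc (p ^ a)) (≤-trans (≤-reflexive (sym (*-identityʳ (suc (p ^ a))))) (^-monoʳ-≤ (suc (p ^ a)) {1} {suc (pred E)} (s≤s z≤n))))

    module _ (R : ℕ) (R^E≤ : R ^ E ≤ p ^ a) (p^a< : p ^ a < suc R ^ E) where
      private
        16≤R : 16 ≤ R
        16≤R = s≤s⁻¹ (^-cancelʳ-< E (≤-<-trans (≤-trans 16^E≤p p≤p^a) p^a<))

        0<R : 0 < R
        0<R = ≤-trans (s≤s z≤n) 16≤R

        instance
          R≢0 : NonZero R
          R≢0 = >-nonZero 0<R

        K : ℕ
        K = R ^ (3 ^ I)

        K^W<n : K ^ W < n
        K^W<n = ^-cancelʳ-< b (begin-strict
          (K ^ W) ^ b  ≡⟨ cong (_^ b) (^-*-assoc R (3 ^ I) W) ⟩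
          (R ^ (3 ^ I * W)) ^ b  ≡⟨ ^-*-assoc R (3 ^ I * W) b ⟩
          R ^ E  ≤⟨ R^E≤ ⟩
          p ^ a  <⟨ p^a<n^b ⟩
          n ^ b  ∎)

        p<K^I : p < K ^ I
        p<K^I = begin-strict
          p  ≤⟨ p≤p^a ⟩
          p ^ a  <⟨ p^a< ⟩
          suc R ^ E  ≤⟨ ^-monoˡ-≤ E suc-R≤R² ⟩
          (R ^ 2) ^ E  ≡⟨ ^-*-assoc R 2 E ⟩
          R ^ (2 * E)  ≡⟨ cong (R ^_) (eq (3 ^ I) W b) ⟩
          R ^ (3 ^ I * I)  ≡⟨ ^-*-assoc R (3 ^ I) I ⟨
          K ^ I  ∎
          where
          eq : ∀ t w b → 2 * (t * w * b) ≡ t * (2 * (w * b))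
          eq = solve-∀
          suc-R≤R² : suc R ≤ R ^ 2
          suc-R≤R² = ≤-trans (+-mono-≤ 0<R (≤-reflexive (sym (+-identityʳ R)))) (≤-trans (*-monoˡ-≤ R (≤-trans (s≤s (s≤s z≤n)) 16≤R)) (≤-reflexive (cong (R *_) (sym (*-identityʳ R)))))

        L : ℕ
        L = suc (p / R)

        p≤RL : p ≤ R * L
        p≤RL = begin
          p  ≡⟨ m≡m%n+[m/n]*n p R ⟩
          p % R + p / R * R  ≤⟨ +-monoˡ-≤ _ (<⇒≤ (m%n<n p R)) ⟩
          R + p / R * R  ≡⟨ *-comm L R ⟩
          R * L  ∎

        R≤K^W : R ≤ K ^ W
        R≤K^W = ≤-trans (≤-trans (≤-reflexive (sym (*-identityʳ R))) (^-monoʳ-≤ R (*-mono-≤ (m^n>0 3 I) (0<weight b)))) (≤-reflexive (sym (^-*-assoc R (3 ^ I) W)))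

        open SmallRepresentatives p p-prime n 0<n n∣p-1

        n≤p : n ≤ p
        n≤p = ≤-trans n≤card-H (card≤n H)

        R≤p : R ≤ p
        R≤p = ≤-trans R≤K^W (≤-trans (<⇒≤ K^W<n) n≤p)

        LR≤2p : L * R ≤ 2 * p
        LR≤2p = ≤-trans (+-mono-≤ R≤p (m/n*n≤m p R)) (≤-reflexive (cong (_+_ p) (sym (+-identityʳ p))))

        L<p : L < p
        L<p = ≰⇒> λ p≤L → <⇒≱ (*-monoˡ-< p (toWitness {a? = 2 <? 16} tt)) (≤-trans (*-mono-≤ 16≤R p≤L) (≤-trans (≤-reflexive (*-comm R L)) LR≤2p))

        k≤L : k ≤ L
        k≤L = ≮⇒≥ λ L<k → proj₂ (proj₂ isKpn) L z<s L<k
          (covers-small L L<p z<s R b I 16≤R p≤RL (≤-<-trans p≤p^a p^a<n^b) p<K^I (≤-<-trans (power-weight b K (m^n>0 R (3 ^ I))) K^W<n))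

      -- The interval has length about p / R, so L (R + 1) ≤ 4 p, and the upper end of the root
      -- bracket replaces (R + 1)^E by p^a.
      bound-from-root : k ^ E * p ^ a ≤ 4 ^ E * p ^ E
      bound-from-root = begin
        k ^ E * p ^ a  ≤⟨ *-mono-≤ (^-monoˡ-≤ E k≤L) (<⇒≤ p^a<) ⟩
        L ^ E * suc R ^ E  ≡⟨ ^-distribʳ-* E L (suc R) ⟨
        (L * suc R) ^ E  ≤⟨ ^-monoˡ-≤ E L[1+R]≤4p ⟩
        (4 * p) ^ E  ≡⟨ ^-distribʳ-* E 4 p ⟩
        4 ^ E * p ^ E  ∎
        where
        eq : ∀ l r → l * (r + r) ≡ 2 * (l * r)
        eq = solve-∀
        eq′ : ∀ q → 2 * (2 * q) ≡ 4 * q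
        eq′ = solve-∀
        L[1+R]≤4p : L * suc R ≤ 4 * p
        L[1+R]≤4p = begin
          L * suc R  ≤⟨ *-monoʳ-≤ L (+-monoˡ-≤ R 0<R) ⟩
          L * (R + R)  ≡⟨ eq L R ⟩
          2 * (L * R)  ≤⟨ *-monoʳ-≤ 2 LR≤2p ⟩
          2 * (2 * p)  ≡⟨ eq′ p ⟩
          4 * p  ∎

    bound : k ^ E * p ^ a ≤ 4 ^ E * p ^ E
    bound = bound-from-root (proj₁ root) (proj₁ (proj₂ root)) (proj₂ (proj₂ root))

odd⇒positive : ∀ n → n % 2 ≡ 1 → 0 < n
odd⇒positive (suc n) _ = z<s

-- Real exponents are represented by fractions ε = a / b, δ = c / d and the smallness threshold a₀ /
-- b₀. The inequalities n > p^ε and k ≤ C p^(1 - δ) are raised to the powers b and d.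
mainTheorem1 : ∃[ a₀ ] ∃[ b₀ ] (0 < a₀ × 0 < b₀ ×
    (∀ a b → 0 < a → 0 < b → a * b₀ < a₀ * b →
    ∃[ c ] ∃[ d ] (0 < c × 0 < d × ∃[ C ] (0 < C × ∃[ P₀ ]
    (∀ p n k → Prime p → P₀ ≤ p → n % 2 ≡ 1 → n ∣ p ∸ 1 →
    p ^ a < n ^ b → IsKpn p n k →
    k ^ d * p ^ c ≤ C ^ d * p ^ d)))))
mainTheorem1 = 1 , 1 , z<s , z<s , λ a b 0<a 0<b _ → let open Parameters b 0<b in
  -- Thus δ = a / E with E depending on b alone. The constant 4 combines the roundings in L and R,
  -- and p ≥ 16 ^ E ensures R ≥ 16, as the combinatorial part demands.
  a , E , 0<a , 0<E , 4 , z<s , 16 ^ E , λ p n k p-prime P₀≤p odd n∣p-1 p^a<n^b isKpn →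
  bound a 0<a p n k p-prime P₀≤p (odd⇒positive n odd) n∣p-1 p^a<n^b isKpn
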